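{- Let $\mathcal{P}$ be the digraph property of not containing $DK_3$, and let $\pi(\mathcal{P})$ be its entropy density. The number of digraphs on the labelled vertex set $[n]$ not containing any $DK_3$ is $$4^{\pi(\mathcal{P})\binom n2+o(n^2)}=3^{\binom n2-\lfloor n^2/4\rfloor}\,4^{\lfloor n^2/4\rfloor+o(n^2)}\qquad(n\to\infty).$$
   Context: A digraph on $[n]$ is a set of ordered pairs $\vec{ij}$ of distinct elements of $[n]$; both $\vec{ij}$ and $\vec{ji}$ may be present, in which case $ij$ is a double edge. $DK_3$ is the double triangle: three vertices with all three pairs being double edges. Not containing $DK_3$ means that there are no three vertices all three pairs of which are double edges. A digraph $D$ on $[n]$ is encoded as a $4$-colouring $c$ of $E(K_n)$: for $i<j$, $c(ij)=1$ if neither $\vec{ij}$ nor $\vec{ji}$ is in $D$, $2$ if only $\vec{ij}$ is, $3$ if only $\vec{ji}$ is, $4$ if both are. Under this encoding $\mathcal{P}_n$ is the set of $4$-colourings of $E(K_n)$ with no triangle all of whose edges have colour $4$. A template for $K_n$ is a function $t$ assigning to each edge $e$ a nonempty set $t(e)\subseteq\{1,2,3,4\}$; $\langle t\rangle$ is the set of colourings $c$ with $c(e)\in t(e)$ for all $e$; $\mathrm{Ent}(t)=\sum_e\log_4|t(e)|$; $\mathrm{ex}(n,\mathcal{P})=\max\{\mathrm{Ent}(t):\langle t\rangle\subseteq\mathcal{P}_n\}$; and $\pi(\mathcal{P})=\lim_{n\to\infty}\mathrm{ex}(n,\mathcal{P})/\binom n2$ (the limit exists). -}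

module Defs where

open import Data.Bool.Base using (true; false)
open import Data.Fin.Base using (Fin; _<_)
open import Data.Fin.Patterns using (3F)
open import Data.Fin.Properties as Fin using (_<?_; any?; all?)
open import Data.Fin.Subset using (Subset; Nonempty; _∈_; ∣_∣)
open import Data.Fin.Subset.Properties using (_∈?_)
open import Data.Integer.Base as ℤ using (+_)
import Data.Integer.Properties as ℤ
import Data.Integer.Solver as ℤSolver
open import Data.List.Base using (List; []; _∷_; map; foldr; length; filter; mapMaybe; allFin; cartesianProduct; cartesianProductWith)
open import Data.Maybe.Base as Maybe using (Maybe)
open import Data.Nat.Base as ℕ using (ℕ; zero; suc; NonZero; z≤n; s≤s; ⌊_/2⌋)
open import Data.Nat.Combinatorics using (_C_)
open import Data.Nat.Induction using (<-wellFounded)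
open import Data.Nat.Logarithm using (⌊log₂_⌋)
open import Data.Nat.Logarithm.Core using (⌊log2⌋)
import Data.Nat.Properties as ℕ
import Data.Nat.Solver as ℕSolver
open import Data.Product using (Σ-syntax; ∃; ∃-syntax; _×_; _,_)
open import Data.Rational.Base as ℚ using (ℚ; 0ℚ; 1ℚ; ½; mkℚ)
import Data.Rational.Properties as ℚ
open import Data.Rational.Solver using (module +-*-Solver)
open import Data.Rational.Unnormalised.Base as ℚᵘ using (mkℚᵘ)
import Data.Rational.Unnormalised.Properties as ℚᵘ
open import Data.Sum.Base using (inj₁; inj₂)
open import Data.Vec.Base as Vec using (Vec; lookup)
open import Induction.WellFounded using (Acc; acc)
open import Relation.Binary.PropositionalEquality
open import Relation.Nullary.Decidable using (Dec; ¬?; _×-dec_; dec⇒maybe)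
open import Relation.Nullary.Negation using (¬_)

record ℝ : Set where
  constructor mkℝ
  field
    seq    : ℕ → ℚ
    cauchy : ∀ ε → 0ℚ ℚ.< ε →
             ∃[ N ] ∀ m n → N ℕ.≤ m → N ℕ.≤ n → ℚ.∣ seq m ℚ.- seq n ∣ ℚ.≤ ε

open ℝ public

infix  4 _≃ᴿ_ _≤ᴿ_
infixl 6 _+ᴿ_ _-ᴿ_
infixl 7 _·ᴿ_ _÷ℕ_

_≃ᴿ_ : ℝ → ℝ → Set
x ≃ᴿ y = ∀ ε → 0ℚ ℚ.< ε →
  ∃[ N ] ∀ n → N ℕ.≤ n → ℚ.∣ seq x n ℚ.- seq y n ∣ ℚ.≤ ε

_≤ᴿ_ : ℝ → ℝ → Set
x ≤ᴿ y = ∀ ε → 0ℚ ℚ.< ε →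
  ∃[ N ] ∀ n → N ℕ.≤ n → seq x n ℚ.≤ seq y n ℚ.+ ε

½-pos : ∀ {ε} → 0ℚ ℚ.< ε → 0ℚ ℚ.< ½ ℚ.* ε
½-pos {ε} ε>0 = ℚ.positive⁻¹ (½ ℚ.* ε) {{ℚ.pos*pos⇒pos ½ ε {{ℚ.positive ε>0}}}}

½+½ : ∀ ε → ½ ℚ.* ε ℚ.+ ½ ℚ.* ε ≡ ε
½+½ ε = trans (sym (ℚ.*-distribʳ-+ ε ½ ½)) (ℚ.*-identityˡ ε)

interchange : ∀ a b c d → (a ℚ.+ b) ℚ.- (c ℚ.+ d) ≡ (a ℚ.- c) ℚ.+ (b ℚ.- d)
interchange = solve 4 (λ a b c d → (a :+ b) :- (c :+ d) := (a :- c) :+ (b :- d)) refl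
  where open +-*-Solver

neg-swap : ∀ a b → ℚ.- (a ℚ.- b) ≡ b ℚ.- a
neg-swap = solve 2 (λ a b → :- (a :- b) := b :- a) refl
  where open +-*-Solver

neg-sub : ∀ a b → ℚ.- a ℚ.- ℚ.- b ≡ b ℚ.- a
neg-sub = solve 2 (λ a b → :- a :- :- b := b :- a) refl
  where open +-*-Solver

≤⇒dist≤ : ∀ a b {ε} → a ℚ.- b ℚ.≤ ε → b ℚ.- a ℚ.≤ ε → ℚ.∣ a ℚ.- b ∣ ℚ.≤ ε
≤⇒dist≤ a b p q with ℚ.∣p∣≡p∨∣p∣≡-p (a ℚ.- b)
... | inj₁ e = subst (ℚ._≤ _) (sym e) p
... | inj₂ e = subst (ℚ._≤ _) (sym (trans e (neg-swap a b))) q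

∣∣-sub : ∀ a b → ℚ.∣ a ∣ ℚ.- ℚ.∣ b ∣ ℚ.≤ ℚ.∣ a ℚ.- b ∣
∣∣-sub a b = begin
  ℚ.∣ a ∣ ℚ.- ℚ.∣ b ∣                         ≡⟨ cong (λ z → ℚ.∣ z ∣ ℚ.- ℚ.∣ b ∣) (lem a b) ⟩
  ℚ.∣ (a ℚ.- b) ℚ.+ b ∣ ℚ.- ℚ.∣ b ∣           ≤⟨ ℚ.+-monoˡ-≤ (ℚ.- ℚ.∣ b ∣) (ℚ.∣p+q∣≤∣p∣+∣q∣ (a ℚ.- b) b) ⟩
  ℚ.∣ a ℚ.- b ∣ ℚ.+ ℚ.∣ b ∣ ℚ.- ℚ.∣ b ∣       ≡⟨ lem′ ℚ.∣ a ℚ.- b ∣ ℚ.∣ b ∣ ⟩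
  ℚ.∣ a ℚ.- b ∣                               ∎
  where
  open ℚ.≤-Reasoning
  open +-*-Solver
  lem : ∀ a b → a ≡ (a ℚ.- b) ℚ.+ b
  lem = solve 2 (λ a b → a := (a :- b) :+ b) refl
  lem′ : ∀ a b → (a ℚ.+ b) ℚ.- b ≡ a
  lem′ = solve 2 (λ a b → (a :+ b) :- b := a) refl

fromℚ : ℚ → ℝ
fromℚ q = mkℝ (λ _ → q) λ ε ε>0 →
  0 , λ _ _ _ _ → ℚ.≤-trans (ℚ.≤-reflexive (cong ℚ.∣_∣ (ℚ.+-inverseʳ q))) (ℚ.<⇒≤ ε>0)

ℕ→ℚ : ℕ → ℚ
ℕ→ℚ n = + n ℚ./ 1

fromℕ : ℕ → ℝ
fromℕ n = fromℚ (ℕ→ℚ n)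

0ᴿ : ℝ
0ᴿ = fromℚ 0ℚ

_+ᴿ_ : ℝ → ℝ → ℝ
x +ᴿ y = mkℝ (λ n → seq x n ℚ.+ seq y n) λ ε ε>0 →
  let M , hM = cauchy x (½ ℚ.* ε) (½-pos ε>0)
      N , hN = cauchy y (½ ℚ.* ε) (½-pos ε>0)
  in M ℕ.⊔ N , λ m n p q →
    let open ℚ.≤-Reasoning
        a = seq x m ; b = seq y m ; c = seq x n ; d = seq y n
    in begin
      ℚ.∣ (a ℚ.+ b) ℚ.- (c ℚ.+ d) ∣          ≡⟨ cong ℚ.∣_∣ (interchange a b c d) ⟩
      ℚ.∣ (a ℚ.- c) ℚ.+ (b ℚ.- d) ∣          ≤⟨ ℚ.∣p+q∣≤∣p∣+∣q∣ (a ℚ.- c) (b ℚ.- d) ⟩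
      ℚ.∣ a ℚ.- c ∣ ℚ.+ ℚ.∣ b ℚ.- d ∣
        ≤⟨ ℚ.+-mono-≤ (hM m n (ℕ.m⊔n≤o⇒m≤o M N p) (ℕ.m⊔n≤o⇒m≤o M N q))
                      (hN m n (ℕ.m⊔n≤o⇒n≤o M N p) (ℕ.m⊔n≤o⇒n≤o M N q)) ⟩
      ½ ℚ.* ε ℚ.+ ½ ℚ.* ε                    ≡⟨ ½+½ ε ⟩
      ε                                      ∎

-ᴿ_ : ℝ → ℝ
-ᴿ x = mkℝ (λ n → ℚ.- seq x n) λ ε ε>0 →
  let N , h = cauchy x ε ε>0
  in N , λ m n p q →
    subst (ℚ._≤ ε) (cong ℚ.∣_∣ (sym (neg-sub (seq x m) (seq x n)))) (h n m q p)

_-ᴿ_ : ℝ → ℝ → ℝ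
x -ᴿ y = x +ᴿ (-ᴿ y)

∣_∣ᴿ : ℝ → ℝ
∣ x ∣ᴿ = mkℝ (λ n → ℚ.∣ seq x n ∣) λ ε ε>0 →
  let N , h = cauchy x ε ε>0
  in N , λ m n p q →
    ≤⇒dist≤ ℚ.∣ seq x m ∣ ℚ.∣ seq x n ∣
            (ℚ.≤-trans (∣∣-sub (seq x m) (seq x n)) (h m n p q))
            (ℚ.≤-trans (∣∣-sub (seq x n) (seq x m)) (h n m q p))

_·ᴿ_ : ℚ → ℝ → ℝ
r ·ᴿ x = mkℝ (λ n → r ℚ.* seq x n) λ ε ε>0 →
  let s = ℚ.∣ r ∣ ℚ.+ 1ℚ
      instance
        ε⁺ : ℚ.Positive ε
        ε⁺ = ℚ.positive ε>0
        r⁺ : ℚ.NonNegative ℚ.∣ r ∣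
        r⁺ = ℚ.∣-∣-nonNeg r
        s⁺ : ℚ.Positive s
        s⁺ = ℚ.nonNeg+pos⇒pos ℚ.∣ r ∣ 1ℚ
        s≢0 : ℚ.NonZero s
        s≢0 = ℚ.pos⇒nonZero s
        s⁻¹⁺ : ℚ.Positive (ℚ.1/ s)
        s⁻¹⁺ = ℚ.1/pos⇒pos s
        δ⁺ : ℚ.Positive (ℚ.1/ s ℚ.* ε)
        δ⁺ = ℚ.pos*pos⇒pos (ℚ.1/ s) ε
        δ⁰⁺ : ℚ.NonNegative (ℚ.1/ s ℚ.* ε)
        δ⁰⁺ = ℚ.pos⇒nonNeg (ℚ.1/ s ℚ.* ε)
      δ = ℚ.1/ s ℚ.* ε
      N , h = cauchy x δ (ℚ.positive⁻¹ δ)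
      r≤s : ℚ.∣ r ∣ ℚ.≤ s
      r≤s = subst (ℚ._≤ s) (ℚ.+-identityʳ ℚ.∣ r ∣) (ℚ.+-monoʳ-≤ ℚ.∣ r ∣ (ℚ.nonNegative⁻¹ 1ℚ))
  in N , λ m n p q →
    let open ℚ.≤-Reasoning
        a = seq x m ; b = seq x n
    in begin
      ℚ.∣ r ℚ.* a ℚ.- r ℚ.* b ∣      ≡⟨ cong ℚ.∣_∣ (·-sub r a b) ⟩
      ℚ.∣ r ℚ.* (a ℚ.- b) ∣          ≡⟨ ℚ.∣p*q∣≡∣p∣*∣q∣ r (a ℚ.- b) ⟩
      ℚ.∣ r ∣ ℚ.* ℚ.∣ a ℚ.- b ∣      ≤⟨ ℚ.*-monoˡ-≤-nonNeg ℚ.∣ r ∣ (h m n p q) ⟩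
      ℚ.∣ r ∣ ℚ.* δ                  ≤⟨ ℚ.*-monoʳ-≤-nonNeg δ r≤s ⟩
      s ℚ.* δ                        ≡⟨ sym (ℚ.*-assoc s (ℚ.1/ s) ε) ⟩
      s ℚ.* ℚ.1/ s ℚ.* ε             ≡⟨ cong (ℚ._* ε) (ℚ.*-inverseʳ s) ⟩
      1ℚ ℚ.* ε                       ≡⟨ ℚ.*-identityˡ ε ⟩
      ε                              ∎
  where
  ·-sub : ∀ r a b → r ℚ.* a ℚ.- r ℚ.* b ≡ r ℚ.* (a ℚ.- b)
  ·-sub = solve 3 (λ r a b → r :* a :- r :* b := r :* (a :- b)) refl
    where open +-*-Solver

-- x ÷ℕ 0 = 0 by convention.
_÷ℕ_ : ℝ → ℕ → ℝ
x ÷ℕ zero  = 0ᴿ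
x ÷ℕ suc m = (+ 1 ℚ./ suc m) ·ᴿ x

sumᴿ : List ℝ → ℝ
sumᴿ = foldr _+ᴿ_ 0ᴿ

infix 4 _⟶_ _≪_

_⟶_ : (ℕ → ℝ) → ℝ → Set
x ⟶ ℓ = ∀ ε → 0ℚ ℚ.< ε → ∃[ N ] ∀ n → N ℕ.≤ n → ∣ x n -ᴿ ℓ ∣ᴿ ≤ᴿ fromℚ ε

-- g ≪ f means g = o(f).
_≪_ : (ℕ → ℝ) → (ℕ → ℕ) → Set
g ≪ f = ∀ ε → 0ℚ ℚ.< ε →
  ∃[ N ] ∀ n → N ℕ.≤ n → ∣ g n ∣ᴿ ≤ᴿ fromℚ (ε ℚ.* ℕ→ℚ (f n))

half-bounds : ∀ n → 2 ℕ.* ⌊ n /2⌋ ℕ.≤ n × n ℕ.≤ suc (2 ℕ.* ⌊ n /2⌋)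
half-bounds zero          = z≤n , z≤n
half-bounds (suc zero)    = z≤n , s≤s z≤n
half-bounds (suc (suc n)) with half-bounds n
... | p , q rewrite ℕ.*-suc 2 ⌊ n /2⌋ = s≤s (s≤s p) , s≤s (s≤s q)

log-lower : ∀ n (a : Acc ℕ._<_ (suc n)) → 2 ℕ.^ ⌊log2⌋ (suc n) a ℕ.≤ suc n
log-lower zero    _        = ℕ.≤-refl
log-lower (suc n) (acc rs) with half-bounds n
... | p , _ = begin
  2 ℕ.* 2 ℕ.^ ⌊log2⌋ (suc ⌊ n /2⌋) _  ≤⟨ ℕ.*-monoʳ-≤ 2 (log-lower ⌊ n /2⌋ _) ⟩
  2 ℕ.* suc ⌊ n /2⌋                   ≡⟨ ℕ.*-suc 2 ⌊ n /2⌋ ⟩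
  2 ℕ.+ 2 ℕ.* ⌊ n /2⌋                 ≤⟨ s≤s (s≤s p) ⟩
  suc (suc n)                         ∎
  where open ℕ.≤-Reasoning

log-upper : ∀ n (a : Acc ℕ._<_ (suc n)) → suc n ℕ.< 2 ℕ.^ suc (⌊log2⌋ (suc n) a)
log-upper zero    _        = ℕ.≤-refl
log-upper (suc n) (acc rs) with half-bounds n
... | _ , q = begin
  3 ℕ.+ n                               ≤⟨ s≤s (s≤s (s≤s q)) ⟩
  4 ℕ.+ 2 ℕ.* ⌊ n /2⌋                   ≡⟨ sym (trans (ℕ.*-suc 2 (suc ⌊ n /2⌋)) (cong (2 ℕ.+_) (ℕ.*-suc 2 ⌊ n /2⌋))) ⟩
  2 ℕ.* suc (suc ⌊ n /2⌋)               ≤⟨ ℕ.*-monoʳ-≤ 2 (log-upper ⌊ n /2⌋ _) ⟩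
  2 ℕ.* 2 ℕ.^ suc (⌊log2⌋ (suc ⌊ n /2⌋) _) ∎
  where open ℕ.≤-Reasoning

⌊log₂⌋-lower : ∀ n .{{_ : NonZero n}} → 2 ℕ.^ ⌊log₂ n ⌋ ℕ.≤ n
⌊log₂⌋-lower (suc n) = log-lower n (<-wellFounded (suc n))

⌊log₂⌋-upper : ∀ n .{{_ : NonZero n}} → n ℕ.< 2 ℕ.^ suc ⌊log₂ n ⌋
⌊log₂⌋-upper (suc n) = log-upper n (<-wellFounded (suc n))

log-cross : ∀ m J K .{{_ : NonZero J}} .{{_ : NonZero K}} →
            ⌊log₂ m ℕ.^ J ⌋ ℕ.* K ℕ.≤ suc ⌊log₂ m ℕ.^ K ⌋ ℕ.* J
log-cross zero      (suc J) (suc K) = z≤n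
log-cross m@(suc _) J       K       = ℕ.≮⇒≥ λ lt → ℕ.<-irrefl refl (begin-strict
  m ℕ.^ (J ℕ.* K)       ≡⟨ cong (m ℕ.^_) (ℕ.*-comm J K) ⟩
  m ℕ.^ (K ℕ.* J)       ≡⟨ ℕ.^-*-assoc m K J ⟨
  (m ℕ.^ K) ℕ.^ J       ≤⟨ ℕ.^-monoˡ-≤ J (ℕ.<⇒≤ (⌊log₂⌋-upper (m ℕ.^ K) {{ℕ.m^n≢0 m K}})) ⟩
  (2 ℕ.^ B) ℕ.^ J       ≡⟨ ℕ.^-*-assoc 2 B J ⟩
  2 ℕ.^ (B ℕ.* J)       <⟨ ℕ.^-monoʳ-< 2 (s≤s (s≤s z≤n)) lt ⟩
  2 ℕ.^ (A ℕ.* K)       ≡⟨ ℕ.^-*-assoc 2 A K ⟨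
  (2 ℕ.^ A) ℕ.^ K       ≤⟨ ℕ.^-monoˡ-≤ K (⌊log₂⌋-lower (m ℕ.^ J) {{ℕ.m^n≢0 m J}}) ⟩
  (m ℕ.^ J) ℕ.^ K       ≡⟨ ℕ.^-*-assoc m J K ⟩
  m ℕ.^ (J ℕ.* K)       ∎)
  where
  open ℕ.≤-Reasoning
  A = ⌊log₂ m ℕ.^ J ⌋
  B = suc ⌊log₂ m ℕ.^ K ⌋

-- For K = suc k, log₄ m = log₂ (m ^ K) / 2K, so rounding log₂ (m ^ K) down gives
-- an approximation from below with error less than 1 / 2K.
log₄-approx : ℕ → ℕ → ℚ
log₄-approx m k = + ⌊log₂ m ℕ.^ suc k ⌋ ℚ./ (2 ℕ.* suc k)

/-mono : ∀ a b c d → a ℕ.* suc d ℕ.≤ c ℕ.* suc b → + a ℚ./ suc b ℚ.≤ + c ℚ./ suc d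
/-mono a b c d h = ℚ.toℚᵘ-cancel-≤ (begin
  ℚ.toℚᵘ (+ a ℚ./ suc b)  ≃⟨ ℚ.toℚᵘ-fromℚᵘ (mkℚᵘ (+ a) b) ⟩
  mkℚᵘ (+ a) b            ≤⟨ ℚᵘ.*≤* (subst₂ ℤ._≤_ (ℤ.pos-* a (suc d)) (ℤ.pos-* c (suc b)) (ℤ.+≤+ h)) ⟩
  mkℚᵘ (+ c) d            ≃⟨ ℚ.toℚᵘ-fromℚᵘ (mkℚᵘ (+ c) d) ⟨
  ℚ.toℚᵘ (+ c ℚ./ suc d)  ∎)
  where open ℚᵘ.≤-Reasoning

/-suc : ∀ a d → + suc a ℚ./ suc d ≡ + a ℚ./ suc d ℚ.+ + 1 ℚ./ suc d
/-suc a d = ℚ.toℚᵘ-injective (begin-equality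
  ℚ.toℚᵘ (+ suc a ℚ./ suc d)  ≃⟨ ℚ.toℚᵘ-fromℚᵘ (mkℚᵘ (+ suc a) d) ⟩
  mkℚᵘ (+ suc a) d            ≃⟨ ℚᵘ.*≡* lem ⟩
  mkℚᵘ (+ a) d ℚᵘ.+ mkℚᵘ (+ 1) d
    ≃⟨ ℚᵘ.+-cong (ℚ.toℚᵘ-fromℚᵘ (mkℚᵘ (+ a) d)) (ℚ.toℚᵘ-fromℚᵘ (mkℚᵘ (+ 1) d)) ⟨
  ℚ.toℚᵘ (+ a ℚ./ suc d) ℚᵘ.+ ℚ.toℚᵘ (+ 1 ℚ./ suc d)
    ≃⟨ ℚ.toℚᵘ-homo-+ (+ a ℚ./ suc d) (+ 1 ℚ./ suc d) ⟨
  ℚ.toℚᵘ (+ a ℚ./ suc d ℚ.+ + 1 ℚ./ suc d) ∎)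
  where
  open ℚᵘ.≤-Reasoning
  open ℤSolver.+-*-Solver
  lem : + suc a ℤ.* + (suc d ℕ.* suc d) ≡ (+ a ℤ.* + suc d ℤ.+ + 1 ℤ.* + suc d) ℤ.* + suc d
  lem = trans (cong (+ suc a ℤ.*_) (ℤ.pos-* (suc d) (suc d)))
    (solve 2 (λ a d → (con (+ 1) :+ a) :* (d :* d) := (a :* d :+ con (+ 1) :* d) :* d) refl (+ a) (+ suc d))

ℚ-archimedean : ∀ ε → 0ℚ ℚ.< ε → ∃[ N ] ∀ n → N ℕ.≤ n → + 1 ℚ./ (2 ℕ.* suc n) ℚ.≤ ε
ℚ-archimedean (mkℚ (+ zero)   d c) (ℚ.*<* (ℤ.+<+ ()))
ℚ-archimedean ε@(mkℚ (+ suc a) d c) _ = d , λ n d≤n →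
  subst (+ 1 ℚ./ (2 ℕ.* suc n) ℚ.≤_) (ℚ.fromℚᵘ-toℚᵘ ε)
    (/-mono 1 (n ℕ.+ suc (n ℕ.+ 0)) (suc a) d (begin
      1 ℕ.* suc d              ≡⟨ ℕ.*-identityˡ (suc d) ⟩
      suc d                    ≤⟨ s≤s d≤n ⟩
      suc n                    ≤⟨ ℕ.m≤m+n (suc n) (suc n ℕ.+ 0) ⟩
      2 ℕ.* suc n              ≤⟨ ℕ.m≤n*m (2 ℕ.* suc n) (suc a) ⟩
      suc a ℕ.* (2 ℕ.* suc n)  ∎))
  where open ℕ.≤-Reasoning

log₄-dist : ∀ m j k {ε} → + 1 ℚ./ (2 ℕ.* suc k) ℚ.≤ ε →
            log₄-approx m j ℚ.- log₄-approx m k ℚ.≤ ε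
log₄-dist m j k {ε} k-large = begin
  x ℚ.- y          ≤⟨ ℚ.+-monoˡ-≤ (ℚ.- y) step ⟩
  (y ℚ.+ δ) ℚ.- y  ≡⟨ cancel y δ ⟩
  δ                ≤⟨ k-large ⟩
  ε                ∎
  where
  open ℚ.≤-Reasoning
  x = log₄-approx m j
  y = log₄-approx m k
  δ = + 1 ℚ./ (2 ℕ.* suc k)
  A = ⌊log₂ m ℕ.^ suc j ⌋
  B = ⌊log₂ m ℕ.^ suc k ⌋
  cancel : ∀ y d → (y ℚ.+ d) ℚ.- y ≡ d
  cancel = solve 2 (λ y d → (y :+ d) :- y := d) refl
    where open +-*-Solver
  double : ∀ a n → a ℕ.* (2 ℕ.* n) ≡ 2 ℕ.* (a ℕ.* n)
  double = solve 2 (λ a n → a :* (con 2 :* n) := con 2 :* (a :* n)) refl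
    where open ℕSolver.+-*-Solver
  step : x ℚ.≤ y ℚ.+ δ
  step = subst (x ℚ.≤_) (/-suc B (k ℕ.+ suc (k ℕ.+ 0)))
    (/-mono A (j ℕ.+ suc (j ℕ.+ 0)) (suc B) (k ℕ.+ suc (k ℕ.+ 0))
      (subst₂ ℕ._≤_ (sym (double A (suc k))) (sym (double (suc B) (suc j)))
        (ℕ.*-monoʳ-≤ 2 (log-cross m (suc j) (suc k)))))

-- The logarithm of m ≥ 1; by convention log₄ 0 = 0.
log₄ : ℕ → ℝ
log₄ m = mkℝ (log₄-approx m) λ ε ε>0 →
  let N , h = ℚ-archimedean ε ε>0
  in N , λ j k N≤j N≤k →
    ≤⇒dist≤ (log₄-approx m j) (log₄-approx m k)
            (log₄-dist m j k (h k N≤k))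
            (log₄-dist m k j (h j N≤j))

-- N ≈ M ·4^ x states N = M · 4ˣ for positive integers N, M and real x, the real
-- power 4ˣ being understood through its inverse log₄.
infix 4 _≈_·4^_

_≈_·4^_ : ℕ → ℕ → ℝ → Set
N ≈ M ·4^ x = 0 ℕ.< N × 0 ℕ.< M × log₄ N ≃ᴿ log₄ M +ᴿ x

record Edge (n : ℕ) : Set where
  constructor edge
  field
    lo hi  : Fin n
    .lo<hi : lo < hi

toEdge : ∀ {n} → Fin n × Fin n → Maybe (Edge n)
toEdge (i , j) = Maybe.map (λ i<j → edge i j i<j) (dec⇒maybe (i <? j))

edges : ∀ n → List (Edge n)
edges n = mapMaybe toEdge (cartesianProduct (allFin n) (allFin n))

-- A digraph gives the pair i < j colour 0F, 1F, 2F or 3F according as it contains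
-- neither arc, only i → j, only j → i, or both.
Colouring : ℕ → Set
Colouring n = Edge n → Fin 4

Property : Set₁
Property = ∀ n → Colouring n → Set

record Template (n : ℕ) : Set where
  field
    palette  : Edge n → Subset 4
    nonempty : ∀ e → Nonempty (palette e)

open Template public

⟨_⟩ : ∀ {n} → Template n → Colouring n → Set
⟨ t ⟩ c = ∀ e → c e ∈ palette t e

Ent : ∀ {n} → Template n → ℝ
Ent {n} t = sumᴿ (map (λ e → log₄ ∣ palette t e ∣) (edges n))

module _ (𝓟 : Property) where

  Admissible : ∀ {n} → Template n → Set
  Admissible {n} t = ∀ c → ⟨ t ⟩ c → 𝓟 n c

  -- x = max { Ent t : ⟨ t ⟩ ⊆ 𝓟ₙ }
  IsEx : ℕ → ℝ → Set
  IsEx n x = (Σ[ t ∈ Template n ] (Admissible t × Ent t ≃ᴿ x))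
           × (∀ (t : Template n) → Admissible t → Ent t ≤ᴿ x)

  IsEntropyDensity : ℝ → Set
  IsEntropyDensity π = Σ[ ex ∈ (ℕ → ℝ) ]
    (∀ n → IsEx n (ex n)) × (λ n → ex n ÷ℕ (n C 2)) ⟶ π

-- Colour 3F marks the double edges, so these colourings encode the digraphs
-- containing no DK₃.
NoDK₃ : Property
NoDK₃ n c = ∀ {i j k : Fin n} (i<j : i < j) (j<k : j < k) →
  ¬ (c (edge i j i<j) ≡ 3F × c (edge j k j<k) ≡ 3F ×
     c (edge i k (Fin.<-trans i<j j<k)) ≡ 3F)

-- Entry i is the set of out-neighbours of vertex i.
Adjacency : ℕ → Set
Adjacency n = Vec (Subset n) n

Arc : ∀ {n} → Adjacency n → Fin n → Fin n → Set
Arc D i j = j ∈ lookup D i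

IsDigraph : ∀ {n} → Adjacency n → Set
IsDigraph D = ∀ i → ¬ Arc D i i

DoubleEdge : ∀ {n} → Adjacency n → Fin n → Fin n → Set
DoubleEdge D i j = Arc D i j × Arc D j i

ContainsDK₃ : ∀ {n} → Adjacency n → Set
ContainsDK₃ D = ∃[ i ] ∃[ j ] ∃[ k ]
  (i ≢ j × j ≢ k × i ≢ k) × DoubleEdge D i j × DoubleEdge D j k × DoubleEdge D i k

isDigraph? : ∀ {n} (D : Adjacency n) → Dec (IsDigraph D)
isDigraph? D = all? λ i → ¬? (i ∈? lookup D i)

doubleEdge? : ∀ {n} (D : Adjacency n) i j → Dec (DoubleEdge D i j)
doubleEdge? D i j = (j ∈? lookup D i) ×-dec (i ∈? lookup D j)

containsDK₃? : ∀ {n} (D : Adjacency n) → Dec (ContainsDK₃ D)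
containsDK₃? D = any? λ i → any? λ j → any? λ k →
  (¬? (i Fin.≟ j) ×-dec ¬? (j Fin.≟ k) ×-dec ¬? (i Fin.≟ k))
  ×-dec doubleEdge? D i j ×-dec doubleEdge? D j k ×-dec doubleEdge? D i k

-- All vectors of length n with entries from xs, each listed once if xs is
-- duplicate-free.
vectors : ∀ {A : Set} → List A → ∀ n → List (Vec A n)
vectors xs zero    = Vec.[] ∷ []
vectors xs (suc n) = cartesianProductWith Vec._∷_ xs (vectors xs n)

adjacencies : ∀ n → List (Adjacency n)
adjacencies n = vectors (vectors (false ∷ true ∷ []) n) n

numDK₃Free : ℕ → ℕ
numDK₃Free n =
  length (filter (λ D → isDigraph? D ×-dec ¬? (containsDK₃? D)) (adjacencies n))

{-# OPTIONS --safe #-}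
module Submission where

-- Upper bound on the count. Fix a constant d and take a set X of 30d vertices of a
-- DK₃-free digraph. Either many outside vertices have at least d double neighbours in
-- X, and then by pigeonhole the double edges contain a complete bipartite graph K(d,d);
-- or all but boundedly many outside vertices have fewer than d double neighbours in X.
-- In the first case delete the K(d,d): an outside vertex can have double neighbours on
-- one side only, so it has at most 2·12^d ways to be joined to the 2d deleted vertices.
-- In the second case delete X: a typical outside vertex has at most 12^(15d) ways to be
-- joined to it. Either way deleting 2z of 2z + j vertices costs about 12^(zj), which is
-- what ⌊k²/4⌋ in 12^⌊k²/4⌋ accounts for, with an error of 2^O(k) per round and at most
-- k/2d rounds. Hence there are at most 12^(n²/4) · 2^(O(n²/d)) such digraphs, and d is
-- arbitrary.
--
-- Lower bound: allow double edges only across a balanced bipartition.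
--
-- Entropy: in an admissible template the pairs with full palette form a triangle-free
-- graph, so by Mantel's theorem there are at most ⌊n²/4⌋ of them, and every other pair
-- contributes at most log₄ 3. Hence ex(n) = (n C 2 - ⌊n²/4⌋) log₄ 3 + ⌊n²/4⌋, which is
-- the logarithm of the count up to o(n²), and the density is ½ + ½ log₄ 3.

open import Defs
open import Data.Bool.Base using (Bool; true; false; if_then_else_; _∨_; _xor_)
import Data.Bool.Properties as Bool
open import Data.Empty using (⊥-elim-irr)
open import Data.Fin.Base as Fin using (Fin; zero; suc)
open import Data.Fin.Patterns using (0F; 3F)
import Data.Fin.Properties as Fin
open import Data.Fin.Subset using (Subset; ∣_∣) renaming (_∈_ to _∈ˢ_)
open import Data.Fin.Subset.Properties using (∣p∣≤n)
import Data.Integer.Base as ℤ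
open import Data.List.Base using (List; []; _∷_; _++_; length; map; filter; take; drop; allFin; mapMaybe; cartesianProduct; cartesianProductWith)
open import Data.List.Properties using (length-++; length-++-sucʳ; length-map; length-tabulate; length-take; length-drop; take++drop≡id; filter-++; filter-all; filter-accept; filter-reject; map-++; map-∘; map-cong; map-tabulate)
import Data.List.Membership.DecPropositional as DecMembership
open import Data.List.Membership.Propositional using (_∈_; find; lose)
open import Data.List.Membership.Propositional.Properties using (∈-++⁺ˡ; ∈-++⁺ʳ; ∈-++⁻; ∈-map⁺; ∈-filter⁺; ∈-filter⁻; ∈-allFin; ∈-∃++; ∈-cartesianProductWith⁺; ∈-cartesianProductWith⁻)
open import Data.List.Relation.Binary.Permutation.Propositional as Perm using (_↭_; refl; prep; swap; ↭-refl; ↭-trans)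
open import Data.List.Relation.Binary.Permutation.Propositional.Properties using (shift; ↭-length; Any-resp-↭) renaming (map⁺ to ↭-map⁺)
open import Data.List.Relation.Binary.Sublist.Propositional as Sublist using (_⊆_; []; _∷ʳ_; _∷_; ⊆-refl; ⊆-trans)
open import Data.List.Relation.Binary.Sublist.Propositional.Properties using (filter-⊆; take-⊆)
open import Data.List.Relation.Binary.Subset.Propositional using () renaming (_⊆_ to _⊆ˢ_)
open import Data.List.Relation.Ternary.Interleaving.Properties using (interleave-length)
open import Data.List.Relation.Ternary.Interleaving.Propositional using (Interleaving; []; consˡ; consʳ; toPermutation)
open import Data.List.Relation.Unary.All as All using (All; []; _∷_)
import Data.List.Relation.Unary.All.Properties as All
open import Data.List.Relation.Unary.AllPairs using (AllPairs; []; _∷_)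
import Data.List.Relation.Unary.AllPairs.Properties as AllPairs
open import Data.List.Relation.Unary.Any as Any using (Any; here; there; any?)
import Data.List.Relation.Unary.Any.Properties as Any
open import Data.List.Relation.Unary.Unique.Propositional using (Unique)
import Data.List.Relation.Unary.Unique.Propositional.Properties as Unique
open import Data.Nat hiding (_≟_)
open import Data.Nat.Combinatorics using (_C_; nC1≡n; nCk+nC[k+1]≡[n+1]C[k+1])
open import Data.Nat.DivMod using (m*n/n≡m; +-distrib-/-∣ˡ; m/n*n≤m; m≡m%n+[m/n]*n; m%n<n)
open import Data.Nat.Divisibility using (divides)
open import Data.Nat.ListAction using (sum)
open import Data.Nat.ListAction.Properties using (sum-++; sum-↭)
open import Data.Nat.Logarithm using (⌊log₂_⌋; ⌊log₂⌋-mono-≤; ⌊log₂[2^n]⌋≡n)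
open import Data.Nat.Properties as ℕ hiding (_≟_)
open import Algebra.Properties.CommutativeSemigroup +-commutativeSemigroup using () renaming (interchange to +-interchange)
open import Algebra.Properties.CommutativeSemigroup *-commutativeSemigroup using () renaming (interchange to *-interchange)
import Data.Nat.Solver as ℕSolver
open import Data.Product using (∃; ∃₂; ∃-syntax; _×_; _,_; proj₁; proj₂; uncurry)
open import Data.Rational.Base as ℚ using (ℚ; 0ℚ; 1ℚ; ½)
import Data.Rational.Properties as ℚ
import Data.Rational.Solver as ℚSolver
open import Data.Sum.Base as Sum using (_⊎_; inj₁; inj₂; [_,_]′)
open import Data.Unit using (tt)
open import Data.Vec.Base as Vec using (Vec; []; _∷_; here; lookup; tabulate; zipWith)
open import Data.Vec.Properties using (∷-injective; lookup-map; lookup-zipWith; tabulate-cong; tabulate∘lookup; []=⇒lookup; lookup⇒[]=)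
open import Function.Base using (_∘_; _on_; id; it)
open import Level using (0ℓ)
open import Relation.Binary.Core using (Rel)
import Relation.Binary.Definitions as Binary
open import Relation.Binary.PropositionalEquality
open import Relation.Nullary.Decidable using (Dec; yes; no; does; ¬?; _×-dec_; _⊎-dec_)
open import Relation.Nullary.Negation using (¬_; contradiction)
open import Relation.Unary using (Pred; _∪_; Decidable)
open import Relation.Unary.Properties using (∁?)

-- Powers, products and splittings of lists

^-distribʳ-* : ∀ n a b → (a * b) ^ n ≡ a ^ n * b ^ n
^-distribʳ-* zero    a b = refl
^-distribʳ-* (suc n) a b = trans (cong (a * b *_) (^-distribʳ-* n a b)) (*-interchange a b (a ^ n) (b ^ n))

length-cartesianProductWith : ∀ {A B C : Set} (f : A → B → C) xs ys →
  length (cartesianProductWith f xs ys) ≡ length xs * length ys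
length-cartesianProductWith f []       ys = refl
length-cartesianProductWith f (x ∷ xs) ys = trans (length-++ (map (f x) ys))
  (cong₂ _+_ (length-map (f x) ys) (length-cartesianProductWith f xs ys))

filter-interleaving : ∀ {A : Set} {P : Pred A 0ℓ} (P? : Decidable P) xs →
  Interleaving (filter P? xs) (filter (∁? P?) xs) xs
filter-interleaving P? []       = []
filter-interleaving P? (x ∷ xs) with P? x
... | yes _ = consˡ (filter-interleaving P? xs)
... | no  _ = consʳ (filter-interleaving P? xs)

complement : ∀ {A : Set} {xs ys : List A} → xs ⊆ ys → ∃ λ zs → Interleaving xs zs ys
complement []          = [] , []
complement (y ∷ʳ p)    = let zs , i = complement p in y ∷ zs , consʳ i
complement (refl ∷ p)  = let zs , i = complement p in zs , consˡ i

-- few d x = Σ_{i < d} (x C i) 3^(x - i): labellings of x pairs, each non-double (3 ways)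
-- or double (1 way), with fewer than d doubles.
few : ℕ → ℕ → ℕ
few zero    _       = 0
few (suc d) zero    = 1
few (suc d) (suc x) = 1 * few d x + 3 * few (suc d) x

-- Covers of families of relations

module Covering {V : Set} (_≟_ : Binary.DecidableEquality V) where

  open DecMembership _≟_ using (_∈?_)

  BoolRel : Set
  BoolRel = V → V → Bool

  Double : BoolRel → V → V → Set
  Double D u w = D u w ≡ true × D w u ≡ true

  double? : ∀ D u w → Dec (Double D u w)
  double? D u w = (D u w Bool.≟ true) ×-dec (D w u Bool.≟ true)

  Double-sym : ∀ {D u w} → Double D u w → Double D w u
  Double-sym (p , q) = q , p

  -- Degenerate triples are included, so loops (Double D u u) are excluded as well.
  TriangleFree : Pred BoolRel 0ℓ
  TriangleFree D = ∀ u v w → Double D u v → Double D v w → ¬ Double D u w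

  Agree : Rel V 0ℓ → BoolRel → BoolRel → Set
  Agree R D D′ = ∀ u w → R u w → D u w ≡ D′ u w

  -- F has at most M restrictions to R. The members need not lie in F, and F may be empty,
  -- so covers can be glued along regions and combined by case distinction.
  record Cov (F : Pred BoolRel 0ℓ) (R : Rel V 0ℓ) (M : ℕ) : Set where
    constructor cov
    field
      members : List BoolRel
      size    : length members ≤ M
      covers  : ∀ {D} → F D → Any (Agree R D) members

  open Cov public

  private variable
    F G : Pred BoolRel 0ℓ
    R S : Rel V 0ℓ
    M N : ℕ

  cov-weaken : (∀ {D} → G D → F D) → (∀ {u w} → S u w → R u w) → M ≤ N → Cov F R M → Cov G S N
  cov-weaken f r m c = cov (members c) (≤-trans (size c) m)
    (λ g → Any.map (λ h u w s → h u w (r s)) (covers c (f g)))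

  cov-single : ∀ D₀ → (∀ {D} → F D → Agree R D D₀) → Cov F R 1
  cov-single D₀ h = cov (D₀ ∷ []) ≤-refl (λ f → here (h f))

  cov-∅ : (∀ {u w} → ¬ R u w) → Cov F R 1
  cov-∅ h = cov-single (λ _ _ → false) λ _ _ _ r → contradiction r h

  cov-⊎ : Cov F R M → Cov G R N → Cov (F ∪ G) R (M + N)
  cov-⊎ c d = cov (members c ++ members d)
    (subst (_≤ _) (sym (length-++ (members c))) (+-mono-≤ (size c) (size d)))
    [ Any.++⁺ˡ ∘ covers c , Any.++⁺ʳ (members c) ∘ covers d ]′

  -- A glued relation follows the first cover on `R` and the second elsewhere. An overlap is
  -- harmless: there the first cover already agrees with the member of `F`.
  cov-× : Binary.Decidable R → Cov F R M → Cov F S N → Cov F (λ u w → R u w ⊎ S u w) (M * N)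
  cov-× {R = R} {S = S} R? c d = cov (cartesianProductWith glue (members c) (members d))
    (subst (_≤ _) (sym (length-cartesianProductWith glue (members c) (members d))) (*-mono-≤ (size c) (size d)))
    λ f → Any.cartesianProductWith⁺ glue agree (covers c f) (covers d f)
    where
    glue : BoolRel → BoolRel → BoolRel
    glue D D′ u w = if does (R? u w) then D u w else D′ u w
    agree : ∀ {D₀ D D′ : BoolRel} → Agree R D₀ D → Agree S D₀ D′ →
      Agree (λ u w → R u w ⊎ S u w) D₀ (glue D D′)
    agree p q u w rs with R? u w | rs
    ... | yes r | _      = p u w r
    ... | no ¬r | inj₁ r = contradiction r ¬r
    ... | no _  | inj₂ s = q u w s

  cov-Any : ∀ {A : Set} {Rs : A → Rel V 0ℓ} → (∀ a → Binary.Decidable (Rs a)) → ∀ as →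
    (∀ {a} → a ∈ as → Cov F (Rs a) M) → Cov F (λ u w → Any (λ a → Rs a u w) as) (M ^ length as)
  cov-Any Rs? []       c = cov-∅ λ ()
  cov-Any Rs? (a ∷ as) c = cov-weaken id (λ { (here r) → inj₁ r ; (there r) → inj₂ r }) ≤-refl
    (cov-× (Rs? a) (c (here refl)) (cov-Any Rs? as (c ∘ there)))

  -- The price of guessing a subset of `vs`: a factor 2 per entry, which goes to one side or the
  -- other. The family may depend on the guess, the region and the bound may not.
  cov-interleaving : ∀ vs {F : List V → List V → Pred BoolRel 0ℓ} →
    (∀ {xs ys} → Interleaving xs ys vs → Cov (F xs ys) R M) →
    Cov (λ D → ∃₂ λ xs ys → Interleaving xs ys vs × F xs ys D) R (2 ^ length vs * M)
  cov-interleaving [] c = cov-weaken (λ { (_ , _ , [] , f) → f }) id (≤-reflexive (sym (+-identityʳ _))) (c [])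
  cov-interleaving {M = M} (v ∷ vs) c = cov-weaken
    (λ { (_ , _ , consˡ i , f) → inj₁ (_ , _ , i , f)
       ; (_ , _ , consʳ i , f) → inj₂ (_ , _ , i , f) })
    id
    (≤-reflexive (trans (sym (*-distribʳ-+ M p p)) (cong (λ q → (p + q) * M) (sym (+-identityʳ p)))))
    (cov-⊎ (cov-interleaving vs (c ∘ consˡ)) (cov-interleaving vs (c ∘ consʳ)))
    where p = 2 ^ length vs

  -- Covers of pairs, stars, cross pairs and squares

  Pair : V → V → Rel V 0ℓ
  Pair u w a b = (a ≡ u × b ≡ w) ⊎ (a ≡ w × b ≡ u)

  pair? : ∀ u w → Binary.Decidable (Pair u w)
  pair? u w a b = ((a ≟ u) ×-dec (b ≟ w)) ⊎-dec ((a ≟ w) ×-dec (b ≟ u))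

  private
    -- Stands for the state of a pair `u`, `w` with the arc from `u` to `w` only: the row of `u` is
    -- full and all others are empty, so `w` need not be named.
    rowOf : V → BoolRel
    rowOf u a _ = does (a ≟ u)

    rowOf-agrees : ∀ {D u w} → D u w ≡ true → D w u ≡ false → Agree (Pair u w) D (rowOf u)
    rowOf-agrees {u = u} p q _ _ (inj₁ (refl , refl)) with u ≟ u
    ... | yes _ = p
    ... | no ne = contradiction refl ne
    rowOf-agrees {u = u} {w} p q _ _ (inj₂ (refl , refl)) with w ≟ u
    ... | yes refl = p
    ... | no _     = q

    Pair-swap : ∀ {u w a b} → Pair u w a b → Pair w u a b
    Pair-swap (inj₁ p) = inj₂ p
    Pair-swap (inj₂ p) = inj₁ p

    const-agrees : ∀ {D : BoolRel} {u w c} → D u w ≡ c → D w u ≡ c → Agree (Pair u w) D (λ _ _ → c)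
    const-agrees p q _ _ (inj₁ (refl , refl)) = p
    const-agrees p q _ _ (inj₂ (refl , refl)) = q

  cov-double : ∀ u w → (∀ {D} → F D → Double D u w) → Cov F (Pair u w) 1
  cov-double u w dbl = cov-single (λ _ _ → true) λ f → let p , q = dbl f in const-agrees p q

  -- The source of every base 3: a non-double pair has no arc, only the arc from `u`, or only the
  -- arc from `w`.
  cov-nonDouble : ∀ u w → (∀ {D} → F D → ¬ Double D u w) → Cov F (Pair u w) 3
  cov-nonDouble {F} u w nd = cov ((λ _ _ → false) ∷ rowOf u ∷ rowOf w ∷ []) ≤-refl go
    where
    go : ∀ {D} → F D → _
    go {D} f with D u w in p | D w u in q
    ... | false | false = here (const-agrees p q)
    ... | true  | false = there (here (rowOf-agrees p q))
    ... | false | true  = there (there (here (λ a b → rowOf-agrees q p a b ∘ Pair-swap)))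
    ... | true  | true  = contradiction (p , q) (nd f)

  cov-pair : ∀ u w → Cov F (Pair u w) 4
  cov-pair {F} u w = cov-weaken decide id ≤-refl
    (cov-⊎ (cov-nonDouble {λ D → ¬ Double D u w} u w id) (cov-double {λ D → Double D u w} u w id))
    where
    decide : ∀ {D} → F D → ¬ Double D u w ⊎ Double D u w
    decide {D} _ with double? D u w
    ... | yes d = inj₂ d
    ... | no ¬d = inj₁ ¬d

  Star : V → List V → Rel V 0ℓ
  Star w vs a b = Any (λ v → Pair w v a b) vs

  star? : ∀ w vs → Binary.Decidable (Star w vs)
  star? w vs a b = any? (λ v → pair? w v a b) vs

  Cross : List V → List V → Rel V 0ℓ
  Cross us vs a b = Any (λ u → Star u vs a b) us

  cross? : ∀ us vs → Binary.Decidable (Cross us vs)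
  cross? us vs a b = any? (λ u → star? u vs a b) us

  Square : List V → Rel V 0ℓ
  Square vs a b = a ∈ vs × b ∈ vs

  square? : ∀ vs → Binary.Decidable (Square vs)
  square? vs a b = (a ∈? vs) ×-dec (b ∈? vs)

  cross⁺ : ∀ {us vs a b} → a ∈ us → b ∈ vs → Cross us vs a b
  cross⁺ a∈ b∈ = Any.map (λ { refl → Any.map (λ { refl → inj₁ (refl , refl) }) b∈ }) a∈

  cross⁺′ : ∀ {us vs a b} → a ∈ us → b ∈ vs → Cross us vs b a
  cross⁺′ a∈ b∈ = Any.map (λ { refl → Any.map (λ { refl → inj₂ (refl , refl) }) b∈ }) a∈

  cov-star : ∀ w vs → (∀ {v} → v ∈ vs → Cov F (Pair w v) M) → Cov F (Star w vs) (M ^ length vs)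
  cov-star w = cov-Any (pair? w)

  cov-cross : ∀ us vs → (∀ {u} → u ∈ us → Cov F (Star u vs) M) → Cov F (Cross us vs) (M ^ length us)
  cov-cross us vs = cov-Any (λ u → star? u vs) us

  -- Crude, since each unordered pair is paid for from both ends. It is applied only to sets whose
  -- size is bounded in terms of `d`.
  cov-square : ∀ vs → Cov F (Square vs) ((4 ^ length vs) ^ length vs)
  cov-square vs = cov-weaken id (λ (p , q) → cross⁺ p q) ≤-refl
    (cov-cross vs vs λ {u} _ → cov-star u vs λ {v} _ → cov-pair u v)

  -- One deletion: the deleted set `Q` is paid for crudely, `M` counts the ways to join it to the
  -- rest `S`, and `N` the ways to fill in `S`.
  cov-remove : ∀ {vs} Q S → (∀ {v} → v ∈ vs → v ∈ Q ⊎ v ∈ S) →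
    Cov F (Cross S Q) M → Cov F (Square S) N →
    Cov F (Square vs) ((4 ^ length Q) ^ length Q * (M * N))
  cov-remove {vs = vs} Q S split c d = cov-weaken id region ≤-refl
    (cov-× (square? Q) (cov-square Q) (cov-× (cross? S Q) c d))
    where
    region : ∀ {u w} → Square vs u w → Square Q u w ⊎ Cross S Q u w ⊎ Square S u w
    region (p , q) with split p | split q
    ... | inj₁ a | inj₁ b = inj₁ (a , b)
    ... | inj₁ a | inj₂ b = inj₂ (inj₁ (cross⁺′ b a))
    ... | inj₂ a | inj₁ b = inj₂ (inj₁ (cross⁺ a b))
    ... | inj₂ a | inj₂ b = inj₂ (inj₂ (a , b))

  doubles : BoolRel → V → List V → ℕ
  doubles D w vs = length (filter (double? D w) vs)

  -- Follows the recursion of `few`: a double first pair has one state and uses up one of the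
  -- allowed doubles; a non-double one has three states and uses up none.
  cov-few : ∀ w vs d → Cov (λ D → doubles D w vs < d) (Star w vs) (few d (length vs))
  cov-few w vs       zero    = cov [] z≤n λ ()
  cov-few w []       (suc d) = cov-∅ λ ()
  cov-few w (v ∷ vs) (suc d) = cov-weaken (λ {D} → decide D) (λ { (here p) → inj₁ p ; (there p) → inj₂ p }) ≤-refl
    (cov-⊎
      (cov-× (pair? w v) (cov-double {F = Yes} w v proj₁)
        (cov-weaken {G = Yes} proj₂ id ≤-refl (cov-few w vs d)))
      (cov-× (pair? w v) (cov-nonDouble {F = No} w v proj₁)
        (cov-weaken {G = No} proj₂ id ≤-refl (cov-few w vs (suc d)))))
    where
    Yes No : Pred BoolRel 0ℓ
    Yes D = Double D w v × doubles D w vs < d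
    No D = ¬ Double D w v × doubles D w vs < suc d
    decide : ∀ D → doubles D w (v ∷ vs) < suc d → Yes D ⊎ No D
    decide D h with double? D w v
    ... | yes dbl = inj₁ (dbl , s≤s⁻¹ (subst (_< suc d) (cong length (filter-accept (double? D w) dbl)) h))
    ... | no ¬dbl = inj₂ (¬dbl , subst (_< suc d) (cong length (filter-reject (double? D w) ¬dbl)) h)

  -- The dichotomy between few exceptional vertices and a complete bipartite graph

  Sparse : ℕ → ℕ → List V → List V → Pred BoolRel 0ℓ
  Sparse d L X Y D = ∃₂ λ E Y′ → Interleaving E Y′ Y ×
    length E ≤ L × (∀ y → y ∈ Y′ → doubles D y X < d)

  -- A copy of K(d,d) in the double edges, with sides `A` in `X` and `B` in `Y`.
  Dense : ℕ → List V → List V → Pred BoolRel 0ℓ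
  Dense d X Y D = ∃₂ λ A X′ → Interleaving A X′ X × ∃₂ λ B Y′ → Interleaving B Y′ Y ×
    length A ≡ d × length B ≡ d × (∀ a b → a ∈ A → b ∈ B → Double D a b)

  -- For each `x` in `X` in turn, `E` is cut down to its entries doubly joined to `x` or to the
  -- others, whichever part still has half of the required size. What survives all `length X`
  -- halvings has one common double neighbourhood `A` in `X`.
  pigeonhole : ∀ D d X E → d * 2 ^ length X ≤ length E →
    ∃₂ λ A E′ → A ⊆ X × E′ ⊆ E × d ≤ length E′ ×
      (∀ {e a} → e ∈ E′ → a ∈ A → Double D e a) × (∀ {e} → e ∈ E′ → doubles D e X ≤ length A)
  pigeonhole D d [] E h = [] , E , [] , ⊆-refl , subst (_≤ length E) (*-identityʳ d) h ,
    (λ _ ()) , λ _ → z≤n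
  pigeonhole D d (x ∷ X) E h
    with d * 2 ^ length X ≤? length (filter (λ e → double? D e x) E)
  ... | yes large =
    let A , E′ , A⊆X , E′⊆ , d≤ , dbl , bound = pigeonhole D d X _ large
        dbl-x = λ {e} (e∈ : e ∈ E′) → proj₂ (∈-filter⁻ (λ e → double? D e x) {xs = E} (Sublist.lookup E′⊆ e∈))
    in x ∷ A , E′ , refl ∷ A⊆X , ⊆-trans E′⊆ (filter-⊆ _ E) , d≤ ,
       (λ { e∈ (here refl) → dbl-x e∈ ; e∈ (there a∈) → dbl e∈ a∈ }) ,
       λ {e} e∈ → subst (_≤ suc (length A)) (sym (cong length (filter-accept (double? D e) (dbl-x e∈)))) (s≤s (bound e∈))
  ... | no small =
    let A , E′ , A⊆X , E′⊆ , d≤ , dbl , bound = pigeonhole D d X (filter (∁? (λ e → double? D e x)) E) rest-large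
        ¬dbl-x = λ {e} (e∈ : e ∈ E′) → proj₂ (∈-filter⁻ (∁? (λ e → double? D e x)) {xs = E} (Sublist.lookup E′⊆ e∈))
    in A , E′ , x ∷ʳ A⊆X , ⊆-trans E′⊆ (filter-⊆ _ E) , d≤ , dbl ,
       λ {e} e∈ → subst (_≤ length A) (sym (cong length (filter-reject (double? D e) (¬dbl-x e∈)))) (bound e∈)
    where
    P = λ e → double? D e x
    p = d * 2 ^ length X
    rest-large : p ≤ length (filter (∁? P) E)
    rest-large = +-cancelˡ-≤ p p _ (begin
      p + p
        ≡⟨ *-distribˡ-+ d (2 ^ length X) (2 ^ length X) ⟨
      d * (2 ^ length X + 2 ^ length X)
        ≡⟨ cong (λ q → d * (2 ^ length X + q)) (+-identityʳ (2 ^ length X)) ⟨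
      d * 2 ^ length (x ∷ X)
        ≤⟨ h ⟩
      length E
        ≡⟨ interleave-length (filter-interleaving P E) ⟩
      length (filter P E) + length (filter (∁? P) E)
        ≤⟨ +-monoˡ-≤ _ (<⇒≤ (≰⇒> small)) ⟩
      p + length (filter (∁? P) E) ∎)
      where open ≤-Reasoning

  -- Exceptional vertices are those with at least `d` double neighbours in `X`. If there are too
  -- many of them, `pigeonhole` finds `d` with the same double neighbourhood, and both sides are
  -- trimmed to `d`.
  sparse⊎dense : ∀ D d .{{_ : NonZero d}} X Y → Sparse d (d * 2 ^ length X) X Y D ⊎ Dense d X Y D
  sparse⊎dense D (suc d-1) X Y with length (filter (λ y → suc d-1 ≤? doubles D y X) Y) ≤? suc d-1 * 2 ^ length X
  ... | yes few = inj₁ (_ , _ , filter-interleaving (λ y → suc d-1 ≤? doubles D y X) Y , few ,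
    λ _ y∈ → ≰⇒> (proj₂ (∈-filter⁻ (∁? (λ y → suc d-1 ≤? doubles D y X)) {xs = Y} y∈)))
  ... | no many with pigeonhole D (suc d-1) X _ (<⇒≤ (≰⇒> many))
  -- The surviving list is nonempty because `d` is positive. Its head `e` has at least `d` double
  -- neighbours in `X`, all of them counted by `A`, so `A` has at least `d` entries.
  ... | A , e ∷ E , A⊆X , E⊆ , d≤E , dbl , bound =
    let X′ , iX = complement (⊆-trans (take-⊆ d A) A⊆X)
        Y′ , iY = complement (⊆-trans (take-⊆ d (e ∷ E)) (⊆-trans E⊆ (filter-⊆ _ Y)))
        d≤A = ≤-trans
          (proj₂ (∈-filter⁻ (λ y → d ≤? doubles D y X) {xs = Y} (Sublist.lookup E⊆ (here refl))))
          (bound (here refl))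
    in inj₂ (_ , X′ , iX , _ , Y′ , iY ,
      trans (length-take d A) (m≤n⇒m⊓n≡m d≤A) ,
      trans (length-take d (e ∷ E)) (m≤n⇒m⊓n≡m d≤E) ,
      λ _ _ a∈ b∈ → Double-sym {D} (dbl (Sublist.lookup (take-⊆ d (e ∷ E)) b∈) (Sublist.lookup (take-⊆ d A) a∈)))
    where d = suc d-1

  cov-empty : (∀ {D} → ¬ F D) → Cov F R M
  cov-empty ¬f = cov [] z≤n (λ f → contradiction f ¬f)

  -- The factors in order: guessing the exceptional vertices, the pairs inside `X`, the exceptional
  -- vertices joined to `X`, the typical vertices joined to `X`, and the rest `Y`.
  cov-sparse : ∀ d L X Y → Cov TriangleFree (Square Y) M →
    let x = length X ; y = length Y in
    Cov (λ D → TriangleFree D × Sparse d L X Y D) (Square (X ++ Y))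
        (2 ^ y * ((4 ^ x) ^ x * (((4 ^ x) ^ L * (1 + few d x) ^ y) * M)))
  cov-sparse {M = M} d L X Y c = cov-weaken (λ (tf , E , Y′ , i , p) → E , Y′ , i , tf , p) id ≤-refl
    (cov-interleaving Y {F = Given} given)
    where
    x = length X
    y = length Y
    Given : List V → List V → Pred BoolRel 0ℓ
    Given E Y′ D = TriangleFree D × length E ≤ L × (∀ y → y ∈ Y′ → doubles D y X < d)
    given : ∀ {E Y′} → Interleaving E Y′ Y →
      Cov (Given E Y′) (Square (X ++ Y)) ((4 ^ x) ^ x * (((4 ^ x) ^ L * (1 + few d x) ^ y) * M))
    given {E} {Y′} i with length E ≤? L
    ... | no ¬p = cov-empty λ (_ , p , _) → ¬p p
    ... | yes p = cov-remove X Y (∈-++⁻ X)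
      (cov-weaken id region
        (*-mono-≤ (^-monoʳ-≤ (4 ^ x) {{m^n≢0 4 x}} p)
                  -- `few d x` may vanish; adding 1 makes the base positive, so the exponent can be
                  -- raised from `length Y′` to `y`.
                  (≤-trans (^-monoˡ-≤ (length Y′) (n≤1+n (few d x)))
                    (^-monoʳ-≤ (1 + few d x) (subst (length Y′ ≤_) (sym (interleave-length i)) (m≤n+m _ (length E))))))
        (cov-× (cross? E X)
          (cov-cross E X λ {e} _ → cov-star e X λ {v} _ → cov-pair e v)
          (cov-cross Y′ X λ {y} y∈ → cov-weaken (λ (_ , _ , h) → h y y∈) id ≤-refl (cov-few y X d))))
      (cov-weaken proj₁ id ≤-refl c)
      where
      region : ∀ {u w} → Cross Y X u w → Cross E X u w ⊎ Cross Y′ X u w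
      region r = Any.++⁻ E (Any-resp-↭ (toPermutation i) r)

  -- Double edges from `w` to both sides would close a triangle with a double edge between the
  -- sides. Hence `w` has none into `A` or none into `B`, and the pairs to that side have 3 states
  -- instead of 4.
  cov-star-bipartite : ∀ w A B →
    Cov (λ D → TriangleFree D × (∀ a b → a ∈ A → b ∈ B → Double D a b)) (Star w (A ++ B))
        (3 ^ length A * 4 ^ length B + 4 ^ length A * 3 ^ length B)
  cov-star-bipartite w A B = cov-weaken decide (Any.++⁻ A) ≤-refl
    (cov-⊎ (cov-× (star? w A) (cov-star w A λ {v} v∈ → cov-nonDouble {F = NoneIn A} w v (λ none → none v∈))
                              (cov-star w B λ {v} _ → cov-pair w v))
           (cov-× (star? w A) (cov-star w A λ {v} _ → cov-pair w v)
                              (cov-star w B λ {v} v∈ → cov-nonDouble {F = NoneIn B} w v (λ none → none v∈))))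
    where
    NoneIn : List V → Pred BoolRel 0ℓ
    NoneIn vs D = ∀ {v} → v ∈ vs → ¬ Double D w v
    decide : ∀ {D} → TriangleFree D × (∀ a b → a ∈ A → b ∈ B → Double D a b) → NoneIn A D ⊎ NoneIn B D
    decide {D} (tf , complete) with any? (double? D w) A
    ... | no ¬a = inj₁ λ v∈ dbl → ¬a (lose v∈ dbl)
    ... | yes a = let _ , a∈ , wa = find a in inj₂ λ b∈ wb → tf w _ _ wa (complete _ _ a∈ b∈) wb

  -- The factors in order: guessing `A` in `X`, guessing `B` in `Y`, the pairs inside the deleted
  -- K(d,d), the `n` other vertices joined to it, and the rest. Which vertices remain depends on the
  -- guess, so a cover is required for every list of length `n`.
  cov-dense : ∀ d X Y n → length X + length Y ≡ 2 * d + n →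
    (∀ {vs} → length vs ≡ n → Cov TriangleFree (Square vs) M) →
    Cov (λ D → TriangleFree D × Dense d X Y D) (Square (X ++ Y))
        (2 ^ length X * (2 ^ length Y * ((4 ^ (2 * d)) ^ (2 * d) * ((2 * 12 ^ d) ^ n * M))))
  cov-dense {M = M} d X Y n size c = cov-weaken
    (λ (tf , A , X′ , iX , B , Y′ , iY , p) → A , X′ , iX , B , Y′ , iY , tf , p) id ≤-refl
    (cov-interleaving X {F = λ A X′ D → ∃₂ λ B Y′ → Interleaving B Y′ Y × Given A B D} λ iX →
      cov-interleaving Y {F = λ B Y′ → Given _ B} λ iY → given iX iY)
    where
    Given : List V → List V → Pred BoolRel 0ℓ
    Given A B D = TriangleFree D × length A ≡ d × length B ≡ d × (∀ a b → a ∈ A → b ∈ B → Double D a b)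
    given : ∀ {A X′ B Y′} → Interleaving A X′ X → Interleaving B Y′ Y →
      Cov (Given A B) (Square (X ++ Y)) ((4 ^ (2 * d)) ^ (2 * d) * ((2 * 12 ^ d) ^ n * M))
    given {A} {X′} {B} {Y′} iX iY with length A ℕ.≟ d | length B ℕ.≟ d
    ... | no ¬p | _     = cov-empty λ (_ , p , _) → ¬p p
    ... | yes _ | no ¬p = cov-empty λ (_ , _ , p , _) → ¬p p
    ... | yes p | yes q = cov-weaken id id
      (≤-reflexive (cong₂ (λ i j → (4 ^ i) ^ i * ((2 * 12 ^ d) ^ j * M)) |Q| |Z|))
      (cov-remove Q Z split
        (cov-cross Z Q λ {w} _ → cov-weaken (λ (tf , _ , _ , h) → tf , h) id (≤-reflexive star-size)
          (cov-star-bipartite w A B))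
        (cov-weaken proj₁ id ≤-refl (c |Z|)))
      where
      Q = A ++ B
      Z = X′ ++ Y′
      |Q| : length Q ≡ 2 * d
      |Q| = trans (length-++ A) (cong₂ _+_ p (trans q (sym (+-identityʳ d))))
      |Z| : length Z ≡ n
      |Z| = +-cancelˡ-≡ (2 * d) _ _ (begin
        2 * d + length (X′ ++ Y′)                        ≡⟨ cong₂ _+_ (sym |Q|) (length-++ X′) ⟩
        length (A ++ B) + (length X′ + length Y′)        ≡⟨ cong (_+ (length X′ + length Y′)) (length-++ A) ⟩
        (length A + length B) + (length X′ + length Y′)  ≡⟨ +-interchange (length A) (length B) (length X′) (length Y′) ⟩
        (length A + length X′) + (length B + length Y′)  ≡⟨ cong₂ _+_ (interleave-length iX) (interleave-length iY) ⟨
        length X + length Y                              ≡⟨ size ⟩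
        2 * d + n                                        ∎)
        where open ≡-Reasoning
      star-size : 3 ^ length A * 4 ^ length B + 4 ^ length A * 3 ^ length B ≡ 2 * 12 ^ d
      star-size = trans (cong₂ (λ i j → 3 ^ i * 4 ^ j + 4 ^ i * 3 ^ j) p q)
        (cong₂ _+_ (sym (^-distribʳ-* d 3 4)) (trans (sym (^-distribʳ-* d 4 3)) (sym (+-identityʳ _))))
      split : ∀ {v} → v ∈ X ++ Y → v ∈ Q ⊎ v ∈ Z
      split v∈ with ∈-++⁻ X v∈
      ... | inj₁ v∈X = Sum.map ∈-++⁺ˡ ∈-++⁺ˡ (∈-++⁻ A (Any-resp-↭ (toPermutation iX) v∈X))
      ... | inj₂ v∈Y = Sum.map (∈-++⁺ʳ A) (∈-++⁺ʳ X′) (∈-++⁻ B (Any-resp-↭ (toPermutation iY) v∈Y))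

-- A labelling with i < d doubles has weight 3^d · 3^(-i) ≥ 1, and the weights of all
-- labellings sum to 3^d · (3 + 1/3)^x; denominators are cleared.
few-bound : ∀ d x → 3 ^ x * few d x ≤ 10 ^ x * 3 ^ d
few-bound zero    x       = subst (_≤ 10 ^ x * 1) (sym (*-zeroʳ (3 ^ x))) z≤n
few-bound (suc d) zero    = subst (1 ≤_) (sym (+-identityʳ (3 ^ suc d))) (m^n>0 3 (suc d))
few-bound (suc d) (suc x) = begin
  3 ^ suc x * few (suc d) (suc x)
    ≡⟨ split (3 ^ x) (few d x) (few (suc d) x) ⟩
  3 * (3 ^ x * few d x) + 9 * (3 ^ x * few (suc d) x)
    ≤⟨ +-mono-≤ (*-monoʳ-≤ 3 (few-bound d x)) (*-monoʳ-≤ 9 (few-bound (suc d) x)) ⟩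
  3 * (10 ^ x * 3 ^ d) + 9 * (10 ^ x * 3 ^ suc d)
    ≡⟨ merge (10 ^ x) (3 ^ d) ⟩
  10 ^ suc x * 3 ^ suc d ∎
  where
  open ≤-Reasoning
  open ℕSolver.+-*-Solver
  split : ∀ p f g → 3 * p * (1 * f + 3 * g) ≡ 3 * (p * f) + 9 * (p * g)
  split = solve 3 (λ p f g → con 3 :* p :* (con 1 :* f :+ con 3 :* g) := con 3 :* (p :* f) :+ con 9 :* (p :* g)) refl
  merge : ∀ p q → 3 * (p * q) + 9 * (p * (3 * q)) ≡ 10 * p * (3 * q)
  merge = solve 2 (λ p q → con 3 :* (p :* q) :+ con 9 :* (p :* (con 3 :* q)) := con 10 :* p :* (con 3 :* q)) refl

-- The constants 30 and 15 are dictated by 3 · 10³⁰ < 3³⁰ · 12¹⁵.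
few<12^ : ∀ d .{{_ : NonZero d}} → few d (30 * d) < 12 ^ (15 * d)
few<12^ d = *-cancelˡ-< (3 ^ (30 * d)) _ _ (begin-strict
  3 ^ (30 * d) * few d (30 * d)  ≤⟨ few-bound d (30 * d) ⟩
  10 ^ (30 * d) * 3 ^ d          ≡⟨ cong (_* 3 ^ d) (^-*-assoc 10 30 d) ⟨
  (10 ^ 30) ^ d * 3 ^ d          ≡⟨ ^-distribʳ-* d (10 ^ 30) 3 ⟨
  (10 ^ 30 * 3) ^ d              <⟨ ^-monoˡ-< d (<ᵇ⇒< (10 ^ 30 * 3) (3 ^ 30 * 12 ^ 15) tt) ⟩
  (3 ^ 30 * 12 ^ 15) ^ d         ≡⟨ ^-distribʳ-* d (3 ^ 30) (12 ^ 15) ⟩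
  (3 ^ 30) ^ d * (12 ^ 15) ^ d   ≡⟨ cong₂ _*_ (^-*-assoc 3 30 d) (^-*-assoc 12 15 d) ⟩
  3 ^ (30 * d) * 12 ^ (15 * d)   ∎)
  where open ≤-Reasoning

-- Deleting `z` vertices from each side of a balanced complete bipartite graph on `2 * z + j`
-- vertices destroys `z * z` edges between them and `z` edges at each of the `j` remaining vertices.
quarter-shift : ∀ z j → (2 * z + j) ^ 2 / 4 ≡ z * z + z * j + j ^ 2 / 4
quarter-shift z j = begin
  (2 * z + j) ^ 2 / 4                  ≡⟨ cong (_/ 4) (expand z j) ⟩
  ((z * z + z * j) * 4 + j ^ 2) / 4    ≡⟨ +-distrib-/-∣ˡ (j ^ 2) (divides (z * z + z * j) refl) ⟩
  (z * z + z * j) * 4 / 4 + j ^ 2 / 4  ≡⟨ cong (_+ j ^ 2 / 4) (m*n/n≡m (z * z + z * j) 4) ⟩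
  z * z + z * j + j ^ 2 / 4            ∎
  where
  open ≡-Reasoning
  open ℕSolver.+-*-Solver
  expand : ∀ z j → (2 * z + j) ^ 2 ≡ (z * z + z * j) * 4 + j ^ 2
  expand = solve 2 (λ z j → (con 2 :* z :+ j) :^ 2 := (z :* z :+ z :* j) :* con 4 :+ j :^ 2) refl

4^-square : ∀ a b → (4 ^ a) ^ b ≡ 2 ^ (2 * (a * b))
4^-square a b = trans (^-*-assoc 4 a b) (^-*-assoc 2 2 (a * b))

2^*12^-* : ∀ a b c d → (2 ^ a * 12 ^ b) * (2 ^ c * 12 ^ d) ≡ 2 ^ (a + c) * 12 ^ (b + d)
2^*12^-* a b c d = begin
  (2 ^ a * 12 ^ b) * (2 ^ c * 12 ^ d)  ≡⟨ *-interchange (2 ^ a) (12 ^ b) (2 ^ c) (12 ^ d) ⟩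
  (2 ^ a * 2 ^ c) * (12 ^ b * 12 ^ d)  ≡⟨ cong₂ _*_ (^-distribˡ-+-* 2 a c) (^-distribˡ-+-* 12 b d) ⟨
  2 ^ (a + c) * 12 ^ (b + d)           ∎
  where open ≡-Reasoning

2^-*-2^*12^ : ∀ a b c → 2 ^ a * (2 ^ b * 12 ^ c) ≡ 2 ^ (a + b) * 12 ^ c
2^-*-2^*12^ a b c = trans (sym (*-assoc (2 ^ a) (2 ^ b) (12 ^ c))) (cong (_* 12 ^ c) (sym (^-distribˡ-+-* 2 a b)))

2^*12^-mono : ∀ {a b c d} → a ≤ c → b ≤ d → 2 ^ a * 12 ^ b ≤ 2 ^ c * 12 ^ d
2^*12^-mono p q = *-mono-≤ (^-monoʳ-≤ 2 p) (^-monoʳ-≤ 12 q)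

-- Repeated deletion

blockSize maxExceptions overhead : ℕ → ℕ
blockSize d     = 30 * d
maxExceptions d = d * 2 ^ blockSize d
-- The summands are exponents of 2 for the pairs inside a deleted block, the exceptional vertices
-- joined to that block, and the pairs inside a deleted K(d,d). Their sum serves both cases.
overhead d      = 2 * (blockSize d * blockSize d) + 2 * (blockSize d * maxExceptions d) + 2 * ((2 * d) * (2 * d))

-- Bits lost in one round: one for the choice between the two cases, at most `n + n` for the guessed
-- subsets and for the factors 2 in `2 * 12 ^ d`, and a constant.
stepCost : ℕ → ℕ → ℕ
stepCost d n = suc (n + n + overhead d)

module Peeling {V : Set} (_≟_ : Binary.DecidableEquality V) (d : ℕ) .{{_ : NonZero d}} (n : ℕ) where

  open Covering _≟_

  private
    x L K : ℕ
    x = blockSize d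
    L = maxExceptions d
    K = overhead d

  -- Each remaining vertex adds `15 * d` to the exponent of 12, half of the number of deleted
  -- vertices: the term `z * j` of `quarter-shift` with `z = 15 * d`. All else goes into the power
  -- of 2.
  sparse-count : ∀ y a b {f} → suc f ≤ 12 ^ (15 * d) → y ≤ n →
    2 ^ y * ((4 ^ x) ^ x * (((4 ^ x) ^ L * (1 + f) ^ y) * (2 ^ a * 12 ^ b)))
      ≤ 2 ^ (n + n + K + a) * 12 ^ (15 * d * y + b)
  sparse-count y a b {f} few< y≤n = begin
    2 ^ y * ((4 ^ x) ^ x * (((4 ^ x) ^ L * (1 + f) ^ y) * (2 ^ a * 12 ^ b)))
      ≤⟨ *-monoʳ-≤ (2 ^ y) (*-mono-≤ (≤-reflexive (4^-square x x)) (*-monoˡ-≤ (2 ^ a * 12 ^ b)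
           (*-mono-≤ (≤-reflexive (4^-square x L))
             (≤-trans (^-monoˡ-≤ y few<) (≤-reflexive (^-*-assoc 12 (15 * d) y)))))) ⟩
    2 ^ y * (2 ^ p * ((2 ^ r * 12 ^ (15 * d * y)) * (2 ^ a * 12 ^ b)))
      ≡⟨ cong (λ z → 2 ^ y * (2 ^ p * z)) (2^*12^-* r (15 * d * y) a b) ⟩
    2 ^ y * (2 ^ p * (2 ^ (r + a) * 12 ^ c))
      ≡⟨ cong (2 ^ y *_) (2^-*-2^*12^ p (r + a) c) ⟩
    2 ^ y * (2 ^ (p + (r + a)) * 12 ^ c)
      ≡⟨ 2^-*-2^*12^ y (p + (r + a)) c ⟩
    2 ^ (y + (p + (r + a))) * 12 ^ c
      ≤⟨ 2^*12^-mono exponent (≤-refl {c}) ⟩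
    2 ^ (n + n + K + a) * 12 ^ c ∎
    where
    open ≤-Reasoning
    p = 2 * (x * x)
    r = 2 * (x * L)
    c = 15 * d * y + b
    exponent : y + (p + (r + a)) ≤ n + n + K + a
    exponent = begin
      y + (p + (r + a))  ≡⟨ cong (y +_) (+-assoc p r a) ⟨
      y + (p + r + a)    ≡⟨ +-assoc y (p + r) a ⟨
      y + (p + r) + a    ≤⟨ +-monoˡ-≤ a (+-mono-≤ (≤-trans y≤n (m≤m+n n n)) (m≤m+n (p + r) _)) ⟩
      n + n + K + a      ∎

  -- The analogue with `z = d`; the factors 2 of the `j` remaining vertices are moved into the power
  -- of 2.
  dense-count : ∀ y j a b → x + y ≤ n → j ≤ n →
    2 ^ x * (2 ^ y * ((4 ^ (2 * d)) ^ (2 * d) * ((2 * 12 ^ d) ^ j * (2 ^ a * 12 ^ b))))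
      ≤ 2 ^ (n + n + K + a) * 12 ^ (d * j + b)
  dense-count y j a b xy≤n j≤n = begin
    2 ^ x * (2 ^ y * ((4 ^ (2 * d)) ^ (2 * d) * ((2 * 12 ^ d) ^ j * (2 ^ a * 12 ^ b))))
      ≡⟨ cong₂ (λ u v → 2 ^ x * (2 ^ y * (u * (v * (2 ^ a * 12 ^ b))))) (4^-square (2 * d) (2 * d))
           (trans (^-distribʳ-* j 2 (12 ^ d)) (cong (2 ^ j *_) (^-*-assoc 12 d j))) ⟩
    2 ^ x * (2 ^ y * (2 ^ p * ((2 ^ j * 12 ^ (d * j)) * (2 ^ a * 12 ^ b))))
      ≡⟨ cong (λ z → 2 ^ x * (2 ^ y * (2 ^ p * z))) (2^*12^-* j (d * j) a b) ⟩
    2 ^ x * (2 ^ y * (2 ^ p * (2 ^ (j + a) * 12 ^ c)))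
      ≡⟨ cong (λ z → 2 ^ x * (2 ^ y * z)) (2^-*-2^*12^ p (j + a) c) ⟩
    2 ^ x * (2 ^ y * (2 ^ (p + (j + a)) * 12 ^ c))
      ≡⟨ cong (2 ^ x *_) (2^-*-2^*12^ y (p + (j + a)) c) ⟩
    2 ^ x * (2 ^ (y + (p + (j + a))) * 12 ^ c)
      ≡⟨ 2^-*-2^*12^ x (y + (p + (j + a))) c ⟩
    2 ^ (x + (y + (p + (j + a)))) * 12 ^ c
      ≤⟨ 2^*12^-mono exponent (≤-refl {c}) ⟩
    2 ^ (n + n + K + a) * 12 ^ c ∎
    where
    open ≤-Reasoning
    open ℕSolver.+-*-Solver
    p = 2 * ((2 * d) * (2 * d))
    c = d * j + b
    regroup : ∀ x y p j a → x + (y + (p + (j + a))) ≡ (x + y) + j + p + a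
    regroup = solve 5 (λ x y p j a → x :+ (y :+ (p :+ (j :+ a))) := (x :+ y) :+ j :+ p :+ a) refl
    exponent : x + (y + (p + (j + a))) ≤ n + n + K + a
    exponent = ≤-trans (≤-reflexive (regroup x y p j a))
      (+-monoˡ-≤ a (+-mono-≤ (+-mono-≤ xy≤n j≤n) (m≤n+m p (2 * (x * x) + 2 * (x * L)))))

  -- Induction on the number `s` of rounds left. A round deletes `30 * d` vertices in the sparse
  -- case and `2 * d` in the dense one, so `2 * d` units of fuel per round suffice. At most `x`
  -- vertices are covered crudely.
  cov-triangleFree : ∀ s vs → length vs ≤ n → length vs ≤ x + 2 * d * s →
    Cov TriangleFree (Square vs) (2 ^ (2 * (x * x) + s * stepCost d n) * 12 ^ (length vs ^ 2 / 4))
  cov-triangleFree s vs |vs|≤n fuel with length vs ≤? x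
  ... | yes small = cov-weaken id id bound (cov-square vs)
    where
    open ≤-Reasoning
    k = length vs
    bound : (4 ^ k) ^ k ≤ 2 ^ (2 * (x * x) + s * stepCost d n) * 12 ^ (k ^ 2 / 4)
    bound = begin
      (4 ^ k) ^ k
        ≡⟨ 4^-square k k ⟩
      2 ^ (2 * (k * k))
        ≡⟨ *-identityʳ _ ⟨
      2 ^ (2 * (k * k)) * 12 ^ 0
        ≤⟨ 2^*12^-mono (≤-trans (*-monoʳ-≤ 2 (*-mono-≤ small small)) (m≤m+n _ _)) (z≤n {k ^ 2 / 4}) ⟩
      2 ^ (2 * (x * x) + s * stepCost d n) * 12 ^ (k ^ 2 / 4) ∎
  cov-triangleFree zero    vs |vs|≤n fuel | no large =
    contradiction (≤-trans fuel (≤-reflexive (trans (cong (x +_) (*-zeroʳ (2 * d))) (+-identityʳ x)))) large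
  cov-triangleFree (suc s) vs |vs|≤n fuel | no large =
    subst (λ us → Cov TriangleFree (Square us) bound) (take++drop≡id x vs)
      (cov-weaken (λ {D} tf → decide D tf) id total
        (cov-⊎ (cov-sparse d _ X Y (cov-triangleFree s Y (≤-trans y≤k |vs|≤n) y-fuel))
               (cov-dense d X Y j X+Y≡2d+j λ {us} |us| →
                 subst (λ i → Cov TriangleFree (Square us) (2 ^ a * 12 ^ (i ^ 2 / 4))) |us|
                 (cov-triangleFree s us (subst (_≤ n) (sym |us|) j≤n) (subst (_≤ x + 2 * d * s) (sym |us|) j-fuel)))))
    where
    X = take x vs
    Y = drop x vs
    k = length vs
    y = length Y
    -- The number of vertices left after deleting a K(d,d) from `30 * d + y`.
    j = 28 * d + y
    a = 2 * (x * x) + s * stepCost d n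
    bound = 2 ^ (2 * (x * x) + suc s * stepCost d n) * 12 ^ (k ^ 2 / 4)
    |X|≡x : length X ≡ x
    |X|≡x = trans (length-take x vs) (m≤n⇒m⊓n≡m (<⇒≤ (≰⇒> large)))
    k≡x+y : k ≡ x + y
    k≡x+y = trans (sym (m+[n∸m]≡n (<⇒≤ (≰⇒> large)))) (cong (x +_) (sym (length-drop x vs)))
    open ℕSolver.+-*-Solver using (solve; _:+_; _:*_; _:=_; con)
    k≡2d+j : k ≡ 2 * d + j
    k≡2d+j = trans k≡x+y (solve 2 (λ d y → con 30 :* d :+ y := con 2 :* d :+ (con 28 :* d :+ y)) refl d y)
    k≡2*15d+y : k ≡ 2 * (15 * d) + y
    k≡2*15d+y = trans k≡x+y (solve 2 (λ d y → con 30 :* d :+ y := con 2 :* (con 15 :* d) :+ y) refl d y)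
    X+Y≡2d+j : length X + y ≡ 2 * d + j
    X+Y≡2d+j = trans (cong (_+ y) |X|≡x) (trans (sym k≡x+y) k≡2d+j)
    y≤k : y ≤ k
    y≤k = subst (y ≤_) (sym k≡x+y) (m≤n+m y x)
    j≤n : j ≤ n
    j≤n = ≤-trans (subst (j ≤_) (sym k≡2d+j) (m≤n+m j (2 * d))) |vs|≤n
    j-fuel : j ≤ x + 2 * d * s
    j-fuel = +-cancelˡ-≤ (2 * d) _ _ (subst₂ _≤_ k≡2d+j
      (solve 3 (λ x d s → x :+ con 2 :* d :* (con 1 :+ s) := con 2 :* d :+ (x :+ con 2 :* d :* s)) refl x d s) fuel)
    y-fuel : y ≤ x + 2 * d * s
    y-fuel = ≤-trans (m≤n+m y (28 * d)) j-fuel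
    decide : ∀ D → TriangleFree D →
      (TriangleFree D × Sparse d (d * 2 ^ length X) X Y D) ⊎ (TriangleFree D × Dense d X Y D)
    decide D tf with sparse⊎dense D d X Y
    ... | inj₁ sp = inj₁ (tf , sp)
    ... | inj₂ dn = inj₂ (tf , dn)
    -- The summand `z * z` of `quarter-shift` is given away: the pairs inside the deleted set are
    -- paid for by `overhead`.
    quarter-mono : ∀ z i → k ≡ 2 * z + i → z * i + i ^ 2 / 4 ≤ k ^ 2 / 4
    quarter-mono z i e = subst (z * i + i ^ 2 / 4 ≤_)
      (sym (trans (cong (λ m → m ^ 2 / 4) e) (trans (quarter-shift z i) (+-assoc (z * z) (z * i) _)))) (m≤n+m _ (z * z))
    open ≤-Reasoning
    total : _ ≤ bound
    total = begin
      _ ≡⟨ cong₂ _+_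
             (cong (λ l → 2 ^ y * ((4 ^ l) ^ l *
                     (((4 ^ l) ^ (d * 2 ^ l) * (1 + few d l) ^ y) * (2 ^ a * 12 ^ (y ^ 2 / 4))))) |X|≡x)
             (cong (λ l → 2 ^ l * (2 ^ y * ((4 ^ (2 * d)) ^ (2 * d) *
                     ((2 * 12 ^ d) ^ j * (2 ^ a * 12 ^ (j ^ 2 / 4)))))) |X|≡x) ⟩
      _ ≤⟨ +-mono-≤
             (≤-trans (sparse-count y a (y ^ 2 / 4) (few<12^ d) (≤-trans y≤k |vs|≤n))
               (2^*12^-mono (≤-refl {n + n + K + a}) (quarter-mono (15 * d) y k≡2*15d+y)))
             (≤-trans (dense-count y j a (j ^ 2 / 4) (subst (_≤ n) k≡x+y |vs|≤n) j≤n)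
               (2^*12^-mono (≤-refl {n + n + K + a}) (quarter-mono d j k≡2d+j))) ⟩
      -- Both cases obey the same bound, so adding them costs one bit, the `suc` in `stepCost`.
      2 ^ e * T + 2 ^ e * T  ≡⟨ *-distribʳ-+ T (2 ^ e) (2 ^ e) ⟨
      (2 ^ e + 2 ^ e) * T    ≡⟨ cong (λ z → (2 ^ e + z) * T) (+-identityʳ (2 ^ e)) ⟨
      2 ^ suc e * T
        ≡⟨ cong (λ z → 2 ^ z * T) (solve 3 (λ w p q → w :+ (p :+ q) := p :+ (w :+ q)) refl
             (stepCost d n) (2 * (x * x)) (s * stepCost d n)) ⟩
      bound                          ∎
      where
      e = n + n + K + a
      T = 12 ^ (k ^ 2 / 4)

-- Bounds on the number of DK₃-free digraphs

module FinCov {n} = Covering (Fin._≟_ {n})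
open FinCov

length-⊆ : ∀ {A : Set} {xs ys : List A} → Unique xs → xs ⊆ˢ ys → length xs ≤ length ys
length-⊆ {xs = []}     _          _  = z≤n
length-⊆ {xs = x ∷ xs} (x∉ ∷ xs!) sub with ∈-∃++ (sub (here refl))
... | us , vs , refl = subst (suc (length xs) ≤_) (sym (length-++-sucʳ us x vs))
  (s≤s (length-⊆ xs! λ y∈ → drop-mid us (sub (there y∈)) (All.lookup x∉ y∈)))
  where
  drop-mid : ∀ us {y} → y ∈ us ++ x ∷ vs → x ≢ y → y ∈ us ++ vs
  drop-mid []       (here refl) x≢y = contradiction refl x≢y
  drop-mid []       (there y∈)  x≢y = y∈
  drop-mid (u ∷ us) (here refl) x≢y = here refl
  drop-mid (u ∷ us) (there y∈)  x≢y = there (drop-mid us y∈ x≢y)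

vectors-unique : ∀ {A : Set} {xs : List A} → Unique xs → ∀ n → Unique (vectors xs n)
vectors-unique xs! zero    = [] ∷ []
vectors-unique xs! (suc n) = Unique.cartesianProductWith⁺ Vec._∷_ ∷-injective xs! (vectors-unique xs! n)

adjacencies-unique : ∀ n → Unique (adjacencies n)
adjacencies-unique n = vectors-unique (vectors-unique (((λ ()) ∷ []) ∷ [] ∷ []) n) n

dk₃Free? : ∀ {n} → Decidable {A = Adjacency n} (λ D → IsDigraph D × ¬ ContainsDK₃ D)
dk₃Free? D = isDigraph? D ×-dec ¬? (containsDK₃? D)

relOf : ∀ {n} → Adjacency n → BoolRel {n}
relOf D i j = lookup (lookup D i) j

adjacencyOf : ∀ {n} → BoolRel {n} → Adjacency n
adjacencyOf D = tabulate λ i → tabulate (D i)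

adjacencyOf-agree : ∀ {n} (D : Adjacency n) {D′} → Agree (Square (allFin n)) (relOf D) D′ → D ≡ adjacencyOf D′
adjacencyOf-agree D agree = trans (sym (tabulate∘lookup D)) (tabulate-cong λ i →
  trans (sym (tabulate∘lookup (lookup D i))) (tabulate-cong λ j → agree i j (∈-allFin i , ∈-allFin j)))

doubleEdge⁺ : ∀ {n} {D : Adjacency n} {i j} → Double (relOf D) i j → DoubleEdge D i j
doubleEdge⁺ {D = D} {i} {j} (p , q) = lookup⇒[]= j (lookup D i) p , lookup⇒[]= i (lookup D j) q

doubleEdge⁻ : ∀ {n} {D : Adjacency n} {i j} → DoubleEdge D i j → Double (relOf D) i j
doubleEdge⁻ (p , q) = []=⇒lookup p , []=⇒lookup q

-- `TriangleFree` also speaks of coinciding vertices; a double edge from a vertex to itself would be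
-- a loop, so distinctness comes from the digraph being loopless.
dk₃Free⇒triangleFree : ∀ {n} (D : Adjacency n) → IsDigraph D → ¬ ContainsDK₃ D → TriangleFree (relOf D)
dk₃Free⇒triangleFree D loopless free u v w uv vw uw =
  free (u , v , w , (distinct uv , distinct vw , distinct uw) ,
        doubleEdge⁺ {D = D} uv , doubleEdge⁺ {D = D} vw , doubleEdge⁺ {D = D} uw)
  where
  distinct : ∀ {i j} → Double (relOf D) i j → i ≢ j
  distinct dbl refl = loopless _ (proj₁ (doubleEdge⁺ {D = D} dbl))

-- Agreement on all ordered pairs determines the adjacency lists. So the counted digraphs, listed
-- without repetition, all occur among the members of the cover.
numDK₃Free≤cov : ∀ {n M} → Cov TriangleFree (Square (allFin n)) M → numDK₃Free n ≤ M
numDK₃Free≤cov {n} c = ≤-trans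
  (length-⊆ (Unique.filter⁺ dk₃Free? (adjacencies-unique n)) included)
  (≤-trans (≤-reflexive (length-map adjacencyOf (members c))) (size c))
  where
  included : filter dk₃Free? (adjacencies n) ⊆ˢ map adjacencyOf (members c)
  included {D} D∈ with ∈-filter⁻ dk₃Free? {xs = adjacencies n} D∈
  ... | _ , loopless , free with find (covers c (dk₃Free⇒triangleFree D loopless free))
  ... | D′ , D′∈ , agree =
    subst (_∈ map adjacencyOf (members c)) (sym (adjacencyOf-agree D agree)) (∈-map⁺ adjacencyOf D′∈)

-- Comparing ⌊n²/4⌋ with the number of pairs

2*nC2+n≡n² : ∀ n → 2 * (n C 2) + n ≡ n ^ 2
2*nC2+n≡n² zero    = refl
2*nC2+n≡n² (suc n) = begin
  2 * (suc n C 2) + suc n        ≡⟨ cong (λ c → 2 * c + suc n) (sym (nCk+nC[k+1]≡[n+1]C[k+1] n 1)) ⟩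
  2 * (n C 1 + n C 2) + suc n    ≡⟨ cong (λ c → 2 * (c + n C 2) + suc n) (nC1≡n n) ⟩
  2 * (n + n C 2) + suc n        ≡⟨ regroup n (n C 2) ⟩
  2 * (n C 2) + n + suc (2 * n)  ≡⟨ cong (_+ suc (2 * n)) (2*nC2+n≡n² n) ⟩
  n ^ 2 + suc (2 * n)            ≡⟨ square n ⟩
  suc n ^ 2                      ∎
  where
  open ≡-Reasoning
  open ℕSolver.+-*-Solver
  regroup : ∀ n c → 2 * (n + c) + suc n ≡ 2 * c + n + suc (2 * n)
  regroup = solve 2 (λ n c → con 2 :* (n :+ c) :+ (con 1 :+ n) := con 2 :* c :+ n :+ (con 1 :+ con 2 :* n)) refl
  square : ∀ n → n ^ 2 + suc (2 * n) ≡ suc n ^ 2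
  square = solve 1 (λ n → n :^ 2 :+ (con 1 :+ con 2 :* n) := (con 1 :+ n) :^ 2) refl

suc-C2 : ∀ n → suc n C 2 ≡ n + n C 2
suc-C2 n = trans (sym (nCk+nC[k+1]≡[n+1]C[k+1] n 1)) (cong (_+ n C 2) (nC1≡n n))

quarter-2+ : ∀ n → (2 + n) ^ 2 / 4 ≡ suc (n + n ^ 2 / 4)
quarter-2+ n = trans (quarter-shift 1 n) (cong (λ m → suc (m + n ^ 2 / 4)) (+-identityʳ n))

4*quarter≤ : ∀ n → 4 * (n ^ 2 / 4) ≤ n ^ 2
4*quarter≤ n = subst (_≤ n ^ 2) (*-comm (n ^ 2 / 4) 4) (m/n*n≤m (n ^ 2) 4)

C2≤2*quarter : ∀ n → n C 2 ≤ 2 * (n ^ 2 / 4)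
C2≤2*quarter zero          = z≤n
C2≤2*quarter (suc zero)    = z≤n
C2≤2*quarter (suc (suc n)) = begin
  suc (suc n) C 2            ≡⟨ trans (suc-C2 (suc n)) (cong (suc n +_) (suc-C2 n)) ⟩
  suc n + (n + n C 2)        ≤⟨ +-monoʳ-≤ (suc n) (+-monoʳ-≤ n (C2≤2*quarter n)) ⟩
  suc n + (n + 2 * q)        ≤⟨ n≤1+n _ ⟩
  suc (suc n + (n + 2 * q))  ≡⟨ regroup n q ⟩
  2 * suc (n + q)            ≡⟨ cong (2 *_) (quarter-2+ n) ⟨
  2 * ((2 + n) ^ 2 / 4)      ∎
  where
  open ≤-Reasoning
  open ℕSolver.+-*-Solver
  q = n ^ 2 / 4
  regroup : ∀ n q → suc (suc n + (n + 2 * q)) ≡ 2 * suc (n + q)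
  regroup = solve 2 (λ n q → con 1 :+ (con 1 :+ n :+ (n :+ con 2 :* q)) := con 2 :* (con 1 :+ (n :+ q))) refl

quarter≤C2+n : ∀ n → n ^ 2 / 4 + n ^ 2 / 4 ≤ n C 2 + n
quarter≤C2+n n = *-cancelˡ-≤ 2 (begin
  2 * (q + q)          ≡⟨ solve 1 (λ q → con 2 :* (q :+ q) := con 4 :* q) refl q ⟩
  4 * q                ≤⟨ 4*quarter≤ n ⟩
  n ^ 2                ≡⟨ 2*nC2+n≡n² n ⟨
  2 * (n C 2) + n      ≤⟨ m≤m+n _ n ⟩
  2 * (n C 2) + n + n  ≡⟨ solve 2 (λ c n → con 2 :* c :+ n :+ n := con 2 :* (c :+ n)) refl (n C 2) n ⟩
  2 * (n C 2 + n)      ∎)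
  where
  open ≤-Reasoning
  open ℕSolver.+-*-Solver
  q = n ^ 2 / 4

-- Since 12 = 3 * 4, only the exponent of 3 has to change, from ⌊n²/4⌋ to the number of pairs left
-- over by ⌊n²/4⌋. The former exceeds the latter by at most `n`, an error of 3^n.
12^quarter≤ : ∀ n → 12 ^ (n ^ 2 / 4) ≤ 3 ^ (n C 2 ∸ n ^ 2 / 4) * 4 ^ (n ^ 2 / 4) * 4 ^ n
12^quarter≤ n = begin
  12 ^ q                       ≡⟨ ^-distribʳ-* q 3 4 ⟩
  3 ^ q * 4 ^ q                ≤⟨ *-monoˡ-≤ (4 ^ q) (^-monoʳ-≤ 3 q≤) ⟩
  3 ^ (c ∸ q + n) * 4 ^ q      ≡⟨ cong (_* 4 ^ q) (^-distribˡ-+-* 3 (c ∸ q) n) ⟩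
  3 ^ (c ∸ q) * 3 ^ n * 4 ^ q  ≤⟨ *-monoˡ-≤ (4 ^ q) (*-monoʳ-≤ (3 ^ (c ∸ q)) (^-monoˡ-≤ n (n≤1+n 3))) ⟩
  3 ^ (c ∸ q) * 4 ^ n * 4 ^ q  ≡⟨ solve 3 (λ a b d → a :* b :* d := a :* d :* b) refl (3 ^ (c ∸ q)) (4 ^ n) (4 ^ q) ⟩
  3 ^ (c ∸ q) * 4 ^ q * 4 ^ n  ∎
  where
  open ≤-Reasoning
  open ℕSolver.+-*-Solver
  q = n ^ 2 / 4
  c = n C 2
  q≤ : q ≤ c ∸ q + n
  q≤ = +-cancelˡ-≤ q q _ (begin
    q + q            ≤⟨ quarter≤C2+n n ⟩
    c + n            ≤⟨ +-monoˡ-≤ n (m≤n+m∸n c q) ⟩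
    q + (c ∸ q) + n  ≡⟨ +-assoc q (c ∸ q) n ⟩
    q + (c ∸ q + n)  ∎)

-- With `r` arbitrary, this bounds the count by the main term times 4^o(n²).
numDK₃Free≤ : ∀ r .{{_ : NonZero r}} → ∃[ N ] ∀ n → N ≤ n → ∃[ e ] r * e ≤ n ^ 2 ×
  numDK₃Free n ≤ 3 ^ (n C 2 ∸ n ^ 2 / 4) * 4 ^ (n ^ 2 / 4) * 4 ^ e
numDK₃Free≤ r = N , λ n N≤n → e n , small n N≤n , bound n
  where
  -- About n/4r rounds at about 2n bits each make `r * e n` roughly n²/2, which leaves room for the
  -- lower-order terms.
  d = 2 * r
  instance
    d≢0 : NonZero d
    d≢0 = m*n≢0 2 r
    2d≢0 : NonZero (2 * d)
    2d≢0 = m*n≢0 2 d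
  x₀ = blockSize d
  K₀ = overhead d
  X = 2 * (x₀ * x₀)
  s : ℕ → ℕ
  s n = suc (n / (2 * d))
  e : ℕ → ℕ
  e n = n + (X + s n * stepCost d n)
  -- `α` and `β` are the coefficients of the linear remainder in `4 * (r * e n)` beyond `2 * n ^ 2`;
  -- from `N` on, that remainder is at most `n * n`.
  α = 4 * r + (1 + K₀) + 8 * r
  β = 4 * r * X + 4 * r * (1 + K₀)
  N = suc (α + β)
  2ds≤ : ∀ n → 2 * d * s n ≤ n + 2 * d
  2ds≤ n = begin
    2 * d * suc (n / (2 * d))      ≡⟨ *-suc (2 * d) (n / (2 * d)) ⟩
    2 * d + 2 * d * (n / (2 * d))  ≡⟨ cong (2 * d +_) (*-comm (2 * d) (n / (2 * d))) ⟩
    2 * d + n / (2 * d) * (2 * d)  ≤⟨ +-monoʳ-≤ (2 * d) (m/n*n≤m n (2 * d)) ⟩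
    2 * d + n                      ≡⟨ +-comm (2 * d) n ⟩
    n + 2 * d                      ∎
    where open ≤-Reasoning
  n≤2ds : ∀ n → n ≤ 2 * d * s n
  n≤2ds n = begin
    n                                    ≡⟨ m≡m%n+[m/n]*n n (2 * d) ⟩
    n % (2 * d) + n / (2 * d) * (2 * d)  ≤⟨ +-monoˡ-≤ _ (<⇒≤ (m%n<n n (2 * d))) ⟩
    s n * (2 * d)                        ≡⟨ *-comm (s n) (2 * d) ⟩
    2 * d * s n                          ∎
    where open ≤-Reasoning
  bound : ∀ n → numDK₃Free n ≤ 3 ^ (n C 2 ∸ n ^ 2 / 4) * 4 ^ (n ^ 2 / 4) * 4 ^ e n
  bound n = begin
    numDK₃Free n
      ≤⟨ numDK₃Free≤cov (Peeling.cov-triangleFree Fin._≟_ d n (s n) (allFin n) (≤-reflexive |n|)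
           (≤-trans (≤-reflexive |n|) (≤-trans (n≤2ds n) (m≤n+m _ x₀)))) ⟩
    2 ^ f * 12 ^ (length (allFin n) ^ 2 / 4)
      ≡⟨ cong (λ m → 2 ^ f * 12 ^ (m ^ 2 / 4)) |n| ⟩
    2 ^ f * 12 ^ (n ^ 2 / 4)  ≤⟨ *-mono-≤ (^-monoˡ-≤ f (s≤s (s≤s (z≤n {2})))) (12^quarter≤ n) ⟩
    4 ^ f * (main * 4 ^ n)    ≡⟨ *-comm (4 ^ f) (main * 4 ^ n) ⟩
    main * 4 ^ n * 4 ^ f      ≡⟨ *-assoc main (4 ^ n) (4 ^ f) ⟩
    main * (4 ^ n * 4 ^ f)    ≡⟨ cong (main *_) (^-distribˡ-+-* 4 n f) ⟨
    main * 4 ^ e n            ∎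
    where
    open ≤-Reasoning
    f = X + s n * stepCost d n
    main = 3 ^ (n C 2 ∸ n ^ 2 / 4) * 4 ^ (n ^ 2 / 4)
    |n| : length (allFin n) ≡ n
    |n| = length-tabulate id
  open ℕSolver.+-*-Solver
  small : ∀ n → N ≤ n → r * e n ≤ n ^ 2
  small n N≤n = *-cancelˡ-≤ 4 (begin
    4 * (r * (n + (X + s n * (1 + (n + n + K₀)))))
      ≡⟨ solve 5 (λ r n X s K → con 4 :* (r :* (n :+ (X :+ s :* (con 1 :+ (n :+ n :+ K)))))
                 := con 4 :* r :* n :+ con 4 :* r :* X
                    :+ (con 2 :* (con 2 :* r) :* s) :* (con 1 :+ (n :+ n :+ K))) refl r n X (s n) K₀ ⟩
    4 * r * n + 4 * r * X + (2 * d * s n) * (1 + (n + n + K₀))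
      ≤⟨ +-monoʳ-≤ (4 * r * n + 4 * r * X) (*-monoˡ-≤ (1 + (n + n + K₀)) (2ds≤ n)) ⟩
    4 * r * n + 4 * r * X + (n + 2 * d) * (1 + (n + n + K₀))
      ≡⟨ solve 4 (λ r n X K → con 4 :* r :* n :+ con 4 :* r :* X
                                :+ (n :+ con 2 :* (con 2 :* r)) :* (con 1 :+ (n :+ n :+ K))
                 := con 2 :* n :^ 2 :+ ((con 4 :* r :+ (con 1 :+ K) :+ con 8 :* r) :* n
                                :+ (con 4 :* r :* X :+ con 4 :* r :* (con 1 :+ K)))) refl r n X K₀ ⟩
    2 * n ^ 2 + (α * n + β)
      ≤⟨ +-monoʳ-≤ (2 * n ^ 2) linear ⟩
    2 * n ^ 2 + n * n
      ≤⟨ m≤m+n _ (n * n) ⟩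
    2 * n ^ 2 + n * n + n * n
      ≡⟨ solve 1 (λ n → con 2 :* n :^ 2 :+ n :* n :+ n :* n := con 4 :* n :^ 2) refl n ⟩
    4 * n ^ 2 ∎)
    where
    open ≤-Reasoning
    linear : α * n + β ≤ n * n
    linear = begin
      α * n + β      ≤⟨ +-monoʳ-≤ (α * n) (m≤m*n β n {{>-nonZero (≤-trans (s≤s z≤n) N≤n)}}) ⟩
      α * n + β * n  ≡⟨ *-distribʳ-+ n α β ⟨
      (α + β) * n    ≤⟨ *-monoˡ-≤ n (≤-trans (n≤1+n _) N≤n) ⟩
      n * n          ∎

-- Lower bound: double edges across a balanced bipartition

differ : Bool → Bool → ℕ
differ false true  = 1
differ true  false = 1
differ _     _     = 0

differAll : Bool → ∀ {n} → Vec Bool n → ℕ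
differAll b []       = 0
differAll b (c ∷ cs) = differ b c + differAll b cs

crossing : ∀ {n} → Vec Bool n → ℕ
crossing []       = 0
crossing (c ∷ cs) = differAll c cs + crossing cs

same : Bool → Bool → ℕ
same b c = 1 ∸ differ b c

sameAll : Bool → ∀ {n} → Vec Bool n → ℕ
sameAll b []       = 0
sameAll b (c ∷ cs) = same b c + sameAll b cs

noncrossing : ∀ {n} → Vec Bool n → ℕ
noncrossing []       = 0
noncrossing (c ∷ cs) = sameAll c cs + noncrossing cs

alternating : ∀ n → Vec Bool n
alternating zero          = []
alternating (suc zero)    = false ∷ []
alternating (suc (suc n)) = false ∷ true ∷ alternating n

same+differ : ∀ b {n} (cs : Vec Bool n) → sameAll b cs + differAll b cs ≡ n
same+differ b     []       = refl
same+differ b     (c ∷ cs) = trans (+-interchange (same b c) _ (differ b c) _) (cong₂ _+_ (one b c) (same+differ b cs))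
  where
  one : ∀ b c → same b c + differ b c ≡ 1
  one false false = refl
  one false true  = refl
  one true  false = refl
  one true  true  = refl

noncrossing+crossing : ∀ {n} (cs : Vec Bool n) → noncrossing cs + crossing cs ≡ n C 2
noncrossing+crossing []               = refl
noncrossing+crossing {suc n} (c ∷ cs) = begin
  sameAll c cs + noncrossing cs + (differAll c cs + crossing cs)
    ≡⟨ +-interchange (sameAll c cs) _ (differAll c cs) _ ⟩
  sameAll c cs + differAll c cs + (noncrossing cs + crossing cs)
    ≡⟨ cong₂ _+_ (same+differ c cs) (noncrossing+crossing cs) ⟩
  n + n C 2
    ≡⟨ suc-C2 n ⟨
  suc n C 2 ∎
  where open ≡-Reasoning

differ-false+true : ∀ {n} (cs : Vec Bool n) → differAll false cs + differAll true cs ≡ n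
differ-false+true []           = refl
differ-false+true (false ∷ cs) = trans (+-suc (differAll false cs) _) (cong suc (differ-false+true cs))
differ-false+true (true ∷ cs)  = cong suc (differ-false+true cs)

-- The first two vertices lie in different classes: they form one crossing pair, and each of the
-- other `n` vertices crosses exactly one of them.
crossing-alternating : ∀ n → crossing (alternating n) ≡ n ^ 2 / 4
crossing-alternating zero          = refl
crossing-alternating (suc zero)    = refl
crossing-alternating (suc (suc n)) = begin
  suc (differAll false cs) + (differAll true cs + crossing cs)
    ≡⟨ cong suc (+-assoc (differAll false cs) _ _) ⟨
  suc (differAll false cs + differAll true cs + crossing cs)
    ≡⟨ cong suc (cong₂ _+_ (differ-false+true cs) (crossing-alternating n)) ⟩
  suc (n + n ^ 2 / 4)
    ≡⟨ quarter-2+ n ⟨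
  (2 + n) ^ 2 / 4 ∎
  where
  open ≡-Reasoning
  cs = alternating n

noncrossing-alternating : ∀ n → noncrossing (alternating n) ≡ n C 2 ∸ n ^ 2 / 4
noncrossing-alternating n = sym (begin
  n C 2 ∸ n ^ 2 / 4
    ≡⟨ cong₂ _∸_ (sym (noncrossing+crossing cs)) (sym (crossing-alternating n)) ⟩
  noncrossing cs + crossing cs ∸ crossing cs
    ≡⟨ m+n∸n≡m (noncrossing cs) (crossing cs) ⟩
  noncrossing cs ∎)
  where
  open ≡-Reasoning
  cs = alternating n

nonDoubleArcs : List (Bool × Bool)
nonDoubleArcs = (false , false) ∷ (true , false) ∷ (false , true) ∷ []

arcs : Bool → Bool → List (Bool × Bool)
arcs false false = nonDoubleArcs
arcs true  true  = nonDoubleArcs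
arcs _     _     = (true , true) ∷ nonDoubleArcs

arcRows : Bool → ∀ {n} → Vec Bool n → List (Vec (Bool × Bool) n)
arcRows b []       = [] ∷ []
arcRows b (c ∷ cs) = cartesianProductWith _∷_ (arcs b c) (arcRows b cs)

-- Adds a vertex in front. An entry of `v` holds the arc from the new vertex and the arc back to it,
-- so the first components form the new row and the second ones the new column.
extend : ∀ {n} → Vec (Bool × Bool) n → Adjacency n → Adjacency (suc n)
extend v D = (false ∷ Vec.map proj₁ v) ∷ zipWith Vec._∷_ (Vec.map proj₂ v) D

-- Built vertex by vertex instead of by filtering, so that its length is a product over pairs and
-- absence of repetitions follows from `extend-injective`.
bipartiteDoubles : ∀ {n} → Vec Bool n → List (Adjacency n)
bipartiteDoubles []       = [] ∷ []
bipartiteDoubles (c ∷ cs) = cartesianProductWith extend (arcRows c cs) (bipartiteDoubles cs)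

nonDoubleArcs-unique : Unique nonDoubleArcs
nonDoubleArcs-unique = ((λ ()) ∷ (λ ()) ∷ []) ∷ ((λ ()) ∷ []) ∷ [] ∷ []

arcs-unique : ∀ b c → Unique (arcs b c)
arcs-unique false false = nonDoubleArcs-unique
arcs-unique true  true  = nonDoubleArcs-unique
arcs-unique false true  = ((λ ()) ∷ (λ ()) ∷ (λ ()) ∷ []) ∷ nonDoubleArcs-unique
arcs-unique true  false = ((λ ()) ∷ (λ ()) ∷ (λ ()) ∷ []) ∷ nonDoubleArcs-unique

length-arcs : ∀ b c → length (arcs b c) ≡ 3 ^ same b c * 4 ^ differ b c
length-arcs false false = refl
length-arcs false true  = refl
length-arcs true  false = refl
length-arcs true  true  = refl

3^*4^-* : ∀ a b c d → (3 ^ a * 4 ^ b) * (3 ^ c * 4 ^ d) ≡ 3 ^ (a + c) * 4 ^ (b + d)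
3^*4^-* a b c d = trans (*-interchange (3 ^ a) (4 ^ b) (3 ^ c) (4 ^ d))
  (sym (cong₂ _*_ (^-distribˡ-+-* 3 a c) (^-distribˡ-+-* 4 b d)))

arcRows-unique : ∀ b {n} (cs : Vec Bool n) → Unique (arcRows b cs)
arcRows-unique b []       = [] ∷ []
arcRows-unique b (c ∷ cs) = Unique.cartesianProductWith⁺ _∷_ ∷-injective (arcs-unique b c) (arcRows-unique b cs)

length-arcRows : ∀ b {n} (cs : Vec Bool n) → length (arcRows b cs) ≡ 3 ^ sameAll b cs * 4 ^ differAll b cs
length-arcRows b []       = refl
length-arcRows b (c ∷ cs) = begin
  length (arcRows b (c ∷ cs))                ≡⟨ length-cartesianProductWith _∷_ (arcs b c) (arcRows b cs) ⟩
  length (arcs b c) * length (arcRows b cs)  ≡⟨ cong₂ _*_ (length-arcs b c) (length-arcRows b cs) ⟩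
  (3 ^ same b c * 4 ^ differ b c) * (3 ^ sameAll b cs * 4 ^ differAll b cs)
    ≡⟨ 3^*4^-* (same b c) (differ b c) (sameAll b cs) (differAll b cs) ⟩
  3 ^ sameAll b (c ∷ cs) * 4 ^ differAll b (c ∷ cs) ∎
  where open ≡-Reasoning

arcs-double : ∀ b c → (true , true) ∈ arcs b c → b ≢ c
arcs-double false false (there (there (there ()))) _
arcs-double true  true  (there (there (there ()))) _

arcRows-double : ∀ b {n} (cs : Vec Bool n) {v} → v ∈ arcRows b cs → ∀ j → lookup v j ≡ (true , true) → b ≢ lookup cs j
arcRows-double b (c ∷ cs) v∈ j eq with ∈-cartesianProductWith⁻ _∷_ (arcs b c) (arcRows b cs) v∈
arcRows-double b (c ∷ cs) v∈ zero    refl | _ , _ , a∈ , _  , refl = arcs-double b c a∈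
arcRows-double b (c ∷ cs) v∈ (suc j) eq   | _ , _ , _  , w∈ , refl = arcRows-double b cs w∈ j eq

zipWith-∷-injective : ∀ {A : Set} {m n} {xs ys : Vec A n} {M N : Vec (Vec A m) n} →
  zipWith Vec._∷_ xs M ≡ zipWith Vec._∷_ ys N → xs ≡ ys × M ≡ N
zipWith-∷-injective {xs = []}     {[]}     {[]}    {[]}    _  = refl , refl
zipWith-∷-injective {xs = x ∷ xs} {y ∷ ys} {r ∷ M} {s ∷ N} eq =
  let heads , tails = ∷-injective eq
      x≡y , r≡s = ∷-injective heads
      xs≡ys , M≡N = zipWith-∷-injective tails
  in cong₂ _∷_ x≡y xs≡ys , cong₂ _∷_ r≡s M≡N

map-proj-injective : ∀ {n} {v w : Vec (Bool × Bool) n} →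
  Vec.map proj₁ v ≡ Vec.map proj₁ w → Vec.map proj₂ v ≡ Vec.map proj₂ w → v ≡ w
map-proj-injective {v = []}    {[]}    _ _ = refl
map-proj-injective {v = _ ∷ v} {_ ∷ w} p q =
  let a , p′ = ∷-injective p ; b , q′ = ∷-injective q
  in cong₂ _∷_ (cong₂ _,_ a b) (map-proj-injective p′ q′)

extend-injective : ∀ {n} {v w : Vec (Bool × Bool) n} {D E} → extend v D ≡ extend w E → v ≡ w × D ≡ E
extend-injective eq =
  let ps , qs = ∷-injective eq ; q , D≡E = zipWith-∷-injective qs
  in map-proj-injective (proj₂ (∷-injective ps)) q , D≡E

bipartiteDoubles-unique : ∀ {n} (cs : Vec Bool n) → Unique (bipartiteDoubles cs)
bipartiteDoubles-unique []       = [] ∷ []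
bipartiteDoubles-unique (c ∷ cs) =
  Unique.cartesianProductWith⁺ extend extend-injective (arcRows-unique c cs) (bipartiteDoubles-unique cs)

length-bipartiteDoubles : ∀ {n} (cs : Vec Bool n) → length (bipartiteDoubles cs) ≡ 3 ^ noncrossing cs * 4 ^ crossing cs
length-bipartiteDoubles []       = refl
length-bipartiteDoubles (c ∷ cs) = begin
  length (bipartiteDoubles (c ∷ cs))
    ≡⟨ length-cartesianProductWith extend (arcRows c cs) (bipartiteDoubles cs) ⟩
  length (arcRows c cs) * length (bipartiteDoubles cs)
    ≡⟨ cong₂ _*_ (length-arcRows c cs) (length-bipartiteDoubles cs) ⟩
  (3 ^ sameAll c cs * 4 ^ differAll c cs) * (3 ^ noncrossing cs * 4 ^ crossing cs)
    ≡⟨ 3^*4^-* (sameAll c cs) (differAll c cs) (noncrossing cs) (crossing cs) ⟩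
  3 ^ noncrossing (c ∷ cs) * 4 ^ crossing (c ∷ cs)             ∎
  where open ≡-Reasoning

bipartiteDoubles-double : ∀ {n} (cs : Vec Bool n) {D} → D ∈ bipartiteDoubles cs →
  ∀ i j → Double (relOf D) i j → lookup cs i ≢ lookup cs j
bipartiteDoubles-double (c ∷ cs) D∈ i j dbl
  with v , D , v∈ , D∈ , refl ← ∈-cartesianProductWith⁻ extend (arcRows c cs) (bipartiteDoubles cs) D∈ = go i j dbl
  where
  column : ∀ j → lookup (lookup (extend v D) (suc j)) zero ≡ proj₂ (lookup v j)
  column j = trans (cong (λ r → lookup r zero) (lookup-zipWith Vec._∷_ j (Vec.map proj₂ v) D)) (lookup-map j proj₂ v)
  rest : ∀ i j → relOf (extend v D) (suc i) (suc j) ≡ relOf D i j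
  rest i j = cong (λ r → lookup r (suc j)) (lookup-zipWith Vec._∷_ i (Vec.map proj₂ v) D)
  first : ∀ j → relOf (extend v D) zero (suc j) ≡ true → relOf (extend v D) (suc j) zero ≡ true → c ≢ lookup cs j
  first j p q = arcRows-double c cs v∈ j (cong₂ _,_ (trans (sym (lookup-map j proj₁ v)) p) (trans (sym (column j)) q))
  go : ∀ i j → Double (relOf (extend v D)) i j → lookup (c ∷ cs) i ≢ lookup (c ∷ cs) j
  go zero    zero    (() , _)
  go zero    (suc j) (p , q) = first j p q
  go (suc i) zero    (p , q) = first i q p ∘ sym
  go (suc i) (suc j) (p , q) = bipartiteDoubles-double cs D∈ i j (trans (sym (rest i j)) p , trans (sym (rest j i)) q)

∈-vectors : ∀ {A : Set} {xs : List A} {n} (v : Vec A n) → (∀ i → lookup v i ∈ xs) → v ∈ vectors xs n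
∈-vectors []      _  = here refl
∈-vectors (a ∷ v) h = ∈-cartesianProductWith⁺ _∷_ (h zero) (∈-vectors v (h ∘ suc))

∈-adjacencies : ∀ {n} (D : Adjacency n) → D ∈ adjacencies n
∈-adjacencies D = ∈-vectors D λ i → ∈-vectors (lookup D i) λ j → bool (relOf D i j)
  where
  bool : ∀ b → b ∈ false ∷ true ∷ []
  bool false = here refl
  bool true  = there (here refl)

-- Two classes cannot separate three vertices; this excludes triangles across a bipartition, both
-- for digraphs and for templates.
no-three-booleans : ∀ {a b c : Bool} → a ≢ b → b ≢ c → ¬ a ≢ c
no-three-booleans {false} {false}         p _ _ = p refl
no-three-booleans {true}  {true}          p _ _ = p refl
no-three-booleans {false} {true}  {false} _ _ r = r refl
no-three-booleans {false} {true}  {true}  _ q _ = q refl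
no-three-booleans {true}  {false} {false} _ q _ = q refl
no-three-booleans {true}  {false} {true}  _ _ r = r refl

numDK₃Free≥ : ∀ n → 3 ^ (n C 2 ∸ n ^ 2 / 4) * 4 ^ (n ^ 2 / 4) ≤ numDK₃Free n
numDK₃Free≥ n = subst (_≤ numDK₃Free n)
  (trans (length-bipartiteDoubles cs)
    (cong₂ (λ a b → 3 ^ a * 4 ^ b) (noncrossing-alternating n) (crossing-alternating n)))
  (length-⊆ (bipartiteDoubles-unique cs) λ {D} D∈ →
    let apart = λ i j dbl → bipartiteDoubles-double cs D∈ i j (doubleEdge⁻ {D = D} dbl)
    in ∈-filter⁺ dk₃Free? (∈-adjacencies D)
      -- A loop would count as a double edge joining a class to itself.
      ( (λ i a → apart i i (a , a) refl)
      , λ (i , j , k , _ , ij , jk , ik) → no-three-booleans (apart i j ij) (apart j k jk) (apart i k ik)))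
  where cs = alternating n

-- Mantel's theorem and the extremal template

pairs : ∀ {A : Set} → List A → List (A × A)
pairs []       = []
pairs (v ∷ vs) = map (v ,_) vs ++ pairs vs

pairSum : ∀ {A : Set} → (A → A → ℕ) → List A → ℕ
pairSum f []       = 0
pairSum f (v ∷ vs) = sum (map (f v) vs) + pairSum f vs

pairSum≡sum : ∀ {A : Set} (f : A → A → ℕ) vs → pairSum f vs ≡ sum (map (uncurry f) (pairs vs))
pairSum≡sum f []       = refl
pairSum≡sum f (v ∷ vs) = sym (begin
  sum (map (uncurry f) (map (v ,_) vs ++ pairs vs))
    ≡⟨ cong sum (map-++ (uncurry f) (map (v ,_) vs) (pairs vs)) ⟩
  sum (map (uncurry f) (map (v ,_) vs) ++ map (uncurry f) (pairs vs))
    ≡⟨ sum-++ (map (uncurry f) (map (v ,_) vs)) _ ⟩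
  sum (map (uncurry f) (map (v ,_) vs)) + sum (map (uncurry f) (pairs vs))
    ≡⟨ cong₂ _+_ (cong sum (sym (map-∘ vs))) (sym (pairSum≡sum f vs)) ⟩
  sum (map (f v) vs) + pairSum f vs ∎)
  where open ≡-Reasoning

pairSum-map : ∀ {A B : Set} (f : B → B → ℕ) (g : A → B) vs → pairSum (f on g) vs ≡ pairSum f (map g vs)
pairSum-map f g []       = refl
pairSum-map f g (v ∷ vs) = cong₂ _+_ (cong sum (map-∘ vs)) (pairSum-map f g vs)

length-pairs : ∀ {A : Set} (vs : List A) → length (pairs vs) ≡ length vs C 2
length-pairs []       = refl
length-pairs (v ∷ vs) = begin
  length (map (v ,_) vs ++ pairs vs)          ≡⟨ length-++ (map (v ,_) vs) ⟩
  length (map (v ,_) vs) + length (pairs vs)  ≡⟨ cong₂ _+_ (length-map (v ,_) vs) (length-pairs vs) ⟩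
  length vs + length vs C 2                   ≡⟨ suc-C2 (length vs) ⟨
  suc (length vs) C 2                         ∎
  where open ≡-Reasoning

ends : ∀ {n} → Edge n → Fin n × Fin n
ends e = Edge.lo e , Edge.hi e

increasing? : ∀ {n} → Decidable (uncurry (Fin._<_ {n} {n}))
increasing? (i , j) = i Fin.<? j

ends-mapMaybe : ∀ {n} (ps : List (Fin n × Fin n)) → map ends (mapMaybe toEdge ps) ≡ filter increasing? ps
ends-mapMaybe []             = refl
ends-mapMaybe ((i , j) ∷ ps) with i Fin.<? j
... | yes i<j = trans (cong ((i , j) ∷_) (ends-mapMaybe ps)) (sym (filter-accept increasing? i<j))
... | no  i≮j = trans (ends-mapMaybe ps) (sym (filter-reject increasing? i≮j))

filter-column : ∀ {n} {v : Fin n} us vs → All (v Fin.<_) us →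
  filter increasing? (cartesianProduct us (v ∷ vs)) ≡ filter increasing? (cartesianProduct us vs)
filter-column []       vs []         = refl
filter-column {v = v} (u ∷ us) vs (v<u ∷ v<us) = begin
  filter increasing? ((u , v) ∷ map (u ,_) vs ++ cartesianProduct us (v ∷ vs))
    ≡⟨ filter-reject increasing? {u , v} {map (u ,_) vs ++ cartesianProduct us (v ∷ vs)} (λ u<v → Fin.<-asym u<v v<u) ⟩
  filter increasing? (map (u ,_) vs ++ cartesianProduct us (v ∷ vs))
    ≡⟨ filter-++ increasing? (map (u ,_) vs) _ ⟩
  filter increasing? (map (u ,_) vs) ++ filter increasing? (cartesianProduct us (v ∷ vs))
    ≡⟨ cong (filter increasing? (map (u ,_) vs) ++_) (filter-column us vs v<us) ⟩
  filter increasing? (map (u ,_) vs) ++ filter increasing? (cartesianProduct us vs)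
    ≡⟨ filter-++ increasing? (map (u ,_) vs) _ ⟨
  filter increasing? (cartesianProduct (u ∷ us) vs) ∎
  where open ≡-Reasoning

filter-square : ∀ {n} (vs : List (Fin n)) → AllPairs Fin._<_ vs → filter increasing? (cartesianProduct vs vs) ≡ pairs vs
filter-square []       []             = refl
filter-square (v ∷ vs) (v<vs ∷ vs<) = begin
  filter increasing? ((v , v) ∷ map (v ,_) vs ++ cartesianProduct vs (v ∷ vs))
    ≡⟨ filter-reject increasing? {v , v} {map (v ,_) vs ++ cartesianProduct vs (v ∷ vs)} (Fin.<-irrefl {x = v} refl) ⟩
  filter increasing? (map (v ,_) vs ++ cartesianProduct vs (v ∷ vs))
    ≡⟨ filter-++ increasing? (map (v ,_) vs) _ ⟩
  filter increasing? (map (v ,_) vs) ++ filter increasing? (cartesianProduct vs (v ∷ vs))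
    ≡⟨ cong₂ _++_ (filter-all increasing? (All.map⁺ v<vs)) (trans (filter-column vs vs v<vs) (filter-square vs vs<)) ⟩
  pairs (v ∷ vs) ∎
  where open ≡-Reasoning

-- `edges` filters all ordered pairs, whereas the counting arguments recurse on a list of vertices.
-- This passes from one form to the other.
ends-edges : ∀ n → map ends (edges n) ≡ pairs (allFin n)
ends-edges n = trans (ends-mapMaybe (cartesianProduct (allFin n) (allFin n)))
  (filter-square (allFin n) (AllPairs.tabulate⁺-< id))

sum-edges : ∀ {n} (f : Fin n → Fin n → ℕ) → sum (map (uncurry f ∘ ends) (edges n)) ≡ pairSum f (allFin n)
sum-edges {n} f = begin
  sum (map (uncurry f ∘ ends) (edges n))      ≡⟨ cong sum (map-∘ (edges n)) ⟩
  sum (map (uncurry f) (map ends (edges n)))  ≡⟨ cong (sum ∘ map (uncurry f)) (ends-edges n) ⟩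
  sum (map (uncurry f) (pairs (allFin n)))    ≡⟨ pairSum≡sum f (allFin n) ⟨
  pairSum f (allFin n)                        ∎
  where open ≡-Reasoning

length-edges : ∀ n → length (edges n) ≡ n C 2
length-edges n = begin
  length (edges n)             ≡⟨ length-map ends (edges n) ⟨
  length (map ends (edges n))  ≡⟨ cong length (ends-edges n) ⟩
  length (pairs (allFin n))    ≡⟨ length-pairs (allFin n) ⟩
  length (allFin n) C 2        ≡⟨ cong (_C 2) (length-tabulate {n = n} id) ⟩
  n C 2                        ∎
  where open ≡-Reasoning

indicator : Bool → ℕ
indicator b = if b then 1 else 0

module Mantel {V : Set} (A : V → V → Bool) (A-sym : ∀ u v → A u v ≡ A v u)
  (A-triangleFree : ∀ u v w → A u v ≡ true → A v w ≡ true → ¬ A u w ≡ true) where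

  adj : V → V → ℕ
  adj u v = indicator (A u v)

  degree : V → List V → ℕ
  degree v vs = sum (map (adj v) vs)

  -- By symmetry of `A` the edge count does not depend on the order of the vertices, so the ends of
  -- any edge can be moved to the front.
  pairSum-↭ : ∀ {us vs} → us ↭ vs → pairSum adj us ≡ pairSum adj vs
  pairSum-↭ refl        = refl
  pairSum-↭ (prep v p)  = cong₂ _+_ (sum-↭ (↭-map⁺ (adj v) p)) (pairSum-↭ p)
  pairSum-↭ (swap {xs} {ys} u v p) = begin
    adj u v + degree u xs + (degree v xs + pairSum adj xs)
      ≡⟨ cong₂ _+_ (cong₂ _+_ (cong indicator (A-sym u v)) (sum-↭ (↭-map⁺ (adj u) p)))
                   (cong₂ _+_ (sum-↭ (↭-map⁺ (adj v) p)) (pairSum-↭ p)) ⟩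
    adj v u + degree u ys + (degree v ys + pairSum adj ys)
      ≡⟨ solve 4 (λ a d e s → a :+ d :+ (e :+ s) := a :+ e :+ (d :+ s)) refl
           (adj v u) (degree u ys) (degree v ys) (pairSum adj ys) ⟩
    adj v u + degree v ys + (degree u ys + pairSum adj ys) ∎
    where
    open ≡-Reasoning
    open ℕSolver.+-*-Solver
  pairSum-↭ (Perm.trans p q) = trans (pairSum-↭ p) (pairSum-↭ q)

  degree≡0 : ∀ v vs → (∀ {u} → u ∈ vs → ¬ A v u ≡ true) → degree v vs ≡ 0
  degree≡0 v []       _ = refl
  degree≡0 v (u ∷ vs) h with A v u in eq
  ... | true  = contradiction eq (h (here refl))
  ... | false = degree≡0 v vs (h ∘ there)

  edge? : ∀ vs → pairSum adj vs ≡ 0 ⊎ ∃₂ λ a b → ∃[ us ] vs ↭ a ∷ b ∷ us × A a b ≡ true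
  edge? []       = inj₁ refl
  edge? (v ∷ vs) with any? (λ u → A v u Bool.≟ true) vs
  ... | yes p with find p
  ...   | b , b∈ , vb with us , ws , refl ← ∈-∃++ b∈ = inj₂ (v , b , us ++ ws , prep v (shift b us ws) , vb)
  edge? (v ∷ vs) | no ¬p with edge? vs
  ... | inj₁ none = inj₁ (cong₂ _+_ (degree≡0 v vs λ u∈ vu → ¬p (lose u∈ vu)) none)
  ... | inj₂ (a , b , us , p , ab) = inj₂ (a , b , v ∷ us ,
    ↭-trans (prep v p) (↭-trans (swap v a ↭-refl) (prep a (swap v b ↭-refl))) , ab)

  -- No vertex is adjacent to both ends of an edge.
  degrees≤ : ∀ {a b} → A a b ≡ true → ∀ vs → degree a vs + degree b vs ≤ length vs
  degrees≤ ab [] = z≤n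
  degrees≤ {a} {b} ab (v ∷ vs) = begin
    adj a v + degree a vs + (adj b v + degree b vs)
      ≡⟨ solve 4 (λ p d q e → p :+ d :+ (q :+ e) := p :+ q :+ (d :+ e)) refl
           (adj a v) (degree a vs) (adj b v) (degree b vs) ⟩
    adj a v + adj b v + (degree a vs + degree b vs)
      ≤⟨ +-mono-≤ not-both (degrees≤ ab vs) ⟩
    suc (length vs) ∎
    where
    open ≤-Reasoning
    open ℕSolver.+-*-Solver
    not-both : adj a v + adj b v ≤ 1
    not-both with A a v in av | A b v in bv
    ... | true  | true  = contradiction av (A-triangleFree a b v ab bv)
    ... | true  | false = ≤-refl
    ... | false | true  = ≤-refl
    ... | false | false = z≤n

  -- Deleting the two ends of an edge loses that edge and at most one edge for each other vertex,
  -- which is the increment in `quarter-2+`. The bound `m` carries the recursion, because the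
  -- remaining list is reached through a permutation.
  mantel : ∀ m vs → length vs ≤ m → pairSum adj vs ≤ length vs ^ 2 / 4
  mantel zero    []         _  = z≤n
  mantel (suc m) vs@(_ ∷ _) |vs| with edge? vs
  ... | inj₁ none = subst (_≤ length vs ^ 2 / 4) (sym none) z≤n
  ... | inj₂ (a , b , us , p , ab) = begin
    pairSum adj vs
      ≡⟨ pairSum-↭ p ⟩
    adj a b + degree a us + (degree b us + pairSum adj us)
      ≡⟨ cong (λ c → indicator c + degree a us + (degree b us + pairSum adj us)) ab ⟩
    suc (degree a us + (degree b us + pairSum adj us))
      ≡⟨ cong suc (+-assoc (degree a us) (degree b us) _) ⟨
    suc (degree a us + degree b us + pairSum adj us)
      ≤⟨ s≤s (+-mono-≤ (degrees≤ ab us) (mantel m us |us|)) ⟩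
    suc (length us + length us ^ 2 / 4)
      ≡⟨ quarter-2+ (length us) ⟨
    (2 + length us) ^ 2 / 4
      ≡⟨ cong (λ l → l ^ 2 / 4) (↭-length p) ⟨
    length vs ^ 2 / 4 ∎
    where
    open ≤-Reasoning
    |us| : length us ≤ m
    |us| = <⇒≤ (s≤s⁻¹ (subst (_≤ suc m) (↭-length p) |vs|))
  mantel zero (_ ∷ _) ()
  mantel (suc m) [] _ = z≤n

-- Only the full palette has positive excess, and it contains `3F`.
palette-excess : ∀ (s : Subset 4) → ∣ s ∣ ∸ 3 ≤ indicator (lookup s 3F)
palette-excess s@(_ ∷ _ ∷ _ ∷ true ∷ []) = ∸-monoˡ-≤ 3 (∣p∣≤n s)
palette-excess (a ∷ b ∷ c ∷ false ∷ []) = ≤-reflexive (m≤n⇒m∸n≡0 (∣p∣≤3 a b c))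
  where
  ∣p∣≤3 : ∀ a b c → ∣ a ∷ b ∷ c ∷ false ∷ [] ∣ ≤ 3
  ∣p∣≤3 true  true  true  = ≤-refl
  ∣p∣≤3 true  true  false = s≤s (s≤s z≤n)
  ∣p∣≤3 true  false true  = s≤s (s≤s z≤n)
  ∣p∣≤3 true  false false = s≤s z≤n
  ∣p∣≤3 false true  true  = s≤s (s≤s z≤n)
  ∣p∣≤3 false true  false = s≤s z≤n
  ∣p∣≤3 false false true  = s≤s z≤n
  ∣p∣≤3 false false false = z≤n

sum-map-≤ : ∀ {A : Set} {f g : A → ℕ} → (∀ a → f a ≤ g a) → ∀ as → sum (map f as) ≤ sum (map g as)
sum-map-≤ h []       = z≤n
sum-map-≤ h (a ∷ as) = +-mono-≤ (h a) (sum-map-≤ h as)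

-- ∣ palette t e ∣ ∸ 3 is 1 for a full palette and, by truncation, 0 for any other.
excess : ∀ {n} → Template n → ℕ
excess {n} t = sum (map (λ e → ∣ palette t e ∣ ∸ 3) (edges n))

module _ {n} (t : Template n) (adm : Admissible NoDK₃ t) where

  private
    double : Edge n → Bool
    double e = lookup (palette t e) 3F

    DoubleFrom : Fin n → Fin n → Set
    DoubleFrom i j = ∃[ i<j ] double (edge i j i<j) ≡ true

    doubleFrom : Fin n → Fin n → Bool
    doubleFrom i j with i Fin.<? j
    ... | yes i<j = double (edge i j i<j)
    ... | no  _   = false

    doubleFrom⁺ : ∀ i j → doubleFrom i j ≡ true → DoubleFrom i j
    doubleFrom⁺ i j h with i Fin.<? j
    ... | yes i<j = i<j , h

    doubleFrom-edge : ∀ e → doubleFrom (Edge.lo e) (Edge.hi e) ≡ double e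
    doubleFrom-edge (edge i j i<j) with i Fin.<? j
    ... | yes _  = refl
    ... | no i≮j = ⊥-elim-irr (i≮j i<j)

    -- Takes `3F` wherever it is allowed, so a triangle of pairs allowing `3F` would become a
    -- forbidden triangle of one colouring in the template.
    greedy : Colouring n
    greedy e = if double e then 3F else proj₁ (nonempty t e)

    greedy∈ : ⟨ t ⟩ greedy
    greedy∈ e with double e in eq
    ... | true  = lookup⇒[]= 3F (palette t e) eq
    ... | false = proj₂ (nonempty t e)

    greedy≡3F : ∀ {e} → double e ≡ true → greedy e ≡ 3F
    greedy≡3F {e} eq = cong (λ b → if b then 3F else proj₁ (nonempty t e)) eq

    sorted : ∀ {i j k} → DoubleFrom i j → DoubleFrom j k → ¬ DoubleFrom i k
    -- The field `lo<hi` is irrelevant, so `i<k` can replace the composite of `i<j` and `j<k` that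
    -- appears in `NoDK₃`.
    sorted {i} {j} {k} (i<j , ij) (j<k , jk) (i<k , ik) = adm greedy greedy∈ i<j j<k
      (greedy≡3F {edge i j i<j} ij , greedy≡3F {edge j k j<k} jk , greedy≡3F {edge i k i<k} ik)

    A : Fin n → Fin n → Bool
    A i j = doubleFrom i j ∨ doubleFrom j i

    A⁺ : ∀ i j → A i j ≡ true → DoubleFrom i j ⊎ DoubleFrom j i
    A⁺ i j h with doubleFrom i j in eq
    ... | true  = inj₁ (doubleFrom⁺ i j eq)
    ... | false = inj₂ (doubleFrom⁺ j i h)

    -- Of the eight orientations, six are transitive and become `sorted` after renaming; the two
    -- cyclic ones contradict the order.
    triangleFree : ∀ i j k → A i j ≡ true → A j k ≡ true → ¬ A i k ≡ true
    triangleFree i j k p q r with A⁺ i j p | A⁺ j k q | A⁺ i k r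
    ... | inj₁ ij | inj₁ jk | inj₁ ik = sorted ij jk ik
    ... | inj₁ ij | inj₁ jk | inj₂ ki = Fin.<-asym (Fin.<-trans (proj₁ ij) (proj₁ jk)) (proj₁ ki)
    ... | inj₁ ij | inj₂ kj | inj₁ ik = sorted ik kj ij
    ... | inj₁ ij | inj₂ kj | inj₂ ki = sorted ki ij kj
    ... | inj₂ ji | inj₁ jk | inj₁ ik = sorted ji ik jk
    ... | inj₂ ji | inj₁ jk | inj₂ ki = sorted jk ki ji
    ... | inj₂ ji | inj₂ kj | inj₁ ik = Fin.<-asym (Fin.<-trans (proj₁ kj) (proj₁ ji)) (proj₁ ik)
    ... | inj₂ ji | inj₂ kj | inj₂ ki = sorted kj ji ki

    open Mantel A (λ i j → Bool.∨-comm (doubleFrom i j) (doubleFrom j i)) triangleFree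

    excess-edge : ∀ e → ∣ palette t e ∣ ∸ 3 ≤ uncurry adj (ends e)
    excess-edge e = ≤-trans (palette-excess (palette t e))
      (subst (λ b → indicator b ≤ uncurry adj (ends e)) (doubleFrom-edge e) (left (doubleFrom (Edge.lo e) (Edge.hi e)) _))
      where
      left : ∀ b c → indicator b ≤ indicator (b ∨ c)
      left true  _ = ≤-refl
      left false _ = z≤n

  excess≤ : excess t ≤ n ^ 2 / 4
  excess≤ = begin
    excess t                                  ≤⟨ sum-map-≤ excess-edge (edges n) ⟩
    sum (map (uncurry adj ∘ ends) (edges n))  ≡⟨ sum-edges adj ⟩
    pairSum adj (allFin n)                    ≤⟨ mantel _ (allFin n) ≤-refl ⟩
    length (allFin n) ^ 2 / 4                 ≡⟨ cong (λ l → l ^ 2 / 4) (length-tabulate {n = n} id) ⟩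
    n ^ 2 / 4                                 ∎
    where open ≤-Reasoning

-- The balanced bipartite template

twoPartPalette : Bool → Bool → Subset 4
twoPartPalette b c = true ∷ true ∷ true ∷ (b xor c) ∷ []

∣twoPartPalette∣ : ∀ b c → ∣ twoPartPalette b c ∣ ≡ 3 + differ b c
∣twoPartPalette∣ true  true  = refl
∣twoPartPalette∣ true  false = refl
∣twoPartPalette∣ false true  = refl
∣twoPartPalette∣ false false = refl

differ≤1 : ∀ b c → differ b c ≤ 1
differ≤1 true  true  = z≤n
differ≤1 true  false = ≤-refl
differ≤1 false true  = ≤-refl
differ≤1 false false = z≤n

twoPart : ∀ n → Template n
twoPart n = record
  { palette  = λ e → twoPartPalette (lookup cs (Edge.lo e)) (lookup cs (Edge.hi e))
  ; nonempty = λ _ → 0F , here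
  }
  where cs = alternating n

twoPart-admissible : ∀ n → Admissible NoDK₃ (twoPart n)
twoPart-admissible n c c∈ {i} {j} {k} i<j j<k (ij , jk , ik) =
  no-three-booleans (apart _ ij) (apart _ jk) (apart (edge i k (Fin.<-trans i<j j<k)) ik)
  where
  cs = alternating n
  xor⇒≢ : ∀ b c → (b xor c) ≡ true → b ≢ c
  xor⇒≢ true true () _
  xor⇒≢ false false () _
  apart : ∀ e → c e ≡ 3F → lookup cs (Edge.lo e) ≢ lookup cs (Edge.hi e)
  apart e eq = xor⇒≢ _ _ ([]=⇒lookup (subst (_∈ˢ palette (twoPart n) e) eq (c∈ e)))

pairSum-toList : ∀ {n} (cs : Vec Bool n) → pairSum differ (Vec.toList cs) ≡ crossing cs
pairSum-toList []       = refl
pairSum-toList (c ∷ cs) = cong₂ _+_ (row cs) (pairSum-toList cs)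
  where
  row : ∀ {m} (ds : Vec Bool m) → sum (map (differ c) (Vec.toList ds)) ≡ differAll c ds
  row []       = refl
  row (d ∷ ds) = cong (differ c d +_) (row ds)

map-lookup-allFin : ∀ {n} (cs : Vec Bool n) → map (lookup cs) (allFin n) ≡ Vec.toList cs
map-lookup-allFin []       = refl
map-lookup-allFin {suc n} (c ∷ cs) = cong (c ∷_) (trans (map-tabulate suc (lookup (c ∷ cs)))
  (trans (sym (map-tabulate id (lookup cs))) (map-lookup-allFin cs)))

excess-twoPart : ∀ n → excess (twoPart n) ≡ n ^ 2 / 4
excess-twoPart n = begin
  excess (twoPart n)                                          ≡⟨ cong sum (map-cong excess-edge (edges n)) ⟩
  sum (map (uncurry (differ on lookup cs) ∘ ends) (edges n))  ≡⟨ sum-edges (differ on lookup cs) ⟩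
  pairSum (differ on lookup cs) (allFin n)                    ≡⟨ pairSum-map differ (lookup cs) (allFin n) ⟩
  pairSum differ (map (lookup cs) (allFin n))                 ≡⟨ cong (pairSum differ) (map-lookup-allFin cs) ⟩
  pairSum differ (Vec.toList cs)                              ≡⟨ pairSum-toList cs ⟩
  crossing cs                                                 ≡⟨ crossing-alternating n ⟩
  n ^ 2 / 4                                                   ∎
  where
  open ≡-Reasoning
  cs = alternating n
  excess-edge : ∀ e → ∣ palette (twoPart n) e ∣ ∸ 3 ≡ (differ on lookup cs) (Edge.lo e) (Edge.hi e)
  excess-edge e = cong (_∸ 3) (∣twoPartPalette∣ (lookup cs (Edge.lo e)) (lookup cs (Edge.hi e)))

-- Logarithms, entropy and density

/-+ : ∀ a b d → ℤ.+ (a + b) ℚ./ suc d ≡ ℤ.+ a ℚ./ suc d ℚ.+ ℤ.+ b ℚ./ suc d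
/-+ zero    b d = trans (sym (ℚ.+-identityˡ _)) (cong (ℚ._+ ℤ.+ b ℚ./ suc d) (sym (ℚ.0/n≡0 (suc d))))
/-+ (suc a) b d = begin
  ℤ.+ suc (a + b) ℚ./ suc d
    ≡⟨ trans (/-suc (a + b) d) (cong (ℚ._+ u) (/-+ a b d)) ⟩
  (ℤ.+ a ℚ./ suc d ℚ.+ ℤ.+ b ℚ./ suc d) ℚ.+ u
    ≡⟨ solve 3 (λ x y z → (x :+ y) :+ z := (x :+ z) :+ y) refl (ℤ.+ a ℚ./ suc d) (ℤ.+ b ℚ./ suc d) u ⟩
  (ℤ.+ a ℚ./ suc d ℚ.+ u) ℚ.+ ℤ.+ b ℚ./ suc d
    ≡⟨ cong (ℚ._+ ℤ.+ b ℚ./ suc d) (/-suc a d) ⟨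
  ℤ.+ suc a ℚ./ suc d ℚ.+ ℤ.+ b ℚ./ suc d ∎
  where
  open ≡-Reasoning
  open ℚSolver.+-*-Solver
  u = ℤ.+ 1 ℚ./ suc d

ℕ→ℚ-mono : ∀ a b → a ≤ b → ℕ→ℚ a ℚ.≤ ℕ→ℚ b
ℕ→ℚ-mono a b a≤b = /-mono a 0 b 0 (*-monoˡ-≤ 1 a≤b)

ℕ→ℚ-+ : ∀ a b → ℕ→ℚ (a + b) ≡ ℕ→ℚ a ℚ.+ ℕ→ℚ b
ℕ→ℚ-+ a b = /-+ a b 0

1/suc*ℕ→ℚ : ∀ d a → (ℤ.+ 1 ℚ./ suc d) ℚ.* ℕ→ℚ a ≡ ℤ.+ a ℚ./ suc d
1/suc*ℕ→ℚ d zero    = trans (ℚ.*-zeroʳ (ℤ.+ 1 ℚ./ suc d)) (sym (ℚ.0/n≡0 (suc d)))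
1/suc*ℕ→ℚ d (suc a) = begin
  u ℚ.* ℕ→ℚ (suc a)      ≡⟨ cong (u ℚ.*_) (/-suc a 0) ⟩
  u ℚ.* (ℕ→ℚ a ℚ.+ 1ℚ)   ≡⟨ trans (ℚ.*-distribˡ-+ u (ℕ→ℚ a) 1ℚ) (cong₂ ℚ._+_ (1/suc*ℕ→ℚ d a) (ℚ.*-identityʳ u)) ⟩
  ℤ.+ a ℚ./ suc d ℚ.+ u  ≡⟨ /-suc a d ⟨
  ℤ.+ suc a ℚ./ suc d    ∎
  where
  open ≡-Reasoning
  u = ℤ.+ 1 ℚ./ suc d

1/suc*suc≡1 : ∀ d → (ℤ.+ 1 ℚ./ suc d) ℚ.* ℕ→ℚ (suc d) ≡ 1ℚ
1/suc*suc≡1 d = trans (1/suc*ℕ→ℚ d (suc d))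
  (ℚ.≤-antisym (/-mono (suc d) d 1 0 (≤-reflexive (*-comm (suc d) 1)))
               (/-mono 1 0 (suc d) d (≤-reflexive (*-comm 1 (suc d)))))

≤-scale : ∀ {p q r} → 0ℚ ℚ.≤ r → p ℚ.≤ q → p ℚ.* r ℚ.≤ q ℚ.* r
≤-scale {r = r} 0≤r = ℚ.*-monoʳ-≤-nonNeg r {{ℚ.nonNegative 0≤r}}

0≤ℕ→ℚ : ∀ a → 0ℚ ℚ.≤ ℕ→ℚ a
0≤ℕ→ℚ a = ℕ→ℚ-mono 0 a z≤n

≤⇒0≤- : ∀ {p q} → p ℚ.≤ q → 0ℚ ℚ.≤ q ℚ.- p
≤⇒0≤- {p} {q} p≤q = subst (ℚ._≤ q ℚ.- p) (ℚ.+-inverseʳ p) (ℚ.+-monoˡ-≤ (ℚ.- p) p≤q)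

≤+⇒-≤ : ∀ {p q r} → p ℚ.≤ q ℚ.+ r → p ℚ.- q ℚ.≤ r
≤+⇒-≤ {p} {q} {r} h = subst (p ℚ.- q ℚ.≤_) (solve 2 (λ q r → (q :+ r) :- q := r) refl q r) (ℚ.+-monoˡ-≤ (ℚ.- q) h)
  where open ℚSolver.+-*-Solver

p≤∣p∣ : ∀ p → p ℚ.≤ ℚ.∣ p ∣
p≤∣p∣ p with ℚ.≤-total 0ℚ p
... | inj₁ 0≤p = ℚ.≤-reflexive (sym (ℚ.0≤p⇒∣p∣≡p 0≤p))
... | inj₂ p≤0 = ℚ.≤-trans p≤0 (ℚ.0≤∣p∣ p)

dist-sym : ∀ p q → ℚ.∣ p ℚ.- q ∣ ≡ ℚ.∣ q ℚ.- p ∣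
dist-sym p q = trans (sym (ℚ.∣-p∣≡∣p∣ (p ℚ.- q))) (cong ℚ.∣_∣ (neg-swap p q))

dist-triangle : ∀ p q r {a b} → ℚ.∣ p ℚ.- q ∣ ℚ.≤ a → ℚ.∣ q ℚ.- r ∣ ℚ.≤ b → ℚ.∣ p ℚ.- r ∣ ℚ.≤ a ℚ.+ b
dist-triangle p q r {a} {b} h h′ = begin
  ℚ.∣ p ℚ.- r ∣                    ≡⟨ cong ℚ.∣_∣ (solve 3 (λ p q r → p :- r := (p :- q) :+ (q :- r)) refl p q r) ⟩
  ℚ.∣ (p ℚ.- q) ℚ.+ (q ℚ.- r) ∣    ≤⟨ ℚ.∣p+q∣≤∣p∣+∣q∣ (p ℚ.- q) (q ℚ.- r) ⟩
  ℚ.∣ p ℚ.- q ∣ ℚ.+ ℚ.∣ q ℚ.- r ∣  ≤⟨ ℚ.+-mono-≤ h h′ ⟩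
  a ℚ.+ b                          ∎
  where
  open ℚ.≤-Reasoning
  open ℚSolver.+-*-Solver

≡⇒≃ᴿ : ∀ {x y} → (∀ k → seq x k ≡ seq y k) → x ≃ᴿ y
≡⇒≃ᴿ {x} {y} eq ε ε>0 = 0 , λ k _ → ℚ.≤-trans
  (ℚ.≤-reflexive (cong ℚ.∣_∣ (trans (cong (ℚ._- seq y k) (eq k)) (ℚ.+-inverseʳ (seq y k))))) (ℚ.<⇒≤ ε>0)

⌊log₂⌋-*-lower : ∀ m n .{{_ : NonZero m}} .{{_ : NonZero n}} → ⌊log₂ m ⌋ + ⌊log₂ n ⌋ ≤ ⌊log₂ m * n ⌋
⌊log₂⌋-*-lower m n = ≮⇒≥ λ lt → <-irrefl refl (begin-strict
  m * n                          <⟨ ⌊log₂⌋-upper (m * n) {{m*n≢0 m n}} ⟩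
  2 ^ suc ⌊log₂ m * n ⌋          ≤⟨ ^-monoʳ-≤ 2 lt ⟩
  2 ^ (⌊log₂ m ⌋ + ⌊log₂ n ⌋)    ≡⟨ ^-distribˡ-+-* 2 ⌊log₂ m ⌋ ⌊log₂ n ⌋ ⟩
  2 ^ ⌊log₂ m ⌋ * 2 ^ ⌊log₂ n ⌋  ≤⟨ *-mono-≤ (⌊log₂⌋-lower m) (⌊log₂⌋-lower n) ⟩
  m * n                          ∎)
  where open ≤-Reasoning

-- Rounding down two logarithms loses less than 2 in total, hence at most 1 between integers.
⌊log₂⌋-*-upper : ∀ m n .{{_ : NonZero m}} .{{_ : NonZero n}} → ⌊log₂ m * n ⌋ ≤ suc (⌊log₂ m ⌋ + ⌊log₂ n ⌋)
⌊log₂⌋-*-upper m n = ≮⇒≥ λ lt → <-irrefl refl (begin-strict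
  m * n                                  <⟨ *-mono-< (⌊log₂⌋-upper m) (⌊log₂⌋-upper n) ⟩
  2 ^ suc ⌊log₂ m ⌋ * 2 ^ suc ⌊log₂ n ⌋  ≡⟨ ^-distribˡ-+-* 2 (suc ⌊log₂ m ⌋) (suc ⌊log₂ n ⌋) ⟨
  2 ^ (suc ⌊log₂ m ⌋ + suc ⌊log₂ n ⌋)    ≡⟨ cong (λ i → 2 ^ suc i) (+-suc ⌊log₂ m ⌋ ⌊log₂ n ⌋) ⟩
  2 ^ suc (suc (⌊log₂ m ⌋ + ⌊log₂ n ⌋))  ≤⟨ ^-monoʳ-≤ 2 lt ⟩
  2 ^ ⌊log₂ m * n ⌋                      ≤⟨ ⌊log₂⌋-lower (m * n) {{m*n≢0 m n}} ⟩
  m * n                                  ∎)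
  where open ≤-Reasoning

-- suc (pred-2* k) computes to 2 * suc k, the shape of denominator /-mono and /-suc expect.
pred-2* : ℕ → ℕ
pred-2* k = k + suc (k + 0)

-- The effect of one unit of rounding in ⌊log₂⌋ on the `k`-th approximation of log₄.
tol : ℕ → ℚ
tol k = ℤ.+ 1 ℚ./ (2 * suc k)

log₄-approx-mono : ∀ {m n} k → m ≤ n → log₄-approx m k ℚ.≤ log₄-approx n k
log₄-approx-mono {m} {n} k m≤n = /-mono ⌊log₂ m ^ suc k ⌋ (pred-2* k) ⌊log₂ n ^ suc k ⌋ (pred-2* k)
  (*-monoˡ-≤ (2 * suc k) (⌊log₂⌋-mono-≤ (^-monoˡ-≤ (suc k) m≤n)))

-- Nothing is lost by rounding at a power of four, so its logarithm is exact at every stage.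
log₄-approx-4^ : ∀ b k → log₄-approx (4 ^ b) k ≡ ℕ→ℚ b
log₄-approx-4^ b k = begin
  ℤ.+ ⌊log₂ (4 ^ b) ^ suc k ⌋ ℚ./ (2 * suc k)     ≡⟨ cong (λ i → ℤ.+ i ℚ./ (2 * suc k)) log≡ ⟩
  ℤ.+ (2 * (b * suc k)) ℚ./ (2 * suc k)
    ≡⟨ ℚ.≤-antisym (/-mono (2 * (b * suc k)) (pred-2* k) b 0 (≤-reflexive cross))
                   (/-mono b 0 (2 * (b * suc k)) (pred-2* k) (≤-reflexive (sym cross))) ⟩
  ℕ→ℚ b                                           ∎
  where
  open ≡-Reasoning
  log≡ : ⌊log₂ (4 ^ b) ^ suc k ⌋ ≡ 2 * (b * suc k)
  log≡ = trans (cong ⌊log₂_⌋ (trans (^-*-assoc 4 b (suc k)) (^-*-assoc 2 2 (b * suc k)))) (⌊log₂[2^n]⌋≡n _)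
  cross : 2 * (b * suc k) * 1 ≡ b * (2 * suc k)
  cross = solve 2 (λ b k → con 2 :* (b :* k) :* con 1 := b :* (con 2 :* k)) refl b (suc k)
    where open ℕSolver.+-*-Solver

log₄-approx-*-lower : ∀ m n k .{{_ : NonZero m}} .{{_ : NonZero n}} →
  log₄-approx m k ℚ.+ log₄-approx n k ℚ.≤ log₄-approx (m * n) k
log₄-approx-*-lower m n k = subst (ℚ._≤ log₄-approx (m * n) k) (/-+ A B (pred-2* k))
  (/-mono (A + B) (pred-2* k) ⌊log₂ (m * n) ^ suc k ⌋ (pred-2* k) (*-monoˡ-≤ (2 * suc k)
    (subst (λ i → A + B ≤ ⌊log₂ i ⌋) (sym (^-distribʳ-* (suc k) m n))
      (⌊log₂⌋-*-lower (m ^ suc k) (n ^ suc k) {{m^n≢0 m (suc k)}} {{m^n≢0 n (suc k)}}))))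
  where
  A = ⌊log₂ m ^ suc k ⌋
  B = ⌊log₂ n ^ suc k ⌋

log₄-approx-*-upper : ∀ m n k .{{_ : NonZero m}} .{{_ : NonZero n}} →
  log₄-approx (m * n) k ℚ.≤ log₄-approx m k ℚ.+ log₄-approx n k ℚ.+ tol k
log₄-approx-*-upper m n k = subst (log₄-approx (m * n) k ℚ.≤_)
  (trans (/-suc (A + B) (pred-2* k)) (cong (ℚ._+ tol k) (/-+ A B (pred-2* k))))
  (/-mono ⌊log₂ (m * n) ^ suc k ⌋ (pred-2* k) (suc (A + B)) (pred-2* k) (*-monoˡ-≤ (2 * suc k)
    (subst (λ i → ⌊log₂ i ⌋ ≤ suc (A + B)) (sym (^-distribʳ-* (suc k) m n))
      (⌊log₂⌋-*-upper (m ^ suc k) (n ^ suc k) {{m^n≢0 m (suc k)}} {{m^n≢0 n (suc k)}}))))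
  where
  A = ⌊log₂ m ^ suc k ⌋
  B = ⌊log₂ n ^ suc k ⌋

log₄-approx-^-lower : ∀ m a k .{{_ : NonZero m}} → ℕ→ℚ a ℚ.* log₄-approx m k ℚ.≤ log₄-approx (m ^ a) k
log₄-approx-^-lower m zero    k = ℚ.≤-reflexive (trans (ℚ.*-zeroˡ (log₄-approx m k)) (sym (log₄-approx-4^ 0 k)))
log₄-approx-^-lower m (suc a) k = begin
  ℕ→ℚ (suc a) ℚ.* l            ≡⟨ cong (ℚ._* l) (/-suc a 0) ⟩
  (ℕ→ℚ a ℚ.+ 1ℚ) ℚ.* l         ≡⟨ solve 2 (λ a l → (a :+ con 1ℚ) :* l := l :+ a :* l) refl (ℕ→ℚ a) l ⟩
  l ℚ.+ ℕ→ℚ a ℚ.* l            ≤⟨ ℚ.+-monoʳ-≤ l (log₄-approx-^-lower m a k) ⟩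
  l ℚ.+ log₄-approx (m ^ a) k  ≤⟨ log₄-approx-*-lower m (m ^ a) k {{it}} {{m^n≢0 m a}} ⟩
  log₄-approx (m ^ suc a) k    ∎
  where
  open ℚ.≤-Reasoning
  open ℚSolver.+-*-Solver
  l = log₄-approx m k

-- Each of the `a` multiplications costs one `tol k`. For fixed `a` the total vanishes as `k` grows,
-- by `multiple-tol`.
log₄-approx-^-upper : ∀ m a k .{{_ : NonZero m}} →
  log₄-approx (m ^ a) k ℚ.≤ ℕ→ℚ a ℚ.* log₄-approx m k ℚ.+ ℕ→ℚ a ℚ.* tol k
log₄-approx-^-upper m zero    k = ℚ.≤-reflexive (trans (log₄-approx-4^ 0 k)
  (sym (cong₂ ℚ._+_ (ℚ.*-zeroˡ (log₄-approx m k)) (ℚ.*-zeroˡ (tol k)))))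
log₄-approx-^-upper m (suc a) k = begin
  log₄-approx (m ^ suc a) k          ≤⟨ log₄-approx-*-upper m (m ^ a) k {{it}} {{m^n≢0 m a}} ⟩
  l ℚ.+ log₄-approx (m ^ a) k ℚ.+ t  ≤⟨ ℚ.+-monoˡ-≤ t (ℚ.+-monoʳ-≤ l (log₄-approx-^-upper m a k)) ⟩
  l ℚ.+ (ℕ→ℚ a ℚ.* l ℚ.+ ℕ→ℚ a ℚ.* t) ℚ.+ t
    ≡⟨ solve 3 (λ a l t → l :+ (a :* l :+ a :* t) :+ t := (a :+ con 1ℚ) :* l :+ (a :+ con 1ℚ) :* t) refl
         (ℕ→ℚ a) l t ⟩
  (ℕ→ℚ a ℚ.+ 1ℚ) ℚ.* l ℚ.+ (ℕ→ℚ a ℚ.+ 1ℚ) ℚ.* t  ≡⟨ cong (λ c → c ℚ.* l ℚ.+ c ℚ.* t) (/-suc a 0) ⟨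
  ℕ→ℚ (suc a) ℚ.* l ℚ.+ ℕ→ℚ (suc a) ℚ.* t        ∎
  where
  open ℚ.≤-Reasoning
  open ℚSolver.+-*-Solver
  l = log₄-approx m k
  t = tol k

multiple-tol : ∀ c ε → 0ℚ ℚ.< ε → ∃[ K ] ∀ k → K ≤ k → ℕ→ℚ c ℚ.* tol k ℚ.≤ ε
multiple-tol zero    ε ε>0 = 0 , λ k _ → subst (ℚ._≤ ε) (sym (ℚ.*-zeroˡ (tol k))) (ℚ.<⇒≤ ε>0)
multiple-tol (suc c) ε ε>0 =
  let K , h = multiple-tol c (½ ℚ.* ε) (½-pos ε>0) ; L , h′ = ℚ-archimedean (½ ℚ.* ε) (½-pos ε>0)
  in K ⊔ L , λ k k≥ → let open ℚ.≤-Reasoning in begin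
    ℕ→ℚ (suc c) ℚ.* tol k
      ≡⟨ cong (ℚ._* tol k) (/-suc c 0) ⟩
    (ℕ→ℚ c ℚ.+ 1ℚ) ℚ.* tol k
      ≡⟨ trans (ℚ.*-distribʳ-+ (tol k) (ℕ→ℚ c) 1ℚ) (cong (ℕ→ℚ c ℚ.* tol k ℚ.+_) (ℚ.*-identityˡ (tol k))) ⟩
    ℕ→ℚ c ℚ.* tol k ℚ.+ tol k
      ≤⟨ ℚ.+-mono-≤ (h k (m⊔n≤o⇒m≤o K L k≥)) (h′ k (m⊔n≤o⇒n≤o K L k≥)) ⟩
    ½ ℚ.* ε ℚ.+ ½ ℚ.* ε
      ≡⟨ ½+½ ε ⟩
    ε ∎

log₄-approx-4^≡ : ∀ {m} b k → m ≡ 4 ^ b → log₄-approx m k ≡ ℕ→ℚ b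
log₄-approx-4^≡ b k refl = log₄-approx-4^ b k

-- Approximations of log₄ 3, not a logarithm to base 3.
log₃ : ℕ → ℚ
log₃ = log₄-approx 3

log₃≤1 : ∀ k → log₃ k ℚ.≤ 1ℚ
log₃≤1 k = ℚ.≤-trans (log₄-approx-mono k (n≤1+n 3)) (ℚ.≤-reflexive (log₄-approx-4^≡ {4} 1 k refl))

0≤log₃ : ∀ k → 0ℚ ℚ.≤ log₃ k
0≤log₃ k = ℚ.≤-trans (ℚ.≤-reflexive (sym (log₄-approx-4^≡ {1} 0 k refl))) (log₄-approx-mono k (s≤s z≤n))

-- The k-th approximation to the entropy of N pairs, F of which have full palette while
-- the other palettes have three colours.
mixture : ℕ → ℕ → ℕ → ℚ
mixture k N F = ℕ→ℚ N ℚ.* log₃ k ℚ.+ ℕ→ℚ F ℚ.* (1ℚ ℚ.- log₃ k)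

mixture-+ : ∀ k N F M G → mixture k (N + M) (F + G) ≡ mixture k N F ℚ.+ mixture k M G
mixture-+ k N F M G = trans
  (cong₂ (λ a b → a ℚ.* log₃ k ℚ.+ b ℚ.* (1ℚ ℚ.- log₃ k)) (ℕ→ℚ-+ N M) (ℕ→ℚ-+ F G))
  (solve 6 (λ n m f g l u → (n :+ m) :* l :+ (f :+ g) :* u := (n :* l :+ f :* u) :+ (m :* l :+ g :* u)) refl
    (ℕ→ℚ N) (ℕ→ℚ M) (ℕ→ℚ F) (ℕ→ℚ G) (log₃ k) (1ℚ ℚ.- log₃ k))
  where open ℚSolver.+-*-Solver

mixture-mono : ∀ k N F G → F ≤ G → mixture k N F ℚ.≤ mixture k N G
mixture-mono k N F G F≤G = ℚ.+-monoʳ-≤ (ℕ→ℚ N ℚ.* log₃ k) (≤-scale (≤⇒0≤- (log₃≤1 k)) (ℕ→ℚ-mono F G F≤G))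

mixture-1-0 : ∀ k → mixture k 1 0 ≡ log₃ k
mixture-1-0 k = solve 1 (λ l → con 1ℚ :* l :+ con 0ℚ :* (con 1ℚ :- l) := l) refl (log₃ k)
  where open ℚSolver.+-*-Solver

mixture-1-1 : ∀ k → mixture k 1 1 ≡ 1ℚ
mixture-1-1 k = solve 1 (λ l → con 1ℚ :* l :+ con 1ℚ :* (con 1ℚ :- l) := con 1ℚ) refl (log₃ k)
  where open ℚSolver.+-*-Solver

log₄-approx≤mixture : ∀ k m → m ≤ 4 → log₄-approx m k ℚ.≤ mixture k 1 (m ∸ 3)
log₄-approx≤mixture k m m≤4 = [ small ∘ s≤s⁻¹ , full ]′ (m≤n⇒m<n∨m≡n m≤4)
  where
  small : m ≤ 3 → log₄-approx m k ℚ.≤ mixture k 1 (m ∸ 3)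
  small m≤3 = ℚ.≤-trans (log₄-approx-mono k m≤3)
    (ℚ.≤-reflexive (trans (sym (mixture-1-0 k)) (cong (mixture k 1) (sym (m≤n⇒m∸n≡0 m≤3)))))
  full : m ≡ 4 → log₄-approx m k ℚ.≤ mixture k 1 (m ∸ 3)
  full m≡4 = ℚ.≤-reflexive (trans (log₄-approx-4^≡ 1 k m≡4)
    (trans (sym (mixture-1-1 k)) (cong (mixture k 1) (sym m∸3≡1))))
    where
    m∸3≡1 : m ∸ 3 ≡ 1
    m∸3≡1 = cong (_∸ 3) m≡4

log₄-approx≡mixture : ∀ k m f → f ≤ 1 → m ≡ 3 + f → log₄-approx m k ≡ mixture k 1 f
log₄-approx≡mixture k m zero       _ m≡ = trans (cong (λ i → log₄-approx i k) m≡3) (sym (mixture-1-0 k))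
  where
  m≡3 : m ≡ 3
  m≡3 = m≡
log₄-approx≡mixture k m (suc zero) _ m≡ = trans (log₄-approx-4^≡ 1 k m≡) (sym (mixture-1-1 k))
log₄-approx≡mixture k m (suc (suc f)) (s≤s ())

module _ {A : Set} (size : A → ℕ) (k : ℕ) where

  private
    total : List A → ℚ
    total as = seq (sumᴿ (map (log₄ ∘ size) as)) k

    excesses : List A → ℕ
    excesses as = sum (map (λ a → size a ∸ 3) as)

    mixture-∷ : ∀ a as → mixture k (suc (length as)) (excesses (a ∷ as)) ≡
      mixture k 1 (size a ∸ 3) ℚ.+ mixture k (length as) (excesses as)
    mixture-∷ a as = mixture-+ k 1 (size a ∸ 3) (length as) (excesses as)

    mixture-0-0 : mixture k 0 0 ≡ 0ℚ
    mixture-0-0 = trans (cong₂ ℚ._+_ (ℚ.*-zeroˡ (log₃ k)) (ℚ.*-zeroˡ (1ℚ ℚ.- log₃ k))) (ℚ.+-identityˡ 0ℚ)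

  sum-log₄≤ : (∀ a → size a ≤ 4) → ∀ as → total as ℚ.≤ mixture k (length as) (excesses as)
  sum-log₄≤ h []       = ℚ.≤-reflexive (sym mixture-0-0)
  sum-log₄≤ h (a ∷ as) = ℚ.≤-trans (ℚ.+-mono-≤ (log₄-approx≤mixture k (size a) (h a)) (sum-log₄≤ h as))
    (ℚ.≤-reflexive (sym (mixture-∷ a as)))

  sum-log₄≡ : ∀ (f : A → ℕ) → (∀ a → f a ≤ 1) → (∀ a → size a ≡ 3 + f a) → ∀ as →
    total as ≡ mixture k (length as) (excesses as)
  sum-log₄≡ f f≤1 size≡ []       = sym mixture-0-0
  sum-log₄≡ f f≤1 size≡ (a ∷ as) = trans
    (cong₂ ℚ._+_
      (trans (log₄-approx≡mixture k (size a) (f a) (f≤1 a) (size≡ a)) (cong (mixture k 1) (sym excess≡)))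
      (sum-log₄≡ f f≤1 size≡ as))
    (sym (mixture-∷ a as))
    where
    excess≡ : size a ∸ 3 ≡ f a
    excess≡ = trans (cong (_∸ 3) (size≡ a)) (m+n∸m≡n 3 (f a))

-- Extremal entropy and its density

Ent≤mixture : ∀ {n} (t : Template n) k → seq (Ent t) k ℚ.≤ mixture k (n C 2) (excess t)
Ent≤mixture {n} t k = subst (λ N → seq (Ent t) k ℚ.≤ mixture k N (excess t)) (length-edges n)
  (sum-log₄≤ (λ e → ∣ palette t e ∣) k (λ e → ∣p∣≤n (palette t e)) (edges n))

Ent-twoPart : ∀ n k → seq (Ent (twoPart n)) k ≡ mixture k (n C 2) (n ^ 2 / 4)
Ent-twoPart n k = trans
  (sum-log₄≡ (λ e → ∣ palette (twoPart n) e ∣) k crossed (λ e → differ≤1 (part Edge.lo e) (part Edge.hi e))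
    (λ e → ∣twoPartPalette∣ (part Edge.lo e) (part Edge.hi e)) (edges n))
  (cong₂ (mixture k) (length-edges n) (excess-twoPart n))
  where
  part : (Edge n → Fin n) → Edge n → Bool
  part end e = lookup (alternating n) (end e)
  crossed : Edge n → ℕ
  crossed e = differ (part Edge.lo e) (part Edge.hi e)

≤⇒≤ᴿ : ∀ {x y} → (∀ k → seq x k ℚ.≤ seq y k) → x ≤ᴿ y
≤⇒≤ᴿ {x} {y} h ε ε>0 = 0 , λ k _ → ℚ.≤-trans (h k)
  (subst (ℚ._≤ seq y k ℚ.+ ε) (ℚ.+-identityʳ (seq y k)) (ℚ.+-monoʳ-≤ (seq y k) (ℚ.<⇒≤ ε>0)))

-- Holds at every stage `k`, not just in the limit: a mixture grows with the number of full
-- palettes, which `excess≤` bounds by ⌊n²/4⌋.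
twoPart-max : ∀ {n} (t : Template n) → Admissible NoDK₃ t → ∀ k → seq (Ent t) k ℚ.≤ seq (Ent (twoPart n)) k
twoPart-max {n} t adm k = ℚ.≤-trans (Ent≤mixture t k)
  (ℚ.≤-trans (mixture-mono k (n C 2) _ _ (excess≤ t adm)) (ℚ.≤-reflexive (sym (Ent-twoPart n k))))

isEx-twoPart : ∀ n → IsEx NoDK₃ n (Ent (twoPart n))
isEx-twoPart n = (twoPart n , twoPart-admissible n , ≡⇒≃ᴿ {Ent (twoPart n)} {Ent (twoPart n)} λ _ → refl) ,
  λ t adm → ≤⇒≤ᴿ {Ent t} {Ent (twoPart n)} (twoPart-max t adm)

-- A maximum is determined only up to `≃ᴿ`: `x` is attained by some `t`, whose entropy is at most
-- that of `twoPart n`, which in turn is at most `x`. This lets the result apply to every entropy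
-- density, with any choice of maxima.
isEx-unique : ∀ {n x} → IsEx NoDK₃ n x → Ent (twoPart n) ≃ᴿ x
isEx-unique {n} {x} ((t , adm , t≃x) , max) ε ε>0 =
  let K , h = t≃x ε ε>0 ; L , h′ = max (twoPart n) (twoPart-admissible n) ε ε>0
  in K ⊔ L , λ k k≥ → ≤⇒dist≤ (seq (Ent (twoPart n)) k) (seq x k)
    (≤+⇒-≤ (h′ k (m⊔n≤o⇒n≤o K L k≥)))
    (ℚ.≤-trans (ℚ.+-monoʳ-≤ (seq x k) (ℚ.neg-antimono-≤ (twoPart-max t adm k)))
      (ℚ.≤-trans (p≤∣p∣ (seq x k ℚ.- seq (Ent t) k))
        (subst (ℚ._≤ ε) (dist-sym (seq (Ent t) k) (seq x k)) (h k (m⊔n≤o⇒m≤o K L k≥)))))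

density : ℝ
density = fromℚ ½ +ᴿ ½ ·ᴿ log₄ 3

1/suc : ℕ → ℚ
1/suc m = ℤ.+ 1 ℚ./ suc m

0≤1/suc : ∀ m → 0ℚ ℚ.≤ 1/suc m
0≤1/suc m = /-mono 0 0 1 m z≤n

≤1/suc⇒≤* : ∀ a b s → a * suc s ≤ b → ℕ→ℚ a ℚ.≤ 1/suc s ℚ.* ℕ→ℚ b
≤1/suc⇒≤* a b s h = ℚ.≤-trans (/-mono a 0 b s (≤-trans h (≤-reflexive (sym (*-identityʳ b)))))
  (ℚ.≤-reflexive (sym (1/suc*ℕ→ℚ s b)))

2*ℕ→ℚ : ∀ a → ℕ→ℚ (2 * a) ≡ ℕ→ℚ a ℚ.+ ℕ→ℚ a
2*ℕ→ℚ a = trans (cong (λ b → ℕ→ℚ (a + b)) (+-identityʳ a)) (ℕ→ℚ-+ a a)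

-- ⌊n²/4⌋ exceeds half of n C 2 by at most n/4.
quarter-excess : ∀ n s → suc s ≤ 2 * (n ∸ 1) → (2 * (n ^ 2 / 4) ∸ n C 2) * suc s ≤ 2 * (n C 2)
quarter-excess n s s≤ = *-cancelˡ-≤ 2 (begin
  2 * (z * suc s)    ≡⟨ *-assoc 2 z (suc s) ⟨
  2 * z * suc s      ≤⟨ *-mono-≤ 2z≤n s≤ ⟩
  n * (2 * (n ∸ 1))  ≡⟨ solve 2 (λ a b → a :* (con 2 :* b) := con 2 :* (a :* b)) refl n (n ∸ 1) ⟩
  2 * (n * (n ∸ 1))  ≡⟨ cong (2 *_) n*[n-1] ⟩
  2 * (2 * (n C 2))  ∎)
  where
  open ≤-Reasoning
  Q = n ^ 2 / 4
  z = 2 * Q ∸ n C 2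
  open ℕSolver.+-*-Solver
  n*[n-1] : n * (n ∸ 1) ≡ 2 * (n C 2)
  n*[n-1] = trans (*-distribˡ-∸ n n 1) (trans
    (cong₂ _∸_ (trans (cong (n *_) (sym (*-identityʳ n))) (sym (2*nC2+n≡n² n))) (*-identityʳ n))
    (m+n∸n≡m (2 * (n C 2)) n))
  2z≤n : 2 * z ≤ n
  2z≤n = begin
    2 * (2 * Q ∸ n C 2)            ≡⟨ *-distribˡ-∸ 2 (2 * Q) (n C 2) ⟩
    2 * (2 * Q) ∸ 2 * (n C 2)      ≡⟨ cong (_∸ 2 * (n C 2)) (sym (*-assoc 2 2 Q)) ⟩
    4 * Q ∸ 2 * (n C 2)            ≤⟨ ∸-monoˡ-≤ (2 * (n C 2)) (4*quarter≤ n) ⟩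
    n ^ 2 ∸ 2 * (n C 2)            ≡⟨ cong (_∸ 2 * (n C 2)) (sym (2*nC2+n≡n² n)) ⟩
    2 * (n C 2) + n ∸ 2 * (n C 2)  ≡⟨ m+n∸m≡n (2 * (n C 2)) n ⟩
    n                              ∎

-- With `p` the density, the entropy equals `p * c + w * u`, where `w` is the excess of ⌊n²/4⌋ over
-- half the number `c` of pairs and `u = 1 - log₄ 3` lies between 0 and 1. By `quarter-excess`, `w`
-- is small compared with `c`.
density-bounds : ∀ n s k → suc s ≤ 2 * (n ∸ 1) →
  seq density k ℚ.* ℕ→ℚ (n C 2) ℚ.≤ seq (Ent (twoPart n)) k ×
  seq (Ent (twoPart n)) k ℚ.≤ (seq density k ℚ.+ 1/suc s) ℚ.* ℕ→ℚ (n C 2)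
density-bounds n s k s≤ =
  (begin
    p ℚ.* c                  ≡⟨ ℚ.+-identityʳ (p ℚ.* c) ⟨
    p ℚ.* c ℚ.+ 0ℚ           ≤⟨ ℚ.+-monoʳ-≤ (p ℚ.* c) 0≤w*u ⟩
    p ℚ.* c ℚ.+ w ℚ.* u      ≡⟨ E≡ ⟨
    seq (Ent (twoPart n)) k  ∎) ,
  (begin
    seq (Ent (twoPart n)) k    ≡⟨ E≡ ⟩
    p ℚ.* c ℚ.+ w ℚ.* u        ≤⟨ ℚ.+-monoʳ-≤ (p ℚ.* c) w*u≤ ⟩
    p ℚ.* c ℚ.+ 1/suc s ℚ.* c  ≡⟨ ℚ.*-distribʳ-+ c p (1/suc s) ⟨
    (p ℚ.+ 1/suc s) ℚ.* c      ∎)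
  where
  Q = n ^ 2 / 4
  z = 2 * Q ∸ n C 2
  c = ℕ→ℚ (n C 2)
  q = ℕ→ℚ Q
  l = log₃ k
  w = q ℚ.- ½ ℚ.* c
  u = 1ℚ ℚ.- l
  open ℚSolver.+-*-Solver
  p = ½ ℚ.+ ½ ℚ.* l
  E≡ : seq (Ent (twoPart n)) k ≡ p ℚ.* c ℚ.+ w ℚ.* u
  E≡ = trans (Ent-twoPart n k)
    (solve 3 (λ c q l → c :* l :+ q :* (con 1ℚ :- l)
                := (con ½ :+ con ½ :* l) :* c :+ (q :- con ½ :* c) :* (con 1ℚ :- l)) refl c q l)
  open ℚ.≤-Reasoning
  half : ∀ p → p ≡ ½ ℚ.* (p ℚ.+ p)
  half p = solve 1 (λ p → p := con ½ :* (p :+ p)) refl p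
  0≤w : 0ℚ ℚ.≤ w
  0≤w = ≤⇒0≤- (subst (½ ℚ.* c ℚ.≤_) (sym (half q)) (ℚ.*-monoˡ-≤-nonNeg ½
    (subst (c ℚ.≤_) (2*ℕ→ℚ Q) (ℕ→ℚ-mono (n C 2) (2 * Q) (C2≤2*quarter n)))))
  w≤ : w ℚ.≤ 1/suc s ℚ.* c
  w≤ = ≤+⇒-≤ (begin
    q
      ≡⟨ trans (half q) (cong (½ ℚ.*_) (sym (2*ℕ→ℚ Q))) ⟩
    ½ ℚ.* ℕ→ℚ (2 * Q)
      ≤⟨ ℚ.*-monoˡ-≤-nonNeg ½ (ℕ→ℚ-mono (2 * Q) (n C 2 + z) (m≤n+m∸n (2 * Q) (n C 2))) ⟩
    ½ ℚ.* ℕ→ℚ (n C 2 + z)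
      ≡⟨ cong (½ ℚ.*_) (ℕ→ℚ-+ (n C 2) z) ⟩
    ½ ℚ.* (c ℚ.+ ℕ→ℚ z)
      ≤⟨ ℚ.*-monoˡ-≤-nonNeg ½ (ℚ.+-monoʳ-≤ c (≤1/suc⇒≤* (2 * Q ∸ n C 2) (2 * (n C 2)) s (quarter-excess n s s≤))) ⟩
    ½ ℚ.* (c ℚ.+ 1/suc s ℚ.* ℕ→ℚ (2 * (n C 2)))
      ≡⟨ cong (λ p → ½ ℚ.* (c ℚ.+ 1/suc s ℚ.* p)) (2*ℕ→ℚ (n C 2)) ⟩
    ½ ℚ.* (c ℚ.+ 1/suc s ℚ.* (c ℚ.+ c))
      ≡⟨ solve 2 (λ c v → con ½ :* (c :+ v :* (c :+ c)) := con ½ :* c :+ v :* c) refl c (1/suc s) ⟩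
    ½ ℚ.* c ℚ.+ 1/suc s ℚ.* c ∎)
  0≤w*u : 0ℚ ℚ.≤ w ℚ.* u
  0≤w*u = subst (ℚ._≤ w ℚ.* u) (ℚ.*-zeroˡ u) (≤-scale (≤⇒0≤- (log₃≤1 k)) 0≤w)
  w*u≤ : w ℚ.* u ℚ.≤ 1/suc s ℚ.* c
  w*u≤ = begin
    w ℚ.* u        ≤⟨ ℚ.*-monoˡ-≤-nonNeg w {{ℚ.nonNegative 0≤w}} u≤1 ⟩
    w ℚ.* 1ℚ       ≡⟨ ℚ.*-identityʳ w ⟩
    w              ≤⟨ w≤ ⟩
    1/suc s ℚ.* c  ∎
    where
    u≤1 : u ℚ.≤ 1ℚ
    u≤1 = subst (u ℚ.≤_) (ℚ.+-identityʳ 1ℚ) (ℚ.+-monoʳ-≤ 1ℚ (ℚ.neg-antimono-≤ (0≤log₃ k)))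

-- From two vertices on, the divisor is a successor, so `÷ℕ` is true division and not its default
-- value 0.
0<C2 : ∀ n → 2 ≤ n → ∃[ m ] n C 2 ≡ suc m
0<C2 (suc zero)    (s≤s ())
0<C2 (suc (suc n)) _ = _ , suc-C2 (suc n)

÷ℕ-dist : ∀ x p {C s k m} → C ≡ suc m → p ℚ.* ℕ→ℚ C ℚ.≤ seq x k → seq x k ℚ.≤ (p ℚ.+ 1/suc s) ℚ.* ℕ→ℚ C →
  ℚ.∣ seq (x ÷ℕ C) k ℚ.- p ∣ ℚ.≤ 1/suc s
÷ℕ-dist x p {s = s} {k} {m} refl lower upper = ≤⇒dist≤ (i ℚ.* seq x k) p
  (≤+⇒-≤ (subst (i ℚ.* seq x k ℚ.≤_) (cancel (p ℚ.+ 1/suc s)) (ℚ.*-monoˡ-≤-nonNeg i upper)))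
  (≤+⇒-≤ (ℚ.≤-trans (subst (ℚ._≤ i ℚ.* seq x k) (cancel p) (ℚ.*-monoˡ-≤-nonNeg i lower))
    (subst (ℚ._≤ i ℚ.* seq x k ℚ.+ 1/suc s) (ℚ.+-identityʳ (i ℚ.* seq x k)) (ℚ.+-monoʳ-≤ (i ℚ.* seq x k) (0≤1/suc s)))))
  where
  i = 1/suc m
  instance
    i≥0 : ℚ.NonNegative i
    i≥0 = ℚ.nonNegative (0≤1/suc m)
  cancel : ∀ r → i ℚ.* (r ℚ.* ℕ→ℚ (suc m)) ≡ r
  cancel r = begin
    i ℚ.* (r ℚ.* ℕ→ℚ (suc m))  ≡⟨ solve 3 (λ i r c → i :* (r :* c) := (i :* c) :* r) refl i r (ℕ→ℚ (suc m)) ⟩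
    i ℚ.* ℕ→ℚ (suc m) ℚ.* r    ≡⟨ cong (ℚ._* r) (1/suc*suc≡1 m) ⟩
    1ℚ ℚ.* r                   ≡⟨ ℚ.*-identityˡ r ⟩
    r                          ∎
    where
    open ≡-Reasoning
    open ℚSolver.+-*-Solver

density-limit : (λ n → Ent (twoPart n) ÷ℕ (n C 2)) ⟶ density
density-limit ε ε>0 =
  let N , 1/N≤ε = ℚ-archimedean ε ε>0
      -- This makes `1/suc s` equal to `1 / (2 * suc N)`, the quantity bounded by `ℚ-archimedean`.
      s = pred-2* N
  in suc (suc (suc s)) , λ n n≥ → ≤⇒≤ᴿ {∣ Ent (twoPart n) ÷ℕ (n C 2) -ᴿ density ∣ᴿ} {fromℚ ε} λ k →
    let lower , upper = density-bounds n s k (≤-trans (n≤1+n (suc s)) (≤-trans (∸-monoˡ-≤ 1 n≥) (m≤m+n (n ∸ 1) _)))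
        C≡suc = proj₂ (0<C2 n (≤-trans (s≤s (s≤s z≤n)) n≥))
    in ℚ.≤-trans (÷ℕ-dist (Ent (twoPart n)) (seq density k) {s = s} C≡suc lower upper) (1/N≤ε N ≤-refl)

entropyDensity : ∃ (IsEntropyDensity NoDK₃)
entropyDensity = density , (λ n → Ent (twoPart n)) , isEx-twoPart , density-limit

-- Comparing the count with the entropy

pairsInside : ℕ → ℕ
pairsInside n = n C 2 ∸ n ^ 2 / 4

pairsInside+quarter : ∀ n → pairsInside n + n ^ 2 / 4 ≡ n C 2
pairsInside+quarter n = trans
  (sym (cong₂ _+_ (noncrossing-alternating n) (crossing-alternating n)))
  (noncrossing+crossing (alternating n))

mainTerm : ℕ → ℝ
mainTerm n = log₄ (3 ^ pairsInside n) +ᴿ fromℕ (n ^ 2 / 4)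

numDK₃Free>0 : ∀ n → 0 < numDK₃Free n
numDK₃Free>0 n = <-≤-trans
  (*-mono-≤ {1} {3 ^ pairsInside n} {1} {4 ^ (n ^ 2 / 4)} (m^n>0 3 (pairsInside n)) (m^n>0 4 (n ^ 2 / 4)))
  (numDK₃Free≥ n)

mainTerm≤ : ∀ n k → seq (mainTerm n) k ℚ.≤ log₄-approx (numDK₃Free n) k
mainTerm≤ n k = begin
  log₄-approx m k ℚ.+ ℕ→ℚ q
    ≡⟨ cong (log₄-approx m k ℚ.+_) (log₄-approx-4^ q k) ⟨
  log₄-approx m k ℚ.+ log₄-approx (4 ^ q) k
    ≤⟨ log₄-approx-*-lower m (4 ^ q) k {{m^n≢0 3 (pairsInside n)}} {{m^n≢0 4 q}} ⟩
  log₄-approx (m * 4 ^ q) k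
    ≤⟨ log₄-approx-mono k (numDK₃Free≥ n) ⟩
  log₄-approx (numDK₃Free n) k ∎
  where
  open ℚ.≤-Reasoning
  q = n ^ 2 / 4
  m = 3 ^ pairsInside n

≤mainTerm+ : ∀ n e k → numDK₃Free n ≤ 3 ^ pairsInside n * 4 ^ (n ^ 2 / 4) * 4 ^ e →
  log₄-approx (numDK₃Free n) k ℚ.≤ seq (mainTerm n) k ℚ.+ (ℕ→ℚ e ℚ.+ tol k)
≤mainTerm+ n e k h = begin
  log₄-approx (numDK₃Free n) k
    ≤⟨ log₄-approx-mono k h ⟩
  log₄-approx (m * 4 ^ q * 4 ^ e) k
    ≡⟨ cong (λ i → log₄-approx i k) m*4^q*4^e ⟩
  log₄-approx (m * 4 ^ (q + e)) k
    ≤⟨ log₄-approx-*-upper m (4 ^ (q + e)) k {{m^n≢0 3 (pairsInside n)}} {{m^n≢0 4 (q + e)}} ⟩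
  l ℚ.+ log₄-approx (4 ^ (q + e)) k ℚ.+ tol k
    ≡⟨ cong (λ i → l ℚ.+ i ℚ.+ tol k) (trans (log₄-approx-4^ (q + e) k) (ℕ→ℚ-+ q e)) ⟩
  l ℚ.+ (ℕ→ℚ q ℚ.+ ℕ→ℚ e) ℚ.+ tol k
    ≡⟨ solve 4 (λ l q e t → l :+ (q :+ e) :+ t := (l :+ q) :+ (e :+ t)) refl l (ℕ→ℚ q) (ℕ→ℚ e) (tol k) ⟩
  seq (mainTerm n) k ℚ.+ (ℕ→ℚ e ℚ.+ tol k) ∎
  where
  open ℚ.≤-Reasoning
  open ℚSolver.+-*-Solver
  q = n ^ 2 / 4
  m = 3 ^ pairsInside n
  l = log₄-approx m k
  m*4^q*4^e : m * 4 ^ q * 4 ^ e ≡ m * 4 ^ (q + e)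
  m*4^q*4^e = trans (*-assoc m (4 ^ q) (4 ^ e)) (cong (m *_) (sym (^-distribˡ-+-* 4 q e)))

0≤tol : ∀ k → 0ℚ ℚ.≤ tol k
0≤tol k = 0≤1/suc (pred-2* k)

numDK₃Free-mainTerm : ∀ ε → 0ℚ ℚ.< ε → ∃[ N ] ∀ n → N ≤ n → ∀ k →
  ℚ.∣ log₄-approx (numDK₃Free n) k ℚ.- seq (mainTerm n) k ∣ ℚ.≤ ε ℚ.* ℕ→ℚ (n ^ 2) ℚ.+ tol k
numDK₃Free-mainTerm ε ε>0 =
  let K , 1/K≤ε = ℚ-archimedean ε ε>0
      -- Here `r` is `2 * suc K`, so `1 / r` is at most `ε`.
      N , bound = numDK₃Free≤ (suc (pred-2* K))
  in N , λ n N≤n k →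
    let e , small , A≤ = bound n N≤n in
    ≤⇒dist≤ (log₄-approx (numDK₃Free n) k) (seq (mainTerm n) k)
      (≤+⇒-≤ (ℚ.≤-trans (≤mainTerm+ n e k A≤)
        (ℚ.+-monoʳ-≤ (seq (mainTerm n) k) (ℚ.+-monoˡ-≤ (tol k) (e≤ n e (pred-2* K) (1/K≤ε K ≤-refl) small)))))
      (≤+⇒-≤ (ℚ.≤-trans (mainTerm≤ n k) (subst (ℚ._≤ log₄-approx (numDK₃Free n) k ℚ.+ (ε ℚ.* ℕ→ℚ (n ^ 2) ℚ.+ tol k))
        (ℚ.+-identityʳ (log₄-approx (numDK₃Free n) k)) (ℚ.+-monoʳ-≤ (log₄-approx (numDK₃Free n) k) (nonneg n k)))))
  where
  e≤ : ∀ n e s → 1/suc s ℚ.≤ ε → suc s * e ≤ n ^ 2 → ℕ→ℚ e ℚ.≤ ε ℚ.* ℕ→ℚ (n ^ 2)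
  e≤ n e s 1/s≤ε small = ℚ.≤-trans (≤1/suc⇒≤* e (n ^ 2) s (subst (_≤ n ^ 2) (*-comm (suc s) e) small))
    (≤-scale (0≤ℕ→ℚ (n ^ 2)) 1/s≤ε)
  nonneg : ∀ n k → 0ℚ ℚ.≤ ε ℚ.* ℕ→ℚ (n ^ 2) ℚ.+ tol k
  nonneg n k = ℚ.+-mono-≤
    (subst (ℚ._≤ ε ℚ.* ℕ→ℚ (n ^ 2)) (ℚ.*-zeroˡ (ℕ→ℚ (n ^ 2))) (≤-scale (0≤ℕ→ℚ (n ^ 2)) (ℚ.<⇒≤ ε>0)))
    (0≤tol k)

-- As reals the two are equal. At stage `k` they differ since the logarithm of `3 ^ a` is rounded
-- once on one side, while on the other the rounding error of log₄ 3 is multiplied by `a`.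
mainTerm-entropy : ∀ n k → ℚ.∣ seq (mainTerm n) k ℚ.- seq (Ent (twoPart n)) k ∣ ℚ.≤ ℕ→ℚ (pairsInside n) ℚ.* tol k
mainTerm-entropy n k = ≤⇒dist≤ M E
  (≤+⇒-≤ (begin
    m ℚ.+ ℕ→ℚ q
      ≤⟨ ℚ.+-monoˡ-≤ (ℕ→ℚ q) (log₄-approx-^-upper 3 a k) ⟩
    (x ℚ.* l ℚ.+ x ℚ.* t) ℚ.+ ℕ→ℚ q
      ≡⟨ solve 3 (λ u v w → (u :+ v) :+ w := (u :+ w) :+ v) refl (x ℚ.* l) (x ℚ.* t) (ℕ→ℚ q) ⟩
    (x ℚ.* l ℚ.+ ℕ→ℚ q) ℚ.+ x ℚ.* t
      ≡⟨ cong (ℚ._+ x ℚ.* t) E≡ ⟨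
    E ℚ.+ x ℚ.* t ∎))
  (≤+⇒-≤ (begin
    E                           ≡⟨ trans E≡ (sym (ℚ.+-identityʳ _)) ⟩
    (x ℚ.* l ℚ.+ ℕ→ℚ q) ℚ.+ 0ℚ  ≤⟨ ℚ.+-mono-≤ (ℚ.+-monoˡ-≤ (ℕ→ℚ q) (log₄-approx-^-lower 3 a k)) 0≤xt ⟩
    M ℚ.+ x ℚ.* t               ∎))
  where
  open ℚ.≤-Reasoning
  open ℚSolver.+-*-Solver
  q = n ^ 2 / 4
  a = pairsInside n
  M = seq (mainTerm n) k
  E = seq (Ent (twoPart n)) k
  x = ℕ→ℚ a
  l = log₃ k
  t = tol k
  m = log₄-approx (3 ^ a) k
  0≤xt : 0ℚ ℚ.≤ x ℚ.* t
  0≤xt = subst (ℚ._≤ x ℚ.* t) (ℚ.*-zeroˡ t) (≤-scale (0≤tol k) (0≤ℕ→ℚ a))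
  E≡ : E ≡ x ℚ.* l ℚ.+ ℕ→ℚ q
  E≡ = trans (Ent-twoPart n k) (trans
    (cong (λ N → N ℚ.* l ℚ.+ ℕ→ℚ q ℚ.* (1ℚ ℚ.- l)) (trans (cong ℕ→ℚ (sym (pairsInside+quarter n))) (ℕ→ℚ-+ a q)))
    (solve 3 (λ x q l → (x :+ q) :* l :+ q :* (con 1ℚ :- l) := x :* l :+ q) refl x (ℕ→ℚ q) l))

÷ℕ-undo : ∀ x p {c k m δ} → c ≡ suc m → ℚ.∣ seq (x ÷ℕ c) k ℚ.- p ∣ ℚ.≤ δ →
  ℚ.∣ seq x k ℚ.- ℕ→ℚ c ℚ.* p ∣ ℚ.≤ δ ℚ.* ℕ→ℚ c
÷ℕ-undo x p {k = k} {m} {δ} refl h = begin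
  ℚ.∣ y ℚ.- c ℚ.* p ∣
    ≡⟨ cong (λ o → ℚ.∣ o ℚ.- c ℚ.* p ∣) (sym i*c*y) ⟩
  ℚ.∣ i ℚ.* c ℚ.* y ℚ.- c ℚ.* p ∣
    ≡⟨ cong ℚ.∣_∣ (solve 4 (λ i c y p → i :* c :* y :- c :* p := (i :* y :- p) :* c) refl i c y p) ⟩
  ℚ.∣ (i ℚ.* y ℚ.- p) ℚ.* c ∣
    ≡⟨ ℚ.∣p*q∣≡∣p∣*∣q∣ (i ℚ.* y ℚ.- p) c ⟩
  ℚ.∣ i ℚ.* y ℚ.- p ∣ ℚ.* ℚ.∣ c ∣
    ≡⟨ cong (ℚ.∣ i ℚ.* y ℚ.- p ∣ ℚ.*_) (ℚ.0≤p⇒∣p∣≡p (0≤ℕ→ℚ (suc m))) ⟩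
  ℚ.∣ i ℚ.* y ℚ.- p ∣ ℚ.* c
    ≤⟨ ≤-scale (0≤ℕ→ℚ (suc m)) h ⟩
  δ ℚ.* c ∎
  where
  open ℚ.≤-Reasoning
  open ℚSolver.+-*-Solver
  i = 1/suc m
  c = ℕ→ℚ (suc m)
  y = seq x k
  i*c*y : i ℚ.* c ℚ.* y ≡ y
  i*c*y = trans (cong (ℚ._* y) (1/suc*suc≡1 m)) (ℚ.*-identityˡ y)

C2≤n² : ∀ n → n C 2 ≤ n ^ 2
C2≤n² n = subst (n C 2 ≤_) (2*nC2+n≡n² n) (≤-trans (m≤m+n (n C 2) (n C 2 + 0)) (m≤m+n (2 * (n C 2)) n))

module _ {π} (isDensity : IsEntropyDensity NoDK₃ π) where

  private
    ex = proj₁ isDensity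

  -- A chain of four distances: from the count to the main term, to the entropy of `twoPart n`, to
  -- the given maximum `ex n`, and to `n C 2` times the given density.
  numDK₃Free-density : ∀ ε → 0ℚ ℚ.< ε → ∃[ N ] ∀ n → N ≤ n → ∀ δ → 0ℚ ℚ.< δ → ∃[ K ] ∀ k → K ≤ k →
    ℚ.∣ log₄-approx (numDK₃Free n) k ℚ.- ℕ→ℚ (n C 2) ℚ.* seq π k ∣ ℚ.≤ ε ℚ.* ℕ→ℚ (n ^ 2) ℚ.+ δ
  numDK₃Free-density ε ε>0 =
    -- Half of `ε` goes to the main term. A quarter goes to the convergence to `π` and another
    -- quarter to the slack hidden in `≤ᴿ`; these two are multiplied by `n C 2`, which is at most
    -- `n ^ 2`.
    let η = ½ ℚ.* ε ; η>0 = ½-pos ε>0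
        ζ = ½ ℚ.* η ; ζ>0 = ½-pos η>0
        N₁ , near-main = numDK₃Free-mainTerm η η>0
        N₂ , near-π = proj₂ (proj₂ isDensity) ζ ζ>0
    in N₁ ⊔ N₂ ⊔ 2 , λ n n≥ δ δ>0 →
      let n≥N = m⊔n≤o⇒m≤o (N₁ ⊔ N₂) 2 n≥
          δ′>0 = ½-pos δ>0
          m , C≡ = 0<C2 n (m⊔n≤o⇒n≤o (N₁ ⊔ N₂) 2 n≥)
          -- One `tol k` comes from `near-main` and `pairsInside n` of them from `mainTerm-entropy`.
          K₁ , tol≤ = multiple-tol (suc (pairsInside n)) (½ ℚ.* δ) δ′>0
          K₂ , near-ex = isEx-unique {n} {ex n} (proj₁ (proj₂ isDensity) n) (½ ℚ.* δ) δ′>0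
          K₃ , near-π′ = near-π n (m⊔n≤o⇒n≤o N₁ N₂ n≥N) ζ ζ>0
      in K₁ ⊔ K₂ ⊔ K₃ , λ k k≥ →
        let k≥K = m⊔n≤o⇒m≤o (K₁ ⊔ K₂) K₃ k≥
            L = log₄-approx (numDK₃Free n) k
            M = seq (mainTerm n) k
            E = seq (Ent (twoPart n)) k
            X = seq (ex n) k
            P = ℕ→ℚ (n C 2) ℚ.* seq π k
        in ℚ.≤-trans
          (dist-triangle L M P (near-main n (m⊔n≤o⇒m≤o N₁ N₂ n≥N) k)
            (dist-triangle M E P (mainTerm-entropy n k)
              (dist-triangle E X P (near-ex k (m⊔n≤o⇒n≤o K₁ K₂ k≥K))
                (÷ℕ-undo (ex n) (seq π k) C≡ (near-π′ k (m⊔n≤o⇒n≤o (K₁ ⊔ K₂) K₃ k≥))))))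
          (collect n δ (tol k) (tol≤ k (m⊔n≤o⇒m≤o K₁ K₂ k≥K)))
    where
    collect : ∀ n δ t → ℕ→ℚ (suc (pairsInside n)) ℚ.* t ℚ.≤ ½ ℚ.* δ →
      let η = ½ ℚ.* ε ; s = ℕ→ℚ (n ^ 2) in
      (η ℚ.* s ℚ.+ t) ℚ.+ (ℕ→ℚ (pairsInside n) ℚ.* t ℚ.+ (½ ℚ.* δ ℚ.+ (½ ℚ.* η ℚ.+ ½ ℚ.* η) ℚ.* ℕ→ℚ (n C 2)))
        ℚ.≤ ε ℚ.* s ℚ.+ δ
    collect n δ t h = begin
      (η ℚ.* s ℚ.+ t) ℚ.+ (a ℚ.* t ℚ.+ (½ ℚ.* δ ℚ.+ (½ ℚ.* η ℚ.+ ½ ℚ.* η) ℚ.* c))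
        ≡⟨ cong (λ z → (η ℚ.* s ℚ.+ t) ℚ.+ (a ℚ.* t ℚ.+ (½ ℚ.* δ ℚ.+ z ℚ.* c))) (½+½ η) ⟩
      (η ℚ.* s ℚ.+ t) ℚ.+ (a ℚ.* t ℚ.+ (½ ℚ.* δ ℚ.+ η ℚ.* c))
        ≡⟨ solve 5 (λ u t a d v → (u :+ t) :+ (a :* t :+ (d :+ v)) := (u :+ v) :+ ((a :+ con 1ℚ) :* t :+ d)) refl
             (η ℚ.* s) t a (½ ℚ.* δ) (η ℚ.* c) ⟩
      (η ℚ.* s ℚ.+ η ℚ.* c) ℚ.+ ((a ℚ.+ 1ℚ) ℚ.* t ℚ.+ ½ ℚ.* δ)
        ≡⟨ cong (λ z → (η ℚ.* s ℚ.+ η ℚ.* c) ℚ.+ (z ℚ.* t ℚ.+ ½ ℚ.* δ)) (/-suc (pairsInside n) 0) ⟨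
      (η ℚ.* s ℚ.+ η ℚ.* c) ℚ.+ (ℕ→ℚ (suc (pairsInside n)) ℚ.* t ℚ.+ ½ ℚ.* δ)
        ≤⟨ ℚ.+-mono-≤ (ℚ.+-monoʳ-≤ (η ℚ.* s) (ℚ.*-monoˡ-≤-nonNeg η {{ℚ.nonNegative (ℚ.<⇒≤ (½-pos ε>0))}}
                        (ℕ→ℚ-mono (n C 2) (n ^ 2) (C2≤n² n))))
                      (ℚ.+-monoˡ-≤ (½ ℚ.* δ) h) ⟩
      (η ℚ.* s ℚ.+ η ℚ.* s) ℚ.+ (½ ℚ.* δ ℚ.+ ½ ℚ.* δ)
        ≡⟨ cong₂ ℚ._+_ (trans (sym (ℚ.*-distribʳ-+ s η η)) (cong (ℚ._* s) (½+½ ε))) (½+½ δ) ⟩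
      ε ℚ.* s ℚ.+ δ ∎
      where
      open ℚ.≤-Reasoning
      open ℚSolver.+-*-Solver
      η = ½ ℚ.* ε
      s = ℕ→ℚ (n ^ 2)
      a = ℕ→ℚ (pairsInside n)
      c = ℕ→ℚ (n C 2)

-- The error term is taken to be the difference of the two sides, so the equation is a rearrangement
-- and the content lies in the error being o(n²).
numDK₃Free-≈ : (M : ℕ → ℕ) (x : ℕ → ℝ) → (∀ n → 0 < M n) →
  (λ n → log₄ (numDK₃Free n) -ᴿ (log₄ (M n) +ᴿ x n)) ≪ (λ n → n ^ 2) →
  ∃[ g ] (g ≪ (λ n → n ^ 2)) × (∀ n → numDK₃Free n ≈ M n ·4^ (x n +ᴿ g n))
numDK₃Free-≈ M x M>0 small = g , small , λ n → numDK₃Free>0 n , M>0 n ,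
  ≡⇒≃ᴿ {log₄ (numDK₃Free n)} {log₄ (M n) +ᴿ (x n +ᴿ g n)} λ k →
    solve 3 (λ a m x → a := m :+ (x :+ (a :- (m :+ x)))) refl
      (log₄-approx (numDK₃Free n) k) (log₄-approx (M n) k) (seq (x n) k)
  where
  open ℚSolver.+-*-Solver
  g : ℕ → ℝ
  g n = log₄ (numDK₃Free n) -ᴿ (log₄ (M n) +ᴿ x n)

corollary4p4 : ∃ (IsEntropyDensity NoDK₃) ×
    ((π : ℝ) → IsEntropyDensity NoDK₃ π →
    (∃[ g ] (g ≪ (λ n → n ^ 2)) ×
    ((n : ℕ) → numDK₃Free n ≈ 1 ·4^ (ℕ→ℚ (n C 2) ·ᴿ π +ᴿ g n)))
    ×
    (∃[ h ] (h ≪ (λ n → n ^ 2)) ×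
    ((n : ℕ) → numDK₃Free n ≈ 3 ^ ((n C 2) ∸ n ^ 2 / 4) ·4^ (fromℕ (n ^ 2 / 4) +ᴿ h n))))
corollary4p4 = entropyDensity , λ π isDensity →
  numDK₃Free-≈ (λ _ → 1) (λ n → ℕ→ℚ (n C 2) ·ᴿ π) (λ _ → z<s) (λ ε ε>0 →
    let N , near = numDK₃Free-density {π} isDensity ε ε>0
    in N , λ n n≥N δ δ>0 →
      let K , near-k = near n n≥N δ δ>0
      in K , λ k k≥K → subst (λ y → ℚ.∣ log₄-approx (numDK₃Free n) k ℚ.- y ∣ ℚ.≤ ε ℚ.* ℕ→ℚ (n ^ 2) ℚ.+ δ)
        -- The factor in front is 1, so its vanishing logarithm has to be inserted.
        (log₁+ k (ℕ→ℚ (n C 2) ℚ.* seq π k)) (near-k k k≥K)) ,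
  numDK₃Free-≈ (λ n → 3 ^ pairsInside n) (λ n → fromℕ (n ^ 2 / 4)) (λ n → m^n>0 3 (pairsInside n)) (λ ε ε>0 →
    let N , near = numDK₃Free-mainTerm ε ε>0
    in N , λ n n≥N δ δ>0 →
      let K , tol≤δ = ℚ-archimedean δ δ>0
      in K , λ k k≥K → ℚ.≤-trans (near n n≥N k) (ℚ.+-monoʳ-≤ (ε ℚ.* ℕ→ℚ (n ^ 2)) (tol≤δ k k≥K)))
  where
  log₁+ : ∀ k y → y ≡ log₄-approx 1 k ℚ.+ y
  log₁+ k y = trans (sym (ℚ.+-identityˡ y)) (cong (ℚ._+ y) (sym (log₄-approx-4^≡ {1} 0 k refl)))
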